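{- Let $\mathfrak{k}=(K_{\mathfrak{k}},\le_{\mathfrak{k}})$ be an abstract elementary class. (1) Assume $\kappa>\theta>\mathrm{LST}_{\mathfrak{k}}$, $\theta$ is a measurable cardinal and $\kappa$ is weakly compact. Then $\mathfrak{k}$ has $(\kappa,\theta)$-amalgamation bases. (2) Assume $\kappa,\theta$ are measurable cardinals $>\mathrm{LST}_{\mathfrak{k}}$ and $\mu>\kappa+\theta$ is a strong limit singular cardinal of cofinality $\kappa$. Then $\mathfrak{k}$ has $(\mu,\theta)$-amalgamation bases. (3) If $\kappa>\theta>\mathrm{LST}_{\mathfrak{k}}$, $\theta$ is a measurable cardinal and $\{M\in K^{\mathfrak{k}}_\kappa: M$ is a $(\chi_1,\chi_2)$-amalgamation base$\}$ is $\le_{\mathfrak{k}}$-dense in $K^{\mathfrak{k}}_\kappa$ (i.e. every $M \in K^{\mathfrak k}_\kappa$ has a $\le_{\mathfrak k}$-extension in this set), then $\mathfrak{k}$ has $((\chi_1,\chi_2),\kappa,\theta)$-amalgamation bases.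
   Context: $\mathfrak{k}=(K_{\mathfrak{k}},\le_{\mathfrak{k}})$ is an abstract elementary class (a.e.c.) in a vocabulary $\tau_{\mathfrak{k}}$; an empty model, which is $\le_{\mathfrak{k}}$ every member, is allowed. $\mathrm{LST}_{\mathfrak{k}}$ is its Löwenheim–Skolem–Tarski number (taken to be $\ge|\tau_{\mathfrak{k}}|+\aleph_0$). $K^{\mathfrak{k}}_\lambda=\{M\in K_{\mathfrak{k}}:\|M\|=\lambda\}$. $M_0\in K_{\mathfrak{k}}$ is a $(\chi_1,\chi_2)$-amalgamation base (where $\chi_1,\chi_2\ge\|M_0\|$) if whenever $M_0\le_{\mathfrak{k}}M_\ell\in K^{\mathfrak{k}}_{\chi_\ell}$ for $\ell=1,2$, there is $M_3\in K_{\mathfrak{k}}$ with $M_0\le_{\mathfrak{k}}M_3$ such that both $M_1$ and $M_2$ can be $\le_{\mathfrak{k}}$-embedded into $M_3$ over $M_0$. For a regular cardinal $\theta$, the $\theta$-majority of $M\in K^{\mathfrak{k}}_\lambda$ satisfies a property $\psi$ if there is a function $F$ such that: (a) $\mathrm{Dom}(F)=\{M\in K_{\mathfrak{k}}: M$ has universe an ordinal in $[\lambda,\lambda^+)\}$; (b) if $M\in\mathrm{Dom}(F)$ then $M\le_{\mathfrak{k}}F(M)\in\mathrm{Dom}(F)$; (c) if $\langle M_\alpha:\alpha\le\theta\rangle$ is $\le_{\mathfrak{k}}$-increasing continuous, each $M_\alpha\in\mathrm{Dom}(F)$, and $M_{2\alpha+2}=F(M_{2\alpha+1})$ for every $\alpha<\theta$,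 then $M_\theta$ satisfies $\psi$. $\mathfrak{k}$ has $((\chi_1,\chi_2),\lambda,\theta)$-amalgamation bases if the $\theta$-majority of $M\in K^{\mathfrak{k}}_\lambda$ are $(\chi_1,\chi_2)$-amalgamation bases; $\mathfrak{k}$ has $(\lambda,\theta)$-amalgamation bases if it has $((\lambda,\lambda),\lambda,\theta)$-amalgamation bases. -}

module Defs where

open import Axiom.ExcludedMiddle using (ExcludedMiddle)
open import Data.Empty.Polymorphic using (⊥)
open import Data.Product using (∃; ∃!; _×_; proj₁; proj₂)
open import Data.Sum using (_⊎_)
open import Function.Bundles using (_⇔_)
open import Level using (Level; suc)
open import Relation.Binary.PropositionalEquality using (_≡_; _≢_; refl)
open import Relation.Nullary using (¬_)

-- A universe of sets.  Classes are arbitrary predicates V → Set ℓ, and the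
-- separation and replacement schemes range over all of them.  Excluded middle
-- is part of the structure because the ambient logic of ZFC is classical; as
-- ∃ is Σ here, it also makes existence statements over V classical.

record ZFC (ℓ : Level) : Set (suc ℓ) where
  infix 4 _∈_
  field
    em  : ExcludedMiddle ℓ
    V   : Set ℓ
    _∈_ : V → V → Set ℓ

    extensionality : ∀ x y → (∀ z → z ∈ x ⇔ z ∈ y) → x ≡ y
    foundation     : ∀ x → (∃ λ y → y ∈ x) →
                     ∃ λ y → y ∈ x × (∀ z → z ∈ y → ¬ z ∈ x)
    pairing        : ∀ x y → ∃ λ p → ∀ z → z ∈ p ⇔ (z ≡ x ⊎ z ≡ y)
    union          : ∀ x → ∃ λ u → ∀ z → z ∈ u ⇔ (∃ λ y → y ∈ x × z ∈ y)
    power          : ∀ x → ∃ λ p → ∀ z → z ∈ p ⇔ (∀ y → y ∈ z → y ∈ x)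
    separation     : ∀ (P : V → Set ℓ) x →
                     ∃ λ s → ∀ z → z ∈ s ⇔ (z ∈ x × P z)
    replacement    : ∀ (R : V → V → Set ℓ) x →
                     (∀ y → y ∈ x → ∀ z z′ → R y z → R y z′ → z ≡ z′) →
                     ∃ λ r → ∀ z → z ∈ r ⇔ (∃ λ y → y ∈ x × R y z)
    infinity       : ∃ λ i → (∃ λ e → e ∈ i × (∀ z → ¬ z ∈ e)) ×
                     (∀ x → x ∈ i →
                      ∃ λ y → y ∈ i × (∀ z → z ∈ y ⇔ (z ∈ x ⊎ z ≡ x)))
    choice         : ∀ x → (∀ y → y ∈ x → ∃ λ z → z ∈ y) →
                     (∀ y y′ → y ∈ x → y′ ∈ x →
                      (∃ λ z → z ∈ y × z ∈ y′) → y ≡ y′) →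
                     ∃ λ c → ∀ y → y ∈ x → ∃! _≡_ (λ z → z ∈ y × z ∈ c)

module SetTheory {ℓ : Level} (𝒵 : ZFC ℓ) where
  open ZFC 𝒵 public

  infix  4 _⊆_ _≈_ _≲_ _≺_
  infixl 6 _∪_ _∖_
  infixl 7 _×ₛ_
  infixl 8 _^ₛ_
  infixl 9 _′_

  _⊆_ : V → V → Set ℓ
  x ⊆ y = ∀ z → z ∈ x → z ∈ y

  sep : V → (V → Set ℓ) → V
  sep x P = proj₁ (separation P x)

  image : (V → V) → V → V
  image f x = proj₁ (replacement (λ y z → f y ≡ z) x
    (λ { y _ z z′ refl refl → refl }))

  ⋃ : V → V
  ⋃ x = proj₁ (union x)

  𝒫 : V → V
  𝒫 x = proj₁ (power x)

  ∅ : V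
  ∅ = sep (proj₁ infinity) (λ _ → ⊥)

  ｛_,_｝ : V → V → V
  ｛ x , y ｝ = proj₁ (pairing x y)

  ｛_｝ : V → V
  ｛ x ｝ = ｛ x , x ｝

  _∪_ : V → V → V
  x ∪ y = ⋃ ｛ x , y ｝

  _∖_ : V → V → V
  x ∖ y = sep x (λ z → ¬ z ∈ y)

  S : V → V
  S x = x ∪ ｛ x ｝

  ω : V
  ω = sep (proj₁ infinity)
          (λ n → ∀ i → ∅ ∈ i → (∀ x → x ∈ i → S x ∈ i) → n ∈ i)

  ⟨_,_⟩ : V → V → V
  ⟨ x , y ⟩ = ｛ ｛ x ｝ , ｛ x , y ｝ ｝

  π₁ π₂ : V → V
  π₁ p = ⋃ (sep (⋃ p) (λ x → ∃ λ y → p ≡ ⟨ x , y ⟩))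
  π₂ p = ⋃ (sep (⋃ p) (λ y → ∃ λ x → p ≡ ⟨ x , y ⟩))

  _×ₛ_ : V → V → V
  a ×ₛ b = ⋃ (image (λ x → image (λ y → ⟨ x , y ⟩) b) a)

  -- Functions that are sets.

  FunctionOn : V → V → Set ℓ
  FunctionOn f a = (∀ p → p ∈ f → ∃ λ x → ∃ λ y → x ∈ a × p ≡ ⟨ x , y ⟩)
                 × (∀ x → x ∈ a → ∃! _≡_ (λ y → ⟨ x , y ⟩ ∈ f))

  _′_ : V → V → V
  f ′ x = ⋃ (sep (⋃ (⋃ f)) (λ y → ⟨ x , y ⟩ ∈ f))

  _^ₛ_ : V → V → V
  a ^ₛ n = sep (𝒫 (n ×ₛ a))
               (λ f → FunctionOn f n × (∀ i → i ∈ n → f ′ i ∈ a))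

  -- Below, maps between sets and sequences indexed by ordinals are given by
  -- f : V → V, of which only the values on the intended domain matter; by
  -- replacement the restriction of f to a set is a set.

  Injective Surjective Bijective : (V → V) → V → V → Set ℓ
  Injective f x y  = (∀ z → z ∈ x → f z ∈ y)
                   × (∀ z z′ → z ∈ x → z′ ∈ x → f z ≡ f z′ → z ≡ z′)
  Surjective f x y = ∀ w → w ∈ y → ∃ λ z → z ∈ x × f z ≡ w
  Bijective f x y  = Injective f x y × Surjective f x y

  _≈_ _≲_ _≺_ : V → V → Set ℓ
  x ≈ y = ∃ λ f → Bijective f x y
  x ≲ y = ∃ λ f → Injective f x y
  x ≺ y = x ≲ y × ¬ x ≈ y

  -- Ordinals are von Neumann ordinals, so < is ∈ and ≤ is ⊆; cardinals are
  -- initial ordinals.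

  Transitive : V → Set ℓ
  Transitive x = ∀ y → y ∈ x → y ⊆ x

  Ordinal : V → Set ℓ
  Ordinal α = Transitive α × (∀ β → β ∈ α → Transitive β)

  Limit : V → Set ℓ
  Limit δ = Ordinal δ × ∅ ∈ δ × (∀ α → α ∈ δ → S α ∈ δ)

  Cardinal : V → Set ℓ
  Cardinal κ = Ordinal κ × (∀ α → α ∈ κ → ¬ α ≈ κ)

  InfiniteCardinal : V → Set ℓ
  InfiniteCardinal κ = Cardinal κ × ω ⊆ κ

  SuccessorCardinal : V → V → Set ℓ
  SuccessorCardinal κ κ⁺ = Cardinal κ⁺ × κ ∈ κ⁺
                         × (∀ ν → Cardinal ν → κ ∈ ν → κ⁺ ⊆ ν)

  -- Twice α β : β = 2 · α, the ordinal product, from the recursion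
  -- 2 · γ = sup { 2 · δ + 2 : δ < γ }.
  Twice : V → V → Set ℓ
  Twice α β = ∃ λ (d : V → V) →
      (∀ γ → γ ∈ S α → d γ ≡ ⋃ (image (λ δ → S (S (d δ))) γ))
    × β ≡ d α

  CofinalMap : (V → V) → V → V → Set ℓ
  CofinalMap f α μ = (∀ i → i ∈ α → f i ∈ μ)
                   × (∀ γ → γ ∈ μ → ∃ λ i → i ∈ α × γ ⊆ f i)

  Cofinality : V → V → Set ℓ
  Cofinality μ κ = Ordinal κ × (∃ λ f → CofinalMap f κ μ)
                 × (∀ α → α ∈ κ → ¬ (∃ λ f → CofinalMap f α μ))

  Regular : V → Set ℓ
  Regular κ = InfiniteCardinal κ × Cofinality κ κ

  Singular : V → Set ℓ
  Singular μ = InfiniteCardinal μ × (∃ λ κ → Cofinality μ κ × κ ∈ μ)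

  StrongLimit : V → Set ℓ
  StrongLimit μ = InfiniteCardinal μ
                × (∀ ν → Cardinal ν → ν ∈ μ → 𝒫 ν ≺ μ)

  Ultrafilter : V → V → Set ℓ
  Ultrafilter U a =
      U ⊆ 𝒫 a
    × a ∈ U
    × ¬ ∅ ∈ U
    × (∀ X Y → X ∈ U → Y ∈ U → sep X (_∈ Y) ∈ U)
    × (∀ X Y → X ∈ U → X ⊆ Y → Y ⊆ a → Y ∈ U)
    × (∀ X → X ⊆ a → X ∈ U ⊎ (a ∖ X) ∈ U)

  Nonprincipal : V → V → Set ℓ
  Nonprincipal U a = ∀ x → x ∈ a → ¬ ｛ x ｝ ∈ U

  Complete : V → V → V → Set ℓ
  Complete κ U a = ∀ β (X : V → V) → β ∈ κ → (∀ i → i ∈ β → X i ∈ U) →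
                   sep a (λ x → ∀ i → i ∈ β → x ∈ X i) ∈ U

  Measurable : V → Set ℓ
  Measurable κ = Cardinal κ × ω ∈ κ
    × (∃ λ U → Ultrafilter U κ × Nonprincipal U κ × Complete κ U κ)

  -- κ is uncountable and κ → (κ)²₂.  A colouring of [κ]² with two colours is
  -- given by the set c of pairs that receive the first colour.
  WeaklyCompact : V → Set ℓ
  WeaklyCompact κ = Cardinal κ × ω ∈ κ
    × (∀ c → ∃ λ H → H ⊆ κ × H ≈ κ
        × ( (∀ α β → α ∈ H → β ∈ H → α ≢ β → ｛ α , β ｝ ∈ c)
          ⊎ (∀ α β → α ∈ H → β ∈ H → α ≢ β → ¬ ｛ α , β ｝ ∈ c)))

  record Vocabulary : Set ℓ where
    field
      Sym Fun : V                 -- all symbols; the function symbols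
      Fun⊆Sym : Fun ⊆ Sym
      arity   : V → V
      arity∈ω : ∀ s → s ∈ Sym → arity s ∈ ω

  module Structures (τ : Vocabulary) where
    open Vocabulary τ public

    -- A τ-structure is a pair ⟨ A , I ⟩ of its universe and a function I on
    -- Sym: an n-ary relation symbol is sent to a subset of A ^ₛ n, an n-ary
    -- function symbol to a function from A ^ₛ n to A.  A may be empty.

    univ : V → V
    univ = π₁

    interp : V → V → V
    interp M s = π₂ M ′ s

    tuples : V → V → V
    tuples M s = univ M ^ₛ arity s

    Structure : V → Set ℓ
    Structure M =
        M ≡ ⟨ π₁ M , π₂ M ⟩
      × FunctionOn (π₂ M) Sym
      × (∀ s → s ∈ Sym → ¬ s ∈ Fun → interp M s ⊆ tuples M s)
      × (∀ s → s ∈ Fun → FunctionOn (interp M s) (tuples M s)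
                       × (∀ x → x ∈ tuples M s → interp M s ′ x ∈ univ M))

    _⊆ₘ_ : V → V → Set ℓ
    M ⊆ₘ N =
        Structure M × Structure N
      × univ M ⊆ univ N
      × (∀ s → s ∈ Sym → ¬ s ∈ Fun → ∀ x → x ∈ tuples M s →
           x ∈ interp M s ⇔ x ∈ interp N s)
      × (∀ s → s ∈ Fun → ∀ x → x ∈ tuples M s →
           interp M s ′ x ≡ interp N s ′ x)

    mapTuple : (V → V) → V → V → V
    mapTuple f n x = image (λ i → ⟨ i , f (x ′ i) ⟩) n

    Iso : (V → V) → V → V → Set ℓ
    Iso f M N =
        Structure M × Structure N
      × Bijective f (univ M) (univ N)
      × (∀ s → s ∈ Sym → ¬ s ∈ Fun → ∀ x → x ∈ tuples M s →
           x ∈ interp M s ⇔ mapTuple f (arity s) x ∈ interp N s)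
      × (∀ s → s ∈ Fun → ∀ x → x ∈ tuples M s →
           f (interp M s ′ x) ≡ interp N s ′ mapTuple f (arity s) x)

    -- The union of ⟨ M α : α < δ ⟩; functions are unions of their graphs.
    ⋃ₘ : (V → V) → V → V
    ⋃ₘ M δ = ⟨ ⋃ (image (λ α → univ (M α)) δ)
             , image (λ s → ⟨ s , ⋃ (image (λ α → interp (M α) s) δ) ⟩) Sym ⟩

  record AEC (τ : Vocabulary) : Set (suc ℓ) where
    open Structures τ public
    infix 4 _≼_
    field
      K   : V → Set ℓ
      _≼_ : V → V → Set ℓ

    -- ⟨ M α : α < β ⟩ is ≼-increasing continuous.
    IncreasingContinuous : (V → V) → V → Set ℓ
    IncreasingContinuous M β =
        (∀ α → α ∈ β → K (M α))
      × (∀ α γ → α ∈ β → γ ∈ α → M γ ≼ M α)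
      × (∀ α → α ∈ β → Limit α → M α ≡ ⋃ₘ M α)

    -- The Löwenheim–Skolem property at χ ≥ |τ| + ℵ₀.  The bound
    -- ‖ M ‖ ≤ |A| + χ is expressed through the cardinals μ ≥ |A| + χ.
    LSBound : V → Set ℓ
    LSBound χ = InfiniteCardinal χ × Sym ≲ χ
      × (∀ μ N A → Cardinal μ → χ ⊆ μ → K N → A ⊆ univ N → A ≲ μ →
           ∃ λ M → M ≼ N × A ⊆ univ M × univ M ≲ μ)

    field
      K-structure : ∀ M → K M → Structure M
      ≼-K         : ∀ M N → M ≼ N → K M × K N
      K-iso       : ∀ f M N → Iso f M N → K M → K N
      ≼-iso       : ∀ f M N M′ N′ → Iso f M M′ → Iso f N N′ → N ≼ M → N′ ≼ M′
      ≼-⊆ₘ        : ∀ M N → M ≼ N → M ⊆ₘ N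
      ≼-refl      : ∀ M → K M → M ≼ M
      ≼-trans     : ∀ M₀ M₁ M₂ → M₀ ≼ M₁ → M₁ ≼ M₂ → M₀ ≼ M₂
      chain-upper : ∀ M δ → Limit δ → IncreasingContinuous M δ →
                    K (⋃ₘ M δ) × (∀ α → α ∈ δ → M α ≼ ⋃ₘ M δ)
      chain-least : ∀ M δ N → Limit δ → IncreasingContinuous M δ →
                    (∀ α → α ∈ δ → M α ≼ N) → ⋃ₘ M δ ≼ N
      coherence   : ∀ M₀ M₁ N → M₀ ⊆ₘ M₁ → M₀ ≼ N → M₁ ≼ N → M₀ ≼ M₁
      ls          : ∃ λ χ → LSBound χ
      empty-≼     : ∀ M N → K M → K N → univ M ≡ ∅ → M ≼ N

    IsLST : V → Set ℓ
    IsLST χ = LSBound χ × (∀ χ′ → LSBound χ′ → χ ⊆ χ′)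

    K[_] : V → V → Set ℓ
    K[ μ ] M = K M × Cardinal μ × univ M ≈ μ

    EmbedsOver : V → V → V → Set ℓ
    EmbedsOver M₀ M N = ∃ λ f → (∃ λ N′ → N′ ≼ N × Iso f M N′)
                              × (∀ x → x ∈ univ M₀ → f x ≡ x)

    AmalgamationBase : V → V → V → Set ℓ
    AmalgamationBase χ₁ χ₂ M₀ =
        K M₀ × univ M₀ ≲ χ₁ × univ M₀ ≲ χ₂
      × (∀ M₁ M₂ → M₀ ≼ M₁ → M₀ ≼ M₂ → K[ χ₁ ] M₁ → K[ χ₂ ] M₂ →
           ∃ λ M₃ → M₀ ≼ M₃ × EmbedsOver M₀ M₁ M₃ × EmbedsOver M₀ M₂ M₃)

    Dom : V → V → Set ℓ
    Dom ν M = K M × Ordinal (univ M) × ν ⊆ univ M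
            × (∃ λ ν⁺ → SuccessorCardinal ν ν⁺ × univ M ∈ ν⁺)

    -- The θ-majority of M ∈ K[ ν ] satisfies ψ; the function F is only used,
    -- and only constrained, on Dom ν.
    Majority : V → V → (V → Set ℓ) → Set ℓ
    Majority θ ν ψ = Regular θ × (∃ λ (F : V → V) →
        (∀ M → Dom ν M → M ≼ F M × Dom ν (F M))
      × (∀ (M : V → V) → IncreasingContinuous M (S θ) →
           (∀ α → α ∈ S θ → Dom ν (M α)) →
           (∀ α β → α ∈ θ → Twice α β → M (S (S β)) ≡ F (M (S β))) →
           ψ (M θ)))

    HasAmalgamationBases₂ : V → V → V → V → Set ℓ
    HasAmalgamationBases₂ χ₁ χ₂ ν θ = Majority θ ν (AmalgamationBase χ₁ χ₂)

    HasAmalgamationBases : V → V → Set ℓ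
    HasAmalgamationBases ν θ = HasAmalgamationBases₂ ν ν ν θ

{-# OPTIONS --safe #-}
-- The engine is an ultraproduct argument.  If κ is measurable and greater than LST,
-- models P α (α < κ) have an ultraproduct in the class: its submodels of size < κ are
-- copies of submodels of almost all P α, and it is their directed union.  So N₁ and N₂
-- can be amalgamated over M once their small parts are, compatibly, embedded into the
-- P α.  For weakly compact κ and models of size κ the same works with a κ-complete
-- filter that decides κ many prescribed subsets of κ.
--
-- Along a chain ⟨ M α : α < θ ⟩, amalgams of N₁ and N₂ over the M α have an ultraproduct
-- that amalgamates N₁ and N₂ over the union.  Hence it is enough that each M in K[ ν ] has
-- an extension N in K[ ν ] such that any two extensions of N in K[ ν ] amalgamate over M.
-- In (3) this is the assumption.  In (1) and (2) take N that realizes every extension of a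
-- small part of M that is realized in some extension of N: if N ≼ N₁ , N₂, the small parts
-- of N₁ then embed into N ≼ N₂ over the small parts of M, and the first paragraph applies.
module Submission where

open import Data.Empty using (⊥-elim)
open import Data.List.Base using (List; []; _∷_; _++_; map; length)
open import Data.List.Membership.Propositional using () renaming (_∈_ to _∈ˡ_)
open import Data.List.Membership.Propositional.Properties using (∈-++⁺ˡ; ∈-++⁺ʳ; ∈-map⁺)
open import Data.List.Properties using (map-cong-local)
open import Data.List.Relation.Binary.Sublist.Propositional
  using ([]; _∷_; _∷ʳ_; ⊆-refl) renaming (_⊆_ to _⊑_)
open import Data.List.Relation.Unary.All as All using (All; []; _∷_)
open import Data.List.Relation.Unary.All.Properties using (++⁺; map⁺)
open import Data.List.Relation.Unary.Any using (here; there)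
open import Data.Nat.Base using (ℕ; zero; suc; _≤_; s≤s)
open import Data.Nat.Properties using (≤-refl; ≤-pred; m≤n⇒m≤1+n)
open import Data.Product using (∃; ∃!; Σ; _×_; _,_; proj₁; proj₂)
open import Data.Sum using (_⊎_; inj₁; inj₂; [_,_]′)
open import Function.Base using (id; _∘_)
open import Function.Bundles using (_⇔_; mk⇔; Equivalence)
open import Induction.WellFounded using (Acc; acc)
open import Level using (Level)
open import Relation.Binary.PropositionalEquality
  using (_≡_; _≢_; refl; sym; trans; cong; cong₂; subst; subst₂)
open import Relation.Nullary using (¬_; Dec; yes; no)
open import Relation.Nullary.Decidable using (decidable-stable)
open import Defs

open Equivalence using (to; from)

-- An abstract elementary class has no Łoś theorem, so `≼` cannot be read off from formulas in a
-- product. What survives is local. For a set `B` of fewer than κ functions, completeness gives one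
-- filter set on which every atomic formula about `B` has its limiting truth value. If moreover the
-- values of `B` at each α form a `≼`-submodel of `P α`, these submodels are isomorphic to each
-- other on that set, and any one of them can be copied into the product. Gluing the copies takes
-- unions of directed systems, whereas the axioms supply unions of chains only.
--
-- In (1) and (2) the hypotheses on the sizes enter by counting. A model of size ν is covered by κ
-- many parts of size below ν, each element lying in all late parts: initial segments if ν is κ,
-- pieces bounded along a cofinal sequence if ν is singular of cofinality κ. As ν is a strong limit,
-- there are at most ν codes for a small extension of a part, so one chain of length ν treats them
-- all. The final amalgam is then found in a reduced power of `N₂`.

-- Elementary set theory: choice, pairs, functions as sets, foundation.

module Basic {ℓ : Level} (𝒵 : ZFC ℓ) where
  open SetTheory 𝒵 renaming (｛_,_｝ to upair)

  abstract
    -- Hilbert's choice operator. Excluded middle for a Σ-type returns a witness and not merely its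
    -- existence, so choice over all of `V` comes from `em`.
    ε : (V → Set ℓ) → V
    ε P with em {∃ P}
    ... | yes (x , _) = x
    ... | no _        = ∅

    ε-spec : ∀ (P : V → Set ℓ) → ∃ P → P (ε P)
    ε-spec P e with em {∃ P}
    ... | yes (_ , p) = p
    ... | no ¬e       = ⊥-elim (¬e e)

    -- The values are chosen in an arbitrary type, which `ε` does not reach: later they are triples
    -- containing maps `V → V`. Deciding `x ∈ a` by `em` frees the choice from the given proof of
    -- membership.
    choice-on : ∀ {D : Set ℓ} {a} (R : V → D → Set ℓ) → D → (∀ x → x ∈ a → ∃ (R x)) →
                ∃ λ (f : V → D) → ∀ x → x ∈ a → R x (f x)
    choice-on {D} {a} R d h = (λ x → f x em) , λ x x∈ → f-spec x∈ em
      where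
      f : ∀ x → Dec (x ∈ a) → D
      f x (yes x∈) = proj₁ (h x x∈)
      f x (no _)   = d
      f-spec : ∀ {x} → x ∈ a → ∀ e → R x (f x e)
      f-spec x∈ (yes x∈′) = proj₂ (h _ x∈′)
      f-spec x∈ (no x∉)   = ⊥-elim (x∉ x∈)

  by-contradiction : ∀ {P : Set ℓ} → ¬ ¬ P → P
  by-contradiction = decidable-stable em

  ¬∀⇒∃ : ∀ {P Q : V → Set ℓ} → ¬ (∀ x → P x → Q x) → ∃ λ x → P x × ¬ Q x
  ¬∀⇒∃ ¬all = by-contradiction λ ¬ex →
    ¬all λ x p → by-contradiction λ ¬q → ¬ex (x , p , ¬q)

  ext : ∀ {x y} → x ⊆ y → y ⊆ x → x ≡ y
  ext {x} {y} p q = extensionality x y λ z → mk⇔ (p z) (q z)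

  ∈-sep : ∀ {x z} (P : V → Set ℓ) → z ∈ x → P z → z ∈ sep x P
  ∈-sep {x} {z} P z∈x p = from (proj₂ (separation P x) z) (z∈x , p)

  sep⁻ : ∀ {x z} (P : V → Set ℓ) → z ∈ sep x P → z ∈ x × P z
  sep⁻ {x} {z} P = to (proj₂ (separation P x) z)

  ∈-image : ∀ (f : V → V) {x y} → y ∈ x → f y ∈ image f x
  ∈-image f {x} {y} y∈x = from (proj₂ (replacement _ x _) (f y)) (y , y∈x , refl)

  image⁻ : ∀ (f : V → V) {x z} → z ∈ image f x → ∃ λ y → y ∈ x × f y ≡ z
  image⁻ f {x} {z} = to (proj₂ (replacement _ x _) z)

  image-elim : ∀ (R : V → Set ℓ) {f x} → (∀ y → y ∈ x → R (f y)) → ∀ z → z ∈ image f x → R z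
  image-elim R {f} h z z∈ = let (y , y∈ , e) = image⁻ f z∈ in subst R e (h y y∈)

  image-cong : ∀ (f g : V → V) x → (∀ z → z ∈ x → f z ≡ g z) → image f x ≡ image g x
  image-cong f g x h = ext (half f g h) (half g f λ z z∈ → sym (h z z∈))
    where
    half : ∀ (f g : V → V) → (∀ z → z ∈ x → f z ≡ g z) → image f x ⊆ image g x
    half f g h = image-elim (_∈ image g x) λ z z∈ → subst (_∈ image g x) (sym (h z z∈)) (∈-image g z∈)

  ∈-⋃ : ∀ {x y z} → y ∈ x → z ∈ y → z ∈ ⋃ x
  ∈-⋃ {x} {y} {z} y∈x z∈y = from (proj₂ (union x) z) (y , y∈x , z∈y)

  ⋃⁻ : ∀ {x z} → z ∈ ⋃ x → ∃ λ y → y ∈ x × z ∈ y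
  ⋃⁻ {x} {z} = to (proj₂ (union x) z)

  ∈-⋃image : ∀ (f : V → V) {x y z} → y ∈ x → z ∈ f y → z ∈ ⋃ (image f x)
  ∈-⋃image f y∈x z∈ = ∈-⋃ (∈-image f y∈x) z∈

  ⋃image⁻ : ∀ (f : V → V) {x z} → z ∈ ⋃ (image f x) → ∃ λ y → y ∈ x × z ∈ f y
  ⋃image⁻ f z∈ with ⋃⁻ z∈
  ... | w , w∈ , z∈w with image⁻ f w∈
  ... | y , y∈x , refl = y , y∈x , z∈w

  ∈-𝒫 : ∀ {x z} → z ⊆ x → z ∈ 𝒫 x
  ∈-𝒫 {x} {z} = from (proj₂ (power x) z)

  𝒫⁻ : ∀ {x z} → z ∈ 𝒫 x → z ⊆ x
  𝒫⁻ {x} {z} = to (proj₂ (power x) z)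

  ∉∅ : ∀ {x} → ¬ x ∈ ∅
  ∉∅ x∈ with proj₂ (sep⁻ _ x∈)
  ... | ()

  empty : ∀ {x} → (∀ z → ¬ z ∈ x) → x ≡ ∅
  empty h = ext (λ z z∈ → ⊥-elim (h z z∈)) (λ z z∈ → ⊥-elim (∉∅ z∈))

  nonempty : ∀ {x} → x ≢ ∅ → ∃ λ z → z ∈ x
  nonempty ne = by-contradiction λ no → ne (empty λ z z∈ → no (z , z∈))

  ∈-pairˡ : ∀ {x y} → x ∈ upair x y
  ∈-pairˡ {x} {y} = from (proj₂ (pairing x y) x) (inj₁ refl)

  ∈-pairʳ : ∀ {x y} → y ∈ upair x y
  ∈-pairʳ {x} {y} = from (proj₂ (pairing x y) y) (inj₂ refl)

  pair⁻ : ∀ {x y z} → z ∈ upair x y → z ≡ x ⊎ z ≡ y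
  pair⁻ {x} {y} {z} = to (proj₂ (pairing x y) z)

  ∈-single : ∀ {x} → x ∈ ｛ x ｝
  ∈-single = ∈-pairˡ

  single⁻ : ∀ {x z} → z ∈ ｛ x ｝ → z ≡ x
  single⁻ z∈ = [ id , id ]′ (pair⁻ z∈)

  ∪ˡ : ∀ {x y z} → z ∈ x → z ∈ x ∪ y
  ∪ˡ = ∈-⋃ ∈-pairˡ

  ∪ʳ : ∀ {x y z} → z ∈ y → z ∈ x ∪ y
  ∪ʳ = ∈-⋃ ∈-pairʳ

  ∪⁻ : ∀ {x y z} → z ∈ x ∪ y → z ∈ x ⊎ z ∈ y
  ∪⁻ z∈ with ⋃⁻ z∈
  ... | w , w∈ , z∈w with pair⁻ w∈
  ... | inj₁ refl = inj₁ z∈w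
  ... | inj₂ refl = inj₂ z∈w

  ∪-least : ∀ {x y z} → x ⊆ z → y ⊆ z → x ∪ y ⊆ z
  ∪-least p q w w∈ = [ p w , q w ]′ (∪⁻ w∈)

  ∈-S : ∀ {x} → x ∈ S x
  ∈-S = ∪ʳ ∈-single

  ⊆-S : ∀ {x y} → y ∈ x → y ∈ S x
  ⊆-S = ∪ˡ

  S⁻ : ∀ {x y} → y ∈ S x → y ∈ x ⊎ y ≡ x
  S⁻ y∈ with ∪⁻ y∈
  ... | inj₁ p = inj₁ p
  ... | inj₂ p = inj₂ (single⁻ p)

  ∈-∖ : ∀ {x y z} → z ∈ x → ¬ z ∈ y → z ∈ x ∖ y
  ∈-∖ = ∈-sep _

  ∖⁻ : ∀ {x y z} → z ∈ x ∖ y → z ∈ x × ¬ z ∈ y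
  ∖⁻ = sep⁻ _

  single-injective : ∀ {x y} → ｛ x ｝ ≡ ｛ y ｝ → x ≡ y
  single-injective {x} {y} e = single⁻ (subst (x ∈_) e ∈-single)

  pair-injectiveʳ : ∀ {x y z} → upair x y ≡ upair x z → y ≡ z
  pair-injectiveʳ {x} {y} {z} e with pair⁻ (subst (y ∈_) e ∈-pairʳ)
  ... | inj₂ p    = p
  ... | inj₁ refl = sym (single⁻ (subst (z ∈_) (sym e) ∈-pairʳ))

  ⟨⟩-injective : ∀ {x y x′ y′} → ⟨ x , y ⟩ ≡ ⟨ x′ , y′ ⟩ → x ≡ x′ × y ≡ y′
  ⟨⟩-injective {x} {y} {x′} {y′} e = p e , q (p e) e
    where
    p : ⟨ x , y ⟩ ≡ ⟨ x′ , y′ ⟩ → x ≡ x′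
    p e with pair⁻ (subst (｛ x ｝ ∈_) e ∈-pairˡ)
    ... | inj₁ r = single-injective r
    ... | inj₂ r = sym (single⁻ (subst (x′ ∈_) (sym r) ∈-pairˡ))
    q : x ≡ x′ → ⟨ x , y ⟩ ≡ ⟨ x′ , y′ ⟩ → y ≡ y′
    q refl e = pair-injectiveʳ (pair-injectiveʳ e)

  π₁-⟨⟩ : ∀ {x y} → π₁ ⟨ x , y ⟩ ≡ x
  π₁-⟨⟩ {x} {y} = ext left right
    where
    left : π₁ ⟨ x , y ⟩ ⊆ x
    left z z∈ with ⋃⁻ z∈
    ... | w , w∈ , z∈w with sep⁻ _ w∈
    ... | _ , _ , e = subst (z ∈_) (sym (proj₁ (⟨⟩-injective e))) z∈w
    right : x ⊆ π₁ ⟨ x , y ⟩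
    right z z∈ = ∈-⋃ (∈-sep _ (∈-⋃ ∈-pairˡ ∈-single) (y , refl)) z∈

  π₂-⟨⟩ : ∀ {x y} → π₂ ⟨ x , y ⟩ ≡ y
  π₂-⟨⟩ {x} {y} = ext left right
    where
    left : π₂ ⟨ x , y ⟩ ⊆ y
    left z z∈ with ⋃⁻ z∈
    ... | w , w∈ , z∈w with sep⁻ _ w∈
    ... | _ , _ , e = subst (z ∈_) (sym (proj₂ (⟨⟩-injective e))) z∈w
    right : y ⊆ π₂ ⟨ x , y ⟩
    right z z∈ = ∈-⋃ (∈-sep _ (∈-⋃ ∈-pairʳ ∈-pairʳ) (x , refl)) z∈

  ∈-× : ∀ {a b x y} → x ∈ a → y ∈ b → ⟨ x , y ⟩ ∈ a ×ₛ b
  ∈-× x∈a y∈b = ∈-⋃image _ x∈a (∈-image _ y∈b)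

  ×⁻ : ∀ {a b p} → p ∈ a ×ₛ b → ∃ λ x → ∃ λ y → x ∈ a × y ∈ b × ⟨ x , y ⟩ ≡ p
  ×⁻ p∈ with ⋃image⁻ _ p∈
  ... | x , x∈ , q with image⁻ _ q
  ... | y , y∈ , e = x , y , x∈ , y∈ , e

  ′-≡ : ∀ {f a x y} → FunctionOn f a → ⟨ x , y ⟩ ∈ f → f ′ x ≡ y
  ′-≡ {f} {a} {x} {y} (dom , fun) xy∈f = ext left right
    where
    x∈a : x ∈ a
    x∈a with dom _ xy∈f
    ... | _ , _ , p , e = subst (_∈ a) (sym (proj₁ (⟨⟩-injective e))) p
    unique : ∀ {w} → ⟨ x , w ⟩ ∈ f → w ≡ y
    unique h with fun x x∈a
    ... | _ , _ , u = trans (sym (u h)) (u xy∈f)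
    left : f ′ x ⊆ y
    left z z∈ with ⋃⁻ z∈
    ... | w , w∈ , z∈w = subst (z ∈_) (unique (proj₂ (sep⁻ _ w∈))) z∈w
    right : y ⊆ f ′ x
    right z z∈ = ∈-⋃ (∈-sep _ (∈-⋃ (∈-⋃ xy∈f ∈-pairʳ) ∈-pairʳ) xy∈f) z∈

  ′-∈ : ∀ {f a x} → FunctionOn f a → x ∈ a → ⟨ x , f ′ x ⟩ ∈ f
  ′-∈ {f} F@(_ , fun) x∈a with fun _ x∈a
  ... | y , xy∈ , _ = subst (λ w → ⟨ _ , w ⟩ ∈ f) (sym (′-≡ F xy∈)) xy∈

  function⁻ : ∀ {f a p} → FunctionOn f a → p ∈ f → ∃ λ x → x ∈ a × p ≡ ⟨ x , f ′ x ⟩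
  function⁻ {f} F@(dom , _) p∈ with dom _ p∈
  ... | x , y , x∈ , refl = x , x∈ , cong ⟨ x ,_⟩ (sym (′-≡ F p∈))

  function-⊆ : ∀ {f g a b} → FunctionOn f a → FunctionOn g b → a ⊆ b →
               (∀ x → x ∈ a → f ′ x ≡ g ′ x) → f ⊆ g
  function-⊆ {f} {g} F G a⊆b h p p∈ with function⁻ F p∈
  ... | x , x∈ , refl = subst (λ w → ⟨ x , w ⟩ ∈ g) (sym (h x x∈)) (′-∈ G (a⊆b x x∈))

  function-ext : ∀ {f g a} → FunctionOn f a → FunctionOn g a →
                 (∀ x → x ∈ a → f ′ x ≡ g ′ x) → f ≡ g
  function-ext F G h = ext (function-⊆ F G (λ _ → id) h)
                           (function-⊆ G F (λ _ → id) λ x x∈ → sym (h x x∈))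

  lam : V → (V → V) → V
  lam a f = image (λ x → ⟨ x , f x ⟩) a

  lam-function : ∀ {a} (f : V → V) → FunctionOn (lam a f) a
  lam-function {a} f = dom , fun
    where
    dom : ∀ p → p ∈ lam a f → ∃ λ x → ∃ λ y → x ∈ a × p ≡ ⟨ x , y ⟩
    dom p p∈ with image⁻ _ p∈
    ... | x , x∈ , e = x , f x , x∈ , sym e
    fun : ∀ x → x ∈ a → ∃! _≡_ (λ y → ⟨ x , y ⟩ ∈ lam a f)
    fun x x∈ = f x , ∈-image _ x∈ , λ h → unique (image⁻ _ h)
      where
      unique : ∀ {y} → (∃ λ w → w ∈ a × ⟨ w , f w ⟩ ≡ ⟨ x , y ⟩) → f x ≡ y
      unique (w , _ , e) with ⟨⟩-injective e
      ... | refl , e₂ = e₂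

  lam-β : ∀ {a x} (f : V → V) → x ∈ a → lam a f ′ x ≡ f x
  lam-β f x∈ = ′-≡ (lam-function f) (∈-image _ x∈)

  lam-cong : ∀ {a} {f g : V → V} → (∀ x → x ∈ a → f x ≡ g x) → lam a f ≡ lam a g
  lam-cong {a} h = image-cong _ _ a λ x x∈ → cong ⟨ x ,_⟩ (h x x∈)

  ∈-^ : ∀ {a n x} → FunctionOn x n → (∀ i → i ∈ n → x ′ i ∈ a) → x ∈ a ^ₛ n
  ∈-^ {a} {n} {x} F h = ∈-sep _ (∈-𝒫 sub) (F , h)
    where
    sub : x ⊆ n ×ₛ a
    sub p p∈ with function⁻ F p∈
    ... | i , i∈ , refl = ∈-× i∈ (h i i∈)

  ^⁻ : ∀ {a n x} → x ∈ a ^ₛ n → FunctionOn x n × (∀ i → i ∈ n → x ′ i ∈ a)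
  ^⁻ x∈ = proj₂ (sep⁻ _ x∈)

  ^-mono : ∀ {a b n} → a ⊆ b → a ^ₛ n ⊆ b ^ₛ n
  ^-mono a⊆b x x∈ with ^⁻ x∈
  ... | F , h = ∈-^ F λ i i∈ → a⊆b _ (h i i∈)

  ∈-irrefl : ∀ {x} → ¬ x ∈ x
  ∈-irrefl {x} x∈x with foundation ｛ x ｝ (x , ∈-single)
  ... | y , y∈ , h with single⁻ y∈
  ... | refl = h x x∈x ∈-single

  ∈-asym : ∀ {x y} → x ∈ y → ¬ y ∈ x
  ∈-asym {x} {y} x∈y y∈x with foundation (upair x y) (x , ∈-pairˡ)
  ... | z , z∈ , h with pair⁻ z∈
  ... | inj₁ refl = h y y∈x ∈-pairʳ
  ... | inj₂ refl = h x x∈y ∈-pairˡ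

  ¬3-cycle : ∀ {x y z} → x ∈ y → y ∈ z → ¬ z ∈ x
  ¬3-cycle {x} {y} {z} x∈y y∈z z∈x with foundation (upair x y ∪ ｛ z ｝) (x , ∪ˡ ∈-pairˡ)
  ... | w , w∈ , h with ∪⁻ w∈
  ... | inj₂ q with single⁻ q
  ...   | refl = h y y∈z (∪ˡ ∈-pairʳ)
  ¬3-cycle {x} {y} {z} x∈y y∈z z∈x | w , w∈ , h | inj₁ q with pair⁻ q
  ...   | inj₁ refl = h z z∈x (∪ʳ ∈-single)
  ...   | inj₂ refl = h x x∈y (∪ˡ ∈-pairˡ)

  -- Otherwise `x`, `｛ x ｝` and the pair form a membership cycle.
  ⟨⟩∉ : ∀ {x y} → ¬ ⟨ x , y ⟩ ∈ x
  ⟨⟩∉ = ¬3-cycle ∈-single ∈-pairˡ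

-- Ordinals, transfinite induction and recursion.

module Ordinals {ℓ : Level} (𝒵 : ZFC ℓ) where
  open SetTheory 𝒵 hiding (｛_,_｝)
  open Basic 𝒵

  ord-∈ : ∀ {α β} → Ordinal α → β ∈ α → Ordinal β
  ord-∈ (t , h) β∈ = h _ β∈ , λ γ γ∈ → h γ (t _ β∈ γ γ∈)

  -- Foundation concerns sets, so it is applied to the set of non-accessible members of `S α`;
  -- transitivity keeps the elements of a minimal one inside `S α`.
  ord-acc : ∀ {α} → Ordinal α → Acc _∈_ α
  ord-acc {α} (t , _) = by-contradiction λ ¬a →
    let (β , β∈ , h)    = foundation (sep (S α) (λ x → ¬ Acc _∈_ x)) (α , ∈-sep _ ∈-S ¬a)
        (β∈Sα , ¬accβ) = sep⁻ _ β∈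
    in ¬accβ (acc λ {γ} γ∈β → by-contradiction λ ¬accγ →
         h γ γ∈β (∈-sep _ (below β∈Sα γ∈β) ¬accγ))
    where
    below : ∀ {β γ} → β ∈ S α → γ ∈ β → γ ∈ S α
    below β∈ γ∈β with S⁻ β∈
    ... | inj₁ β∈α  = ⊆-S (t _ β∈α _ γ∈β)
    ... | inj₂ refl = ⊆-S γ∈β

  abstract
    ord-ind : ∀ {p} (P : V → Set p) →
              (∀ α → Ordinal α → (∀ β → β ∈ α → P β) → P α) → ∀ α → Ordinal α → P α
    ord-ind P step α O = go α O (ord-acc O)
      where
      go : ∀ α → Ordinal α → Acc _∈_ α → P α
      go α O (acc rs) = step α O λ β β∈ → go β (ord-∈ O β∈) (rs β∈)

  trichotomy : ∀ {α β} → Ordinal α → Ordinal β → α ∈ β ⊎ α ≡ β ⊎ β ∈ α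
  trichotomy {α} {β} Oα Oβ = ord-ind _ outer α Oα β Oβ
    where
    outer : ∀ α → Ordinal α →
            (∀ α′ → α′ ∈ α → ∀ β → Ordinal β → α′ ∈ β ⊎ α′ ≡ β ⊎ β ∈ α′) →
            ∀ β → Ordinal β → α ∈ β ⊎ α ≡ β ⊎ β ∈ α
    outer α (tα , _) ihα = ord-ind _ inner
      where
      inner : ∀ β → Ordinal β → (∀ β′ → β′ ∈ β → α ∈ β′ ⊎ α ≡ β′ ⊎ β′ ∈ α) →
              α ∈ β ⊎ α ≡ β ⊎ β ∈ α
      inner β Oβ@(tβ , _) ihβ with em {α ∈ β} | em {β ∈ α}
      ... | yes p | _     = inj₁ p
      ... | no  _ | yes q = inj₂ (inj₂ q)
      ... | no ¬p | no ¬q = inj₂ (inj₁ (ext α⊆β β⊆α))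
        where
        α⊆β : α ⊆ β
        α⊆β γ γ∈ with ihα γ γ∈ β Oβ
        ... | inj₁ p           = p
        ... | inj₂ (inj₁ refl) = ⊥-elim (¬q γ∈)
        ... | inj₂ (inj₂ p)    = ⊥-elim (¬q (tα γ γ∈ β p))
        β⊆α : β ⊆ α
        β⊆α γ γ∈ with ihβ γ γ∈
        ... | inj₁ p           = ⊥-elim (¬p (tβ γ γ∈ α p))
        ... | inj₂ (inj₁ refl) = ⊥-elim (¬p γ∈)
        ... | inj₂ (inj₂ p)    = p

  ⊆-or-∋ : ∀ {α β} → Ordinal α → Ordinal β → α ⊆ β ⊎ β ∈ α
  ⊆-or-∋ Oα Oβ with trichotomy Oα Oβ
  ... | inj₁ p           = inj₁ (proj₁ Oβ _ p)
  ... | inj₂ (inj₁ refl) = inj₁ λ _ → id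
  ... | inj₂ (inj₂ p)    = inj₂ p

  ∉⇒⊇ : ∀ {α β} → Ordinal α → Ordinal β → ¬ β ∈ α → α ⊆ β
  ∉⇒⊇ Oα Oβ β∉ = [ id , (λ p → ⊥-elim (β∉ p)) ]′ (⊆-or-∋ Oα Oβ)

  ⊆⇒∉ : ∀ {α β} → α ⊆ β → ¬ β ∈ α
  ⊆⇒∉ α⊆β β∈α = ∈-irrefl (α⊆β _ β∈α)

  ⊆-∈ : ∀ {α β γ} → Ordinal α → Ordinal γ → α ⊆ β → β ∈ γ → α ∈ γ
  ⊆-∈ Oα Oγ α⊆β β∈γ with trichotomy Oα (ord-∈ Oγ β∈γ)
  ... | inj₁ p           = proj₁ Oγ _ β∈γ _ p
  ... | inj₂ (inj₁ refl) = β∈γ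
  ... | inj₂ (inj₂ p)    = ⊥-elim (⊆⇒∉ α⊆β p)

  ∈⇒S⊆ : ∀ {α β} → Ordinal β → α ∈ β → S α ⊆ β
  ∈⇒S⊆ (t , _) α∈ z z∈ with S⁻ z∈
  ... | inj₁ p    = t _ α∈ z p
  ... | inj₂ refl = α∈

  abstract
    least : ∀ (P : V → Set ℓ) {α} → Ordinal α → P α →
            ∃ λ β → Ordinal β × P β × β ⊆ α × (∀ γ → γ ∈ β → ¬ P γ)
    least P {α} O = ord-ind _ step α O
      where
      step : ∀ α → Ordinal α →
             (∀ β → β ∈ α → P β →
                ∃ λ β′ → Ordinal β′ × P β′ × β′ ⊆ β × (∀ γ → γ ∈ β′ → ¬ P γ)) →
             P α → ∃ λ β → Ordinal β × P β × β ⊆ α × (∀ γ → γ ∈ β → ¬ P γ)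
      step α O@(t , _) ih p with em {∃ λ β → β ∈ α × P β}
      ... | no ¬e = α , O , p , (λ _ → id) , λ γ γ∈ q → ¬e (γ , γ∈ , q)
      ... | yes (β , β∈ , q) with ih β β∈ q
      ...   | β′ , O′ , p′ , sub , h = β′ , O′ , p′ , (λ z z∈ → t β β∈ z (sub z z∈)) , h

  ∅-ord : Ordinal ∅
  ∅-ord = (λ _ y∈ → ⊥-elim (∉∅ y∈)) , λ _ y∈ → ⊥-elim (∉∅ y∈)

  ⋃-ord : ∀ {a} → (∀ x → x ∈ a → Ordinal x) → Ordinal (⋃ a)
  ⋃-ord {a} h = tr , tr′
    where
    tr : Transitive (⋃ a)
    tr y y∈ z z∈ with ⋃⁻ y∈
    ... | w , w∈ , y∈w = ∈-⋃ w∈ (proj₁ (h w w∈) y y∈w z z∈)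
    tr′ : ∀ β → β ∈ ⋃ a → Transitive β
    tr′ β β∈ with ⋃⁻ β∈
    ... | w , w∈ , β∈w = proj₂ (h w w∈) β β∈w

  ⋃image-ord : ∀ (f : V → V) {a} → (∀ x → x ∈ a → Ordinal (f x)) → Ordinal (⋃ (image f a))
  ⋃image-ord f h = ⋃-ord (image-elim Ordinal h)

  ∪-ord : ∀ {α β} → Ordinal α → Ordinal β → Ordinal (α ∪ β)
  ∪-ord {α} {β} Oα Oβ with ⊆-or-∋ Oα Oβ
  ... | inj₁ p = subst Ordinal (ext (λ z → ∪ʳ) (∪-least p λ _ → id)) Oβ
  ... | inj₂ p = subst Ordinal (ext (λ z → ∪ˡ) (∪-least (λ _ → id) (proj₁ Oα _ p))) Oα

  ∪-∈ : ∀ {α β γ} → Ordinal γ → α ∈ γ → β ∈ γ → α ∪ β ∈ γ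
  ∪-∈ {α} {β} {γ} Oγ α∈ β∈ with ⊆-or-∋ (ord-∈ Oγ α∈) (ord-∈ Oγ β∈)
  ... | inj₁ p = subst (_∈ γ) (ext (λ z → ∪ʳ) (∪-least p λ _ → id)) β∈
  ... | inj₂ p =
    subst (_∈ γ) (ext (λ z → ∪ˡ) (∪-least (λ _ → id) (proj₁ (ord-∈ Oγ α∈) _ p))) α∈

  S-ord : ∀ {α} → Ordinal α → Ordinal (S α)
  S-ord {α} O@(t , h) = (λ y y∈ z z∈ → ⊆-S (sub y y∈ z z∈)) , tr
    where
    sub : ∀ y → y ∈ S α → y ⊆ α
    sub y y∈ with S⁻ y∈
    ... | inj₁ p    = t y p
    ... | inj₂ refl = λ _ → id
    tr : ∀ β → β ∈ S α → Transitive β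
    tr β β∈ with S⁻ β∈
    ... | inj₁ p    = h β p
    ... | inj₂ refl = t

  ord-cases : ∀ {β} → Ordinal β → β ≡ ∅ ⊎ (∃ λ γ → γ ∈ β × β ≡ S γ) ⊎ Limit β
  ord-cases {β} Oβ with em {β ≡ ∅} | em {∃ λ γ → γ ∈ β × β ≡ S γ}
  ... | yes e | _      = inj₁ e
  ... | no _  | yes s  = inj₂ (inj₁ s)
  ... | no ne | no ¬s = inj₂ (inj₂ (Oβ , ∅∈ , S∈))
    where
    ∅∈ : ∅ ∈ β
    ∅∈ with trichotomy ∅-ord Oβ
    ... | inj₁ p        = p
    ... | inj₂ (inj₁ e) = ⊥-elim (ne (sym e))
    ... | inj₂ (inj₂ p) = ⊥-elim (∉∅ p)
    S∈ : ∀ γ → γ ∈ β → S γ ∈ β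
    S∈ γ γ∈ with trichotomy (S-ord (ord-∈ Oβ γ∈)) Oβ
    ... | inj₁ p        = p
    ... | inj₂ (inj₁ e) = ⊥-elim (¬s (γ , γ∈ , sym e))
    ... | inj₂ (inj₂ p) = ⊥-elim (∈-irrefl (∈⇒S⊆ Oβ γ∈ _ p))

  S-injective : ∀ {x y} → S x ≡ S y → x ≡ y
  S-injective {x} {y} e with S⁻ (subst (x ∈_) e ∈-S) | S⁻ (subst (y ∈_) (sym e) ∈-S)
  ... | inj₂ p | _      = p
  ... | inj₁ _ | inj₂ q = sym q
  ... | inj₁ p | inj₁ q = ⊥-elim (∈-asym p q)

  S≢∅ : ∀ {x} → S x ≢ ∅
  S≢∅ {x} e = ∉∅ (subst (x ∈_) e ∈-S)

  -- Burali-Forti: the ordinals in `r` would form an ordinal, hence a member of itself.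
  no-set-of-ordinals : ∀ r → ¬ (∀ α → Ordinal α → α ∈ r)
  no-set-of-ordinals r all = ∈-irrefl (∈-sep Ordinal (all _ Oo) Oo)
    where
    o = sep r Ordinal
    Oo : Ordinal o
    Oo = (λ y y∈ z z∈ → let Oz = ord-∈ (proj₂ (sep⁻ _ y∈)) z∈ in ∈-sep _ (all z Oz) Oz)
       , λ y y∈ → proj₁ (proj₂ (sep⁻ _ y∈))

  -- The branch may use the decided proof, so that recursive calls and witnesses can depend on it;
  -- the default is `∅`.
  pick : ∀ {A : Set ℓ} → Dec A → (A → V) → V
  pick (yes a) f = f a
  pick (no _)  f = ∅

  pick-yes : ∀ {A : Set ℓ} (d : Dec A) (f : A → V) {v} → A → (∀ a → f a ≡ v) → pick d f ≡ v
  pick-yes (yes a) f _ h = h a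
  pick-yes (no ¬a) f a h = ⊥-elim (¬a a)

  pick-cong : ∀ {A : Set ℓ} (d : Dec A) {f g : A → V} → (∀ a → f a ≡ g a) → pick d f ≡ pick d g
  pick-cong (yes a) h = h a
  pick-cong (no _)  h = refl

  -- The step function F α g receives the values below α as a set function g on α.

  rec : (V → V → V) → ∀ x → Acc _∈_ x → V
  rec F x (acc rs) = F x (lam x λ y → pick (em {y ∈ x}) λ y∈ → rec F y (rs y∈))

  -- The earlier values are handed to `F` as a set, so agreement at the members of `x` already makes
  -- the two arguments equal; no function extensionality is involved.
  rec-irrelevant : ∀ F x (a b : Acc _∈_ x) → rec F x a ≡ rec F x b
  rec-irrelevant F x (acc rs) (acc rs′) =
    cong (F x) (lam-cong λ y _ → pick-cong em λ y∈ → rec-irrelevant F y (rs y∈) (rs′ y∈))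

  abstract
    trec : (V → V → V) → V → V
    trec F x = pick (em {Acc _∈_ x}) (rec F x)

    trec-acc : ∀ F {x} (a : Acc _∈_ x) → trec F x ≡ rec F x a
    trec-acc F {x} a = pick-yes em _ a λ b → rec-irrelevant F x b a

    trec-≡ : ∀ F {α} → Ordinal α → trec F α ≡ F α (lam α (trec F))
    trec-≡ F {α} O = trans (trec-acc F (ord-acc O)) (unfold (ord-acc O))
      where
      unfold : (a : Acc _∈_ α) → rec F α a ≡ F α (lam α (trec F))
      unfold (acc rs) = cong (F α) (lam-cong λ y y∈ →
        pick-yes em _ y∈ λ p → sym (trec-acc F (rs p)))

-- Comparison of sizes, enumerations and cardinals.

module Cardinals {ℓ : Level} (𝒵 : ZFC ℓ) where
  open SetTheory 𝒵 hiding (｛_,_｝)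
  open Basic 𝒵
  open Ordinals 𝒵

  ⊆⇒≲ : ∀ {x y} → x ⊆ y → x ≲ y
  ⊆⇒≲ h = id , h , λ _ _ _ _ e → e

  ≲-refl : ∀ {x} → x ≲ x
  ≲-refl = ⊆⇒≲ λ _ → id

  ≲-trans : ∀ {x y z} → x ≲ y → y ≲ z → x ≲ z
  ≲-trans (f , f∈ , fi) (g , g∈ , gi) = g ∘ f , (λ z z∈ → g∈ _ (f∈ z z∈)) ,
    λ z z′ z∈ z′∈ e → fi z z′ z∈ z′∈ (gi _ _ (f∈ z z∈) (f∈ z′ z′∈) e)

  ≈⇒≲ : ∀ {x y} → x ≈ y → x ≲ y
  ≈⇒≲ (f , i , _) = f , i

  inverse : (V → V) → V → V → V
  inverse f x y = ε λ z → z ∈ x × f z ≡ y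

  inverse-spec : ∀ f {x y} → (∃ λ z → z ∈ x × f z ≡ y) → inverse f x y ∈ x × f (inverse f x y) ≡ y
  inverse-spec f = ε-spec _

  inverse-β : ∀ {f x y} → Injective f x y → ∀ {z} → z ∈ x → inverse f x (f z) ≡ z
  inverse-β {f} (_ , i) {z} z∈ with inverse-spec f (z , z∈ , refl)
  ... | p , e = i _ _ p z∈ e

  surjection⇒≳ : ∀ {x y} (f : V → V) → Surjective f x y → y ≲ x
  surjection⇒≳ {x} f s = inverse f x , (λ w w∈ → proj₁ (inverse-spec f (s w w∈))) ,
    λ w w′ w∈ w′∈ e → trans (sym (proj₂ (inverse-spec f (s w w∈))))
      (trans (cong f e) (proj₂ (inverse-spec f (s w′ w′∈))))

  inverse-bijective : ∀ {f x y} → Bijective f x y → Bijective (inverse f x) y x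
  inverse-bijective {f} (i , s) = proj₂ (surjection⇒≳ f s) ,
    λ z z∈ → f z , proj₁ i z z∈ , inverse-β i z∈

  ≈-sym : ∀ {x y} → x ≈ y → y ≈ x
  ≈-sym {x} (f , b) = inverse f x , inverse-bijective b

  ≈-trans : ∀ {x y z} → x ≈ y → y ≈ z → x ≈ z
  ≈-trans {x} {y} {z} (f , fi , fs) (g , gi , gs) =
    g ∘ f , proj₂ (≲-trans {x} {y} {z} (f , fi) (g , gi)) , s
    where
    s : Surjective (g ∘ f) x z
    s w w∈ with gs w w∈
    ... | v , v∈ , refl with fs v v∈
    ... | u , u∈ , refl = u , u∈ , refl

  image-≲ : ∀ (f : V → V) {x} → image f x ≲ x
  image-≲ f = surjection⇒≳ f λ w → image⁻ f

  image-≈ : ∀ {f x y} → Injective f x y → x ≈ image f x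
  image-≈ {f} (_ , i) = f , ((λ _ → ∈-image f) , i) , λ w → image⁻ f

  image-bijective : ∀ {f x y} → Bijective f x y → image f x ≡ y
  image-bijective {f} {x} {y} ((f∈ , _) , onto) = ext (image-elim (_∈ y) f∈)
    λ z z∈ → let (w , w∈ , e) = onto z z∈ in subst (_∈ image f x) e (∈-image f w∈)

  -- Knaster–Tarski: ⋃ Good is the largest fixed point of X ↦ x ∖ g[y ∖ f[X]].
  cantor-schröder-bernstein : ∀ {x y} → x ≲ y → y ≲ x → x ≈ y
  cantor-schröder-bernstein {x} {y} (f , f∈ , fi) (g , g∈ , gi) = h , (h∈ , hi) , hs
    where
    Good : V → Set ℓ
    Good X = ∀ z → z ∈ X → ∀ w → w ∈ y → g w ≡ z → ∃ λ z′ → z′ ∈ X × f z′ ≡ w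
    W = ⋃ (sep (𝒫 x) Good)
    W⊆x : W ⊆ x
    W⊆x z z∈ with ⋃⁻ z∈
    ... | X , X∈ , z∈X = 𝒫⁻ (proj₁ (sep⁻ _ X∈)) z z∈X
    good : Good W
    good z z∈ w w∈ e with ⋃⁻ z∈
    ... | X , X∈ , z∈X with proj₂ (sep⁻ _ X∈) z z∈X w w∈ e
    ... | z′ , z′∈ , e′ = z′ , ∈-⋃ X∈ z′∈ , e′
    outside : ∀ z → z ∈ x → ¬ z ∈ W →
              ∃ λ w → w ∈ y × g w ≡ z × ¬ (∃ λ z′ → z′ ∈ W × f z′ ≡ w)
    -- Without such a `w` the set `W ∪ ｛ z ｝` would still be `Good`, and `W` contains every `Good`
    -- subset of `x`.
    outside z z∈ z∉ = by-contradiction λ none → z∉ (∈-⋃ (∈-sep _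
      (∈-𝒫 (∪-least W⊆x λ v v∈ → subst (_∈ x) (sym (single⁻ v∈)) z∈)) (good′ none)) (∪ʳ ∈-single))
      where
      good′ : ¬ (∃ λ w → w ∈ y × g w ≡ z × ¬ (∃ λ z′ → z′ ∈ W × f z′ ≡ w)) → Good (W ∪ ｛ z ｝)
      good′ none v v∈ w w∈ e with ∪⁻ v∈
      ... | inj₁ p with good v p w w∈ e
      ...   | z′ , z′∈ , e′ = z′ , ∪ˡ z′∈ , e′
      good′ none v v∈ w w∈ e | inj₂ q with single⁻ q
      ...   | refl with by-contradiction (λ ¬p → none (w , w∈ , e , ¬p))
      ...     | z′ , z′∈ , e′ = z′ , ∪ˡ z′∈ , e′
    case : ∀ z → Dec (z ∈ W) → V
    case z (yes _) = f z
    case z (no _)  = inverse g y z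
    h : V → V
    h z = case z em
    out : ∀ {z} → z ∈ x → ¬ z ∈ W →
          inverse g y z ∈ y × g (inverse g y z) ≡ z × ¬ (∃ λ z′ → z′ ∈ W × f z′ ≡ inverse g y z)
    out {z} z∈ z∉ with outside z z∈ z∉
    ... | w , w∈ , refl , no-pre with inverse-β {g} {y} {x} (g∈ , gi) w∈
    ...   | e = subst (_∈ y) (sym e) w∈ , cong g e , λ (z′ , p , q) → no-pre (z′ , p , trans q e)
    h∈ : ∀ z → z ∈ x → h z ∈ y
    h∈ z z∈ with em {z ∈ W}
    ... | yes _ = f∈ z z∈
    ... | no z∉ = proj₁ (out z∈ z∉)
    hi : ∀ z z′ → z ∈ x → z′ ∈ x → h z ≡ h z′ → z ≡ z′
    hi z z′ z∈ z′∈ e with em {z ∈ W} | em {z′ ∈ W}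
    ... | yes _ | yes _ = fi z z′ z∈ z′∈ e
    ... | yes p | no q  = ⊥-elim (proj₂ (proj₂ (out z′∈ q)) (z , p , e))
    ... | no q  | yes p = ⊥-elim (proj₂ (proj₂ (out z∈ q)) (z′ , p , sym e))
    ... | no p  | no q  =
      trans (sym (proj₁ (proj₂ (out z∈ p)))) (trans (cong g e) (proj₁ (proj₂ (out z′∈ q))))
    hs : Surjective h x y
    hs w w∈ with em {∃ λ z′ → z′ ∈ W × f z′ ≡ w}
    ... | yes (z , z∈ , e) = z , W⊆x z z∈ , eq
      where
      eq : h z ≡ w
      eq with em {z ∈ W}
      ... | yes _ = e
      ... | no q  = ⊥-elim (q z∈)
    ... | no none = g w , g∈ w w∈ , eq
      where
      eq : h (g w) ≡ w
      eq with em {g w ∈ W}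
      ... | yes p = ⊥-elim (none (good (g w) p w w∈ refl))
      ... | no _  = inverse-β {g} {y} {x} (g∈ , gi) w∈

  -- The prescribed start `e₀` on `α` allows a model to be moved onto an ordinal while a given
  -- submodel keeps a given listing.
  Enumerates : (V → V) → V → (V → V) → V → V → Set ℓ
  Enumerates e₀ α e β A = Ordinal β × α ⊆ β × Bijective e β A × (∀ i → i ∈ α → e i ≡ e₀ i)

  abstract
    -- Each ordinal from `α` on is sent to an element of `A` not yet listed. If this never stopped,
    -- all ordinals would inject into `A`, and replacement would collect them into a set.
    enumeration : ∀ A α (e₀ : V → V) → Ordinal α → Injective e₀ α A →
                  ∃ λ β → ∃ λ e → Enumerates e₀ α e β A
    enumeration A α e₀ Oα (e₀∈ , e₀i) = result
      where
      New : V → V → V → Set ℓ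
      New β g z = z ∈ A × (∀ γ → γ ∈ β → g ′ γ ≢ z)
      choose : ∀ {β} → Dec (β ∈ α) → V → V
      choose {β} (yes _) g = e₀ β
      choose {β} (no _)  g = ε (New β g)
      e : V → V
      e = trec λ β → choose {β} em
      Exhausted : V → Set ℓ
      Exhausted β = ∀ z → z ∈ A → ∃ λ γ → γ ∈ β × e γ ≡ z
      Fresh : V → Set ℓ
      Fresh β = e β ∈ A × (∀ γ → γ ∈ β → e γ ≢ e β)
      e-below : ∀ {β} → Ordinal β → β ∈ α → e β ≡ e₀ β
      e-below {β} O β∈ = trans (trec-≡ _ O) (lemma em)
        where
        lemma : (d : Dec (β ∈ α)) → choose d (lam β e) ≡ e₀ β
        lemma (yes _) = refl
        lemma (no ¬p) = ⊥-elim (¬p β∈)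
      e-above : ∀ {β} → Ordinal β → ¬ β ∈ α → e β ≡ ε (New β (lam β e))
      e-above {β} O β∉ = trans (trec-≡ _ O) (lemma em)
        where
        lemma : (d : Dec (β ∈ α)) → choose d (lam β e) ≡ ε (New β (lam β e))
        lemma (yes p) = ⊥-elim (β∉ p)
        lemma (no _)  = refl
      fresh : ∀ {β} → Ordinal β → (¬ β ∈ α → ¬ Exhausted β) → Fresh β
      fresh {β} O h with em {β ∈ α}
      ... | yes β∈ = subst (_∈ A) (sym (e-below O β∈)) (e₀∈ β β∈) , λ γ γ∈ eq →
            ∈-irrefl (subst (γ ∈_) (sym (e₀i γ β (proj₁ Oα β β∈ γ γ∈) β∈
              (trans (sym (e-below (ord-∈ O γ∈) (proj₁ Oα β β∈ γ γ∈)))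
                (trans eq (e-below O β∈))))) γ∈)
      ... | no β∉ with ¬∀⇒∃ (h β∉)
      ...   | z , z∈ , unseen with ε-spec (New β (lam β e))
                (z , z∈ , λ γ γ∈ eq → unseen (γ , γ∈ , trans (sym (lam-β e γ∈)) eq))
      ...     | p , q = subst (_∈ A) (sym (e-above O β∉)) p , λ γ γ∈ eq →
                  q γ γ∈ (trans (lam-β e γ∈) (trans eq (e-above O β∉)))
      exhausts : ∃ λ β → Ordinal β × Exhausted β
      exhausts = by-contradiction λ never →
        let allFresh : ∀ β → Ordinal β → Fresh β
            allFresh β O = fresh O λ _ ex → never (β , O , ex)
            inj : ∀ β γ → Ordinal β → Ordinal γ → e β ≡ e γ → β ≡ γ
            inj β γ Oβ Oγ eq = [ (λ p → ⊥-elim (proj₂ (allFresh γ Oγ) β p eq))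
              , [ id , (λ p → ⊥-elim (proj₂ (allFresh β Oβ) γ p (sym eq))) ]′ ]′ (trichotomy Oβ Oγ)
            (r , hr) = replacement (λ z β → Ordinal β × e β ≡ z) A
              λ z _ β γ (Oβ , p) (Oγ , q) → inj β γ Oβ Oγ (trans p (sym q))
        in no-set-of-ordinals r λ β O → from (hr β) (e β , proj₁ (allFresh β O) , O , refl)
      result : ∃ λ β → ∃ λ e → Enumerates e₀ α e β A
      result with exhausts
      ... | β₀ , O₀ , ex₀ with least (λ β → α ⊆ β × Exhausted β) (∪-ord Oα O₀)
               ((λ _ → ∪ˡ) , λ z z∈ → let (γ , γ∈ , eq) = ex₀ z z∈ in γ , ∪ʳ γ∈ , eq)
      ... | β , Oβ , (α⊆β , ex) , _ , min =
        β , e , Oβ , α⊆β , (((λ γ γ∈ → proj₁ (fr γ∈)) , inj) , ex) , λ i i∈ → e-below (ord-∈ Oα i∈) i∈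
        where
        fr : ∀ {γ} → γ ∈ β → Fresh γ
        fr {γ} γ∈ = fresh (ord-∈ Oβ γ∈) λ γ∉ ex′ →
          min γ γ∈ (∉⇒⊇ Oα (ord-∈ Oβ γ∈) γ∉ , ex′)
        inj : ∀ γ δ → γ ∈ β → δ ∈ β → e γ ≡ e δ → γ ≡ δ
        inj γ δ γ∈ δ∈ eq = [ (λ p → ⊥-elim (proj₂ (fr δ∈) γ p eq))
          , [ id , (λ p → ⊥-elim (proj₂ (fr γ∈) δ p (sym eq))) ]′ ]′
          (trichotomy (ord-∈ Oβ γ∈) (ord-∈ Oβ δ∈))

  well-ordered : ∀ x → ∃ λ β → Ordinal β × x ≈ β
  well-ordered x =
    let (β , e , Oβ , _ , b , _) = enumeration x ∅ id ∅-ord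
          ((λ _ z∈ → ⊥-elim (∉∅ z∈)) , λ _ _ z∈ → ⊥-elim (∉∅ z∈))
    in β , Oβ , ≈-sym (e , b)

  abstract
    cardinality : ∀ x → ∃ λ κ → Cardinal κ × x ≈ κ
    cardinality x =
      let (β , Oβ , x≈β)           = well-ordered x
          (κ , Oκ , x≈κ , _ , min) = least (x ≈_) Oβ x≈β
      in κ , (Oκ , λ α α∈ α≈κ → min α α∈ (≈-trans x≈κ (≈-sym α≈κ))) , x≈κ

    card : V → V
    card x = proj₁ (cardinality x)

    card-cardinal : ∀ x → Cardinal (card x)
    card-cardinal x = proj₁ (proj₂ (cardinality x))

    ≈-card : ∀ x → x ≈ card x
    ≈-card x = proj₂ (proj₂ (cardinality x))

  ∈⇒⋨ : ∀ {κ β} → Cardinal κ → β ∈ κ → ¬ κ ≲ β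
  ∈⇒⋨ (O , h) β∈ κ≲β =
    h _ β∈ (cantor-schröder-bernstein (⊆⇒≲ (proj₁ O _ β∈)) κ≲β)

  ≲⇒⊆ : ∀ {κ ν} → Cardinal κ → Ordinal ν → κ ≲ ν → κ ⊆ ν
  ≲⇒⊆ C O κ≲ν with ⊆-or-∋ (proj₁ C) O
  ... | inj₁ p = p
  ... | inj₂ p = ⊥-elim (∈⇒⋨ C p κ≲ν)

  ∅∈ω : ∅ ∈ ω
  ∅∈ω = ∈-sep _ ∅∈inf λ _ p _ → p
    where
    ∅∈inf : ∅ ∈ proj₁ infinity
    ∅∈inf with proj₁ (proj₂ infinity)
    ... | e , e∈ , none = subst (_∈ proj₁ infinity) (empty none) e∈

  S∈ω : ∀ {n} → n ∈ ω → S n ∈ ω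
  S∈ω {n} n∈ with sep⁻ _ n∈
  ... | n∈inf , h = ∈-sep _ Sn∈inf λ i p q → q n (h i p q)
    where
    Sn∈inf : S n ∈ proj₁ infinity
    Sn∈inf with proj₂ (proj₂ infinity) n n∈inf
    ... | y , y∈ , hy = subst (_∈ proj₁ infinity) (ext
      (λ z z∈ → [ ⊆-S , (λ { refl → ∈-S }) ]′ (to (hy z) z∈))
      (λ z z∈ → from (hy z) (S⁻ z∈))) y∈

  -- Hilbert's hotel: `α` goes to `∅` and the natural numbers are shifted by one.
  S-≲ : ∀ {α} → ω ⊆ α → S α ≲ α
  S-≲ {α} ω⊆α = f , f∈ , fi
    where
    g : ∀ x → Dec (x ≡ α) → Dec (x ∈ ω) → V
    g x (yes _) _       = ∅
    g x (no _)  (yes _) = S x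
    g x (no _)  (no _)  = x
    f : V → V
    f x = g x em em
    f∈ : ∀ x → x ∈ S α → f x ∈ α
    f∈ x x∈ with em {x ≡ α} | em {x ∈ ω}
    ... | yes _ | _     = ω⊆α _ ∅∈ω
    ... | no _  | yes p = ω⊆α _ (S∈ω p)
    ... | no ne | no _  = [ id , (λ e → ⊥-elim (ne e)) ]′ (S⁻ x∈)
    fi : ∀ x y → x ∈ S α → y ∈ S α → f x ≡ f y → x ≡ y
    fi x y x∈ y∈ e with em {x ≡ α} | em {x ∈ ω} | em {y ≡ α} | em {y ∈ ω}
    ... | yes refl | _ | yes refl | _ = refl
    ... | yes _ | _     | no _  | yes _ = ⊥-elim (S≢∅ (sym e))
    ... | yes _ | _     | no _  | no q  = ⊥-elim (q (subst (_∈ ω) e ∅∈ω))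
    ... | no _  | yes _ | yes _ | _     = ⊥-elim (S≢∅ e)
    ... | no _  | no q  | yes _ | _     = ⊥-elim (q (subst (_∈ ω) (sym e) ∅∈ω))
    ... | no _  | yes _ | no _  | yes _ = S-injective e
    ... | no _  | yes p | no _  | no q  = ⊥-elim (q (subst (_∈ ω) e (S∈ω p)))
    ... | no _  | no q  | no _  | yes p = ⊥-elim (q (subst (_∈ ω) (sym e) (S∈ω p)))
    ... | no _  | no _  | no _  | no _  = e

  infinite-limit : ∀ {κ} → InfiniteCardinal κ → Limit κ
  infinite-limit {κ} (C@(O , _) , ω⊆κ) = O , ω⊆κ _ ∅∈ω , closed
    where
    closed : ∀ α → α ∈ κ → S α ∈ κ
    closed α α∈ with trichotomy (S-ord (ord-∈ O α∈)) O
    ... | inj₁ p        = p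
    ... | inj₂ (inj₂ p) = ⊥-elim (∈-irrefl (∈⇒S⊆ O α∈ _ p))
    ... | inj₂ (inj₁ e) = ⊥-elim (∈⇒⋨ C α∈ (subst (_≲ α) e (S-≲ ω⊆α)))
      where
      ω⊆α : ω ⊆ α
      ω⊆α n n∈ with S⁻ (subst (n ∈_) (sym e) (ω⊆κ n n∈))
      ... | inj₁ p    = p
      ... | inj₂ refl = ⊥-elim (∈-irrefl (subst (_∈ κ) e (ω⊆κ _ (S∈ω n∈))))

  ∅∈-infinite : ∀ {κ} → InfiniteCardinal κ → ∅ ∈ κ
  ∅∈-infinite I = proj₁ (proj₂ (infinite-limit I))

  S∈-infinite : ∀ {κ α} → InfiniteCardinal κ → α ∈ κ → S α ∈ κ
  S∈-infinite I = proj₂ (proj₂ (infinite-limit I)) _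

-- Sets of size below a strong limit or inaccessible cardinal.

module SmallSets {ℓ : Level} (𝒵 : ZFC ℓ) where
  open SetTheory 𝒵 hiding (｛_,_｝)
  open Basic 𝒵
  open Ordinals 𝒵
  open Cardinals 𝒵

  Small : V → V → Set ℓ
  Small ν x = ∃ λ β → β ∈ ν × x ≲ β

  small-∈ : ∀ {ν β} → β ∈ ν → Small ν β
  small-∈ β∈ = _ , β∈ , ≲-refl

  small-≲ : ∀ {ν x y} → x ≲ y → Small ν y → Small ν x
  small-≲ h (β , β∈ , k) = β , β∈ , ≲-trans h k

  small-⊆ : ∀ {ν x y} → x ⊆ y → Small ν y → Small ν x
  small-⊆ h = small-≲ (⊆⇒≲ h)

  small-image : ∀ {ν x} (f : V → V) → Small ν x → Small ν (image f x)
  small-image f = small-≲ (image-≲ f)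

  small⇒≲ : ∀ {ν x} → Ordinal ν → Small ν x → x ≲ ν
  small⇒≲ O (β , β∈ , h) = ≲-trans h (⊆⇒≲ (proj₁ O β β∈))

  ¬small-self : ∀ {ν} → Cardinal ν → ¬ Small ν ν
  ¬small-self C (β , β∈ , h) = ∈⇒⋨ C β∈ h

  small-or-≳ : ∀ {ν} x → Cardinal ν → Small ν x ⊎ ν ≲ x
  small-or-≳ {ν} x C with ⊆-or-∋ (proj₁ C) (proj₁ (card-cardinal x))
  ... | inj₁ p = inj₂ (≲-trans (⊆⇒≲ p) (≈⇒≲ (≈-sym (≈-card x))))
  ... | inj₂ p = inj₁ (card x , p , ≈⇒≲ (≈-card x))

  -- It depends on the two sets only and not on a proof of `x ≲ y`, so every occurrence refers to
  -- the same coding of `x` by elements of `y`.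
  injection : V → V → V → V
  injection x y with em {x ≲ y}
  ... | yes (f , _) = f
  ... | no _        = id

  injection-spec : ∀ {x y} → x ≲ y → Injective (injection x y) x y
  injection-spec {x} {y} h with em {x ≲ y}
  ... | yes (f , i) = i
  ... | no ¬h       = ⊥-elim (¬h h)

  𝒫-≲ : ∀ {x y} → x ≲ y → 𝒫 x ≲ 𝒫 y
  𝒫-≲ {x} {y} (f , f∈ , fi) = image f , into , inj
    where
    into : ∀ z → z ∈ 𝒫 x → image f z ∈ 𝒫 y
    into z z∈ = ∈-𝒫 (image-elim (_∈ y) λ v v∈ → f∈ v (𝒫⁻ z∈ v v∈))
    half : ∀ z z′ → z ⊆ x → z′ ⊆ x → image f z ≡ image f z′ → z ⊆ z′
    half z z′ h h′ e w w∈ with image⁻ f (subst (f w ∈_) e (∈-image f w∈))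
    ... | v , v∈ , eq = subst (_∈ z′) (fi v w (h′ v v∈) (h w w∈) eq) v∈
    inj : ∀ z z′ → z ∈ 𝒫 x → z′ ∈ 𝒫 x → image f z ≡ image f z′ → z ≡ z′
    inj z z′ z∈ z′∈ e = ext (half z z′ (𝒫⁻ z∈) (𝒫⁻ z′∈) e) (half z′ z (𝒫⁻ z′∈) (𝒫⁻ z∈) (sym e))

  -- The two sides are kept apart by tags: `w` in `x` becomes `｛ ｛ f w ｝ ｝`, any other `w` becomes a
  -- set that contains `∅`. The two power sets in the bound are harmless below a strong limit.
  ∪-≲ : ∀ {x y z} → x ≲ z → y ≲ z → x ∪ y ≲ 𝒫 (𝒫 z)
  ∪-≲ {x} {y} {z} (f , f∈ , fi) (g , g∈ , gi) = h , h∈ , hi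
    where
    single∈ : ∀ {a b} → a ∈ b → ｛ a ｝ ∈ 𝒫 b
    single∈ {a} {b} a∈ = ∈-𝒫 λ w w∈ → subst (_∈ b) (sym (single⁻ w∈)) a∈
    branch : ∀ w → Dec (w ∈ x) → V
    branch w (yes _) = ｛ ｛ f w ｝ ｝
    branch w (no _)  = ｛ ∅ ｝ ∪ ｛ ｛ g w ｝ ｝
    h : V → V
    h w = branch w em
    in-y : ∀ {w} → w ∈ x ∪ y → ¬ w ∈ x → w ∈ y
    in-y w∈ w∉ = [ (λ p → ⊥-elim (w∉ p)) , id ]′ (∪⁻ w∈)
    single≢∅ : ∀ {a} → ｛ a ｝ ≢ ∅
    single≢∅ {a} e = ∉∅ (subst (a ∈_) e ∈-single)
    cross : ∀ {a b} → ¬ ｛ ｛ a ｝ ｝ ≡ ｛ ∅ ｝ ∪ ｛ ｛ b ｝ ｝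
    cross e = single≢∅ (sym (single⁻ (subst (∅ ∈_) (sym e) (∪ˡ ∈-single))))
    h∈ : ∀ w → w ∈ x ∪ y → h w ∈ 𝒫 (𝒫 z)
    h∈ w w∈ with em {w ∈ x}
    ... | yes p = single∈ (single∈ (f∈ w p))
    ... | no p  = ∈-𝒫 (∪-least
      (λ v v∈ → subst (_∈ 𝒫 z) (sym (single⁻ v∈)) (∈-𝒫 λ u u∈ → ⊥-elim (∉∅ u∈)))
      (𝒫⁻ (single∈ (single∈ (g∈ w (in-y w∈ p))))))
    hi : ∀ w w′ → w ∈ x ∪ y → w′ ∈ x ∪ y → h w ≡ h w′ → w ≡ w′
    hi w w′ w∈ w′∈ e with em {w ∈ x} | em {w′ ∈ x}
    ... | yes p | yes q = fi w w′ p q (single-injective (single-injective e))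
    ... | yes p | no q  = ⊥-elim (cross e)
    ... | no p  | yes q = ⊥-elim (cross (sym e))
    ... | no p  | no q  with ∪⁻ (subst (｛ g w ｝ ∈_) e (∪ʳ ∈-single))
    ...   | inj₁ r = ⊥-elim (single≢∅ (single⁻ r))
    ...   | inj₂ r = gi w w′ (in-y w∈ p) (in-y w′∈ q) (single-injective (single⁻ r))

  upair-⊆ : ∀ {a b x} → a ∈ x → b ∈ x → SetTheory.｛_,_｝ 𝒵 a b ⊆ x
  upair-⊆ {x = x} a∈ b∈ w w∈ with pair⁻ w∈
  ... | inj₁ refl = a∈
  ... | inj₂ refl = b∈

  ⟨⟩∈𝒫𝒫 : ∀ {a b x} → a ∈ x → b ∈ x → ⟨ a , b ⟩ ∈ 𝒫 (𝒫 x)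
  ⟨⟩∈𝒫𝒫 a∈ b∈ = ∈-𝒫 (upair-⊆ (∈-𝒫 (upair-⊆ a∈ a∈)) (∈-𝒫 (upair-⊆ a∈ b∈)))

  ×-⊆𝒫𝒫 : ∀ {a b} → a ×ₛ b ⊆ 𝒫 (𝒫 (a ∪ b))
  ×-⊆𝒫𝒫 {a} {b} p p∈ = let (x , y , x∈ , y∈ , e) = ×⁻ p∈ in
    subst (_∈ 𝒫 (𝒫 (a ∪ b))) e (⟨⟩∈𝒫𝒫 (∪ˡ x∈) (∪ʳ y∈))

  -- Infinite and strong limit, stated for ordinals `β` so that it applies directly to the witnesses
  -- of `Small`.
  PowerClosed : V → Set ℓ
  PowerClosed ν = InfiniteCardinal ν × (∀ β → β ∈ ν → Small ν (𝒫 β))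

  infinite-ord : ∀ {ν} → InfiniteCardinal ν → Ordinal ν
  infinite-ord ((O , _) , _) = O

  module _ {ν : V} (PC : PowerClosed ν) where

    small-𝒫 : ∀ {x} → Small ν x → Small ν (𝒫 x)
    small-𝒫 (β , β∈ , h) = small-≲ (𝒫-≲ h) (proj₂ PC β β∈)

    small-∪ : ∀ {x y} → Small ν x → Small ν y → Small ν (x ∪ y)
    small-∪ (α , α∈ , h) (β , β∈ , k) = small-≲
      (∪-≲ (≲-trans h (⊆⇒≲ λ _ → ∪ˡ)) (≲-trans k (⊆⇒≲ λ _ → ∪ʳ)))
      (small-𝒫 (small-𝒫 (small-∈ (∪-∈ (infinite-ord (proj₁ PC)) α∈ β∈))))

    small-× : ∀ {x y} → Small ν x → Small ν y → Small ν (x ×ₛ y)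
    small-× h k = small-⊆ ×-⊆𝒫𝒫 (small-𝒫 (small-𝒫 (small-∪ h k)))

    small-single : ∀ {x} → Small ν ｛ x ｝
    small-single = S ∅ , S∈-infinite (proj₁ PC) (∅∈-infinite (proj₁ PC)) ,
      (λ _ → ∅) , (λ _ _ → ∈-S) , λ z z′ p q _ → trans (single⁻ p) (sym (single⁻ q))

  -- A listing of x by least rank cannot reach stage ν without having exhausted x.
  rank-≲ : ∀ {ν x} (ρ : V → V) → InfiniteCardinal ν → (∀ z → z ∈ x → ρ z ∈ ν) →
           (∀ β → β ∈ ν → Small ν (sep x λ z → ρ z ∈ β)) → x ≲ ν
  rank-≲ {ν} {x} ρ I@(C@(Oν , _) , _) ρ∈ initial = by-contradiction λ ¬x≲ν →
    let (z₀ , z₀∈ , unseen) = ¬∀⇒∃ λ s → ¬x≲ν (surjection⇒≳ e s)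
        (β , β∈ , h)        = initial (S (ρ z₀)) (S∈-infinite I (ρ∈ z₀ z₀∈))
    in ∈⇒⋨ C β∈ (≲-trans (e , into z₀ z₀∈ unseen , inj z₀ z₀∈ unseen) h)
    where
    New : V → V → V → Set ℓ
    New ξ g z = z ∈ x × (∀ γ → γ ∈ ξ → g ′ γ ≢ z)
    First : V → V → V → Set ℓ
    First ξ g z = New ξ g z × (∀ z′ → New ξ g z′ → ρ z ⊆ ρ z′)
    step : V → V → V
    step ξ g = ε (First ξ g)
    e : V → V
    e = trec step
    Unseen : V → Set ℓ
    Unseen z = ¬ (∃ λ ξ → ξ ∈ ν × e ξ ≡ z)
    first : ∀ {z₀} → z₀ ∈ x → Unseen z₀ → ∀ {ξ} → ξ ∈ ν → First ξ (lam ξ e) (e ξ)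
    first {z₀} z₀∈ unseen {ξ} ξ∈ = subst (First ξ (lam ξ e)) (sym (trec-≡ step (ord-∈ Oν ξ∈)))
      (ε-spec _ exists)
      where
      Occurs : V → Set ℓ
      Occurs β = ∃ λ z → New ξ (lam ξ e) z × ρ z ≡ β
      exists : ∃ λ z → First ξ (lam ξ e) z
      exists =
        let (β , _ , (z , new , eq) , _ , min) = least Occurs (ord-∈ Oν (ρ∈ z₀ z₀∈))
              (z₀ , (z₀∈ , λ γ γ∈ eq → unseen (γ , proj₁ Oν ξ ξ∈ γ γ∈ ,
                trans (sym (lam-β e γ∈)) eq)) , refl)
        in z , new , λ z′ new′ → ∉⇒⊇ (ord-∈ Oν (ρ∈ z (proj₁ new))) (ord-∈ Oν (ρ∈ z′ (proj₁ new′)))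
             λ lt → min (ρ z′) (subst (ρ z′ ∈_) eq lt) (z′ , new′ , refl)
    into : ∀ z₀ → z₀ ∈ x → Unseen z₀ → ∀ ξ → ξ ∈ ν → e ξ ∈ sep x λ z → ρ z ∈ S (ρ z₀)
    into z₀ z₀∈ unseen ξ ξ∈ =
      let ((eξ∈ , _) , min) = first z₀∈ unseen ξ∈
          New-z₀ : New ξ (lam ξ e) z₀
          New-z₀ = z₀∈ , λ γ γ∈ eq →
            unseen (γ , proj₁ Oν ξ ξ∈ γ γ∈ , trans (sym (lam-β e γ∈)) eq)
      in ∈-sep (λ z → ρ z ∈ S (ρ z₀)) eξ∈
           (⊆-∈ {β = ρ z₀} (ord-∈ Oν (ρ∈ (e ξ) eξ∈)) (S-ord (ord-∈ Oν (ρ∈ z₀ z₀∈))) (min z₀ New-z₀) ∈-S)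
    before : ∀ {z₀} → z₀ ∈ x → Unseen z₀ → ∀ {ξ ξ′} → ξ′ ∈ ν → ξ ∈ ξ′ → e ξ ≢ e ξ′
    before z₀∈ unseen ξ′∈ ξ∈ eq =
      proj₂ (proj₁ (first z₀∈ unseen ξ′∈)) _ ξ∈ (trans (lam-β e ξ∈) eq)
    inj : ∀ z₀ → z₀ ∈ x → Unseen z₀ → ∀ ξ ξ′ → ξ ∈ ν → ξ′ ∈ ν → e ξ ≡ e ξ′ → ξ ≡ ξ′
    inj z₀ z₀∈ unseen ξ ξ′ ξ∈ ξ′∈ eq with trichotomy (ord-∈ Oν ξ∈) (ord-∈ Oν ξ′∈)
    ... | inj₁ p        = ⊥-elim (before z₀∈ unseen ξ′∈ p eq)
    ... | inj₂ (inj₁ p) = p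
    ... | inj₂ (inj₂ p) = ⊥-elim (before z₀∈ unseen ξ∈ p (sym eq))

  module _ {ν : V} (PC : PowerClosed ν) where

    -- Pairs are ranked by the maximum of their coordinates, as in Gödel's pairing; those of rank
    -- below `β` lie in `β ×ₛ β`, which is small because `ν` is closed under power sets.
    ×-square : ν ×ₛ ν ≲ ν
    ×-square = rank-≲ (λ p → π₁ p ∪ π₂ p) (proj₁ PC) rank∈ initial
      where
      rank∈ : ∀ p → p ∈ ν ×ₛ ν → π₁ p ∪ π₂ p ∈ ν
      rank∈ p p∈ = let (x , y , x∈ , y∈ , e) = ×⁻ p∈ in
        subst (λ q → π₁ q ∪ π₂ q ∈ ν) e
          (subst₂ (λ a b → a ∪ b ∈ ν) (sym π₁-⟨⟩) (sym π₂-⟨⟩) (∪-∈ (infinite-ord (proj₁ PC)) x∈ y∈))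
      initial : ∀ β → β ∈ ν → Small ν (sep (ν ×ₛ ν) λ p → π₁ p ∪ π₂ p ∈ β)
      initial β β∈ = small-⊆ sub (small-× PC (small-∈ β∈) (small-∈ β∈))
        where
        Oβ = ord-∈ (infinite-ord (proj₁ PC)) β∈
        sub : sep (ν ×ₛ ν) (λ p → π₁ p ∪ π₂ p ∈ β) ⊆ β ×ₛ β
        sub p p∈ =
          let (p∈ν , r)               = sep⁻ _ p∈
              (x , y , x∈ , y∈ , e) = ×⁻ p∈ν
              r′ = subst₂ (λ a b → a ∪ b ∈ β) π₁-⟨⟩ π₂-⟨⟩ (subst (λ q → π₁ q ∪ π₂ q ∈ β) (sym e) r)
          in subst (_∈ β ×ₛ β) e (∈-× (⊆-∈ (ord-∈ (infinite-ord (proj₁ PC)) x∈) Oβ (λ _ → ∪ˡ) r′)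
                                      (⊆-∈ (ord-∈ (infinite-ord (proj₁ PC)) y∈) Oβ (λ _ → ∪ʳ) r′))

    ≲-× : ∀ {x y} → x ≲ ν → y ≲ ν → x ×ₛ y ≲ ν
    ≲-× {x} {y} (f , f∈ , fi) (g , g∈ , gi) = ≲-trans (h , h∈ , hi) ×-square
      where
      h : V → V
      h p = ⟨ f (π₁ p) , g (π₂ p) ⟩
      h∈ : ∀ p → p ∈ x ×ₛ y → h p ∈ ν ×ₛ ν
      h∈ p p∈ = let (a , b , a∈ , b∈ , e) = ×⁻ p∈ in subst (λ q → h q ∈ ν ×ₛ ν) e
        (∈-× (f∈ _ (subst (_∈ x) (sym π₁-⟨⟩) a∈)) (g∈ _ (subst (_∈ y) (sym π₂-⟨⟩) b∈)))
      hi : ∀ p q → p ∈ x ×ₛ y → q ∈ x ×ₛ y → h p ≡ h q → p ≡ q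
      hi p q p∈ q∈ e with ×⁻ p∈ | ×⁻ q∈
      ... | a , b , a∈ , b∈ , refl | a′ , b′ , a′∈ , b′∈ , refl with ⟨⟩-injective e
      ...   | e₁ , e₂ = cong₂ ⟨_,_⟩
        (fi a a′ a∈ a′∈ (trans (cong f (sym π₁-⟨⟩)) (trans e₁ (cong f π₁-⟨⟩))))
        (gi b b′ b∈ b′∈ (trans (cong g (sym π₂-⟨⟩)) (trans e₂ (cong g π₂-⟨⟩))))

    ≲-⋃ : ∀ {x} (f : V → V) → x ≲ ν → (∀ z → z ∈ x → f z ≲ ν) → ⋃ (image f x) ≲ ν
    ≲-⋃ {x} f x≲ h = ≲-trans (k , into , inj) (≲-× x≲ ≲-refl)
      where
      at : V → V
      at w = ε λ z → z ∈ x × w ∈ f z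
      at-spec : ∀ {w} → w ∈ ⋃ (image f x) → at w ∈ x × w ∈ f (at w)
      at-spec w∈ = ε-spec _ (⋃image⁻ f w∈)
      k : V → V
      k w = ⟨ at w , injection (f (at w)) ν w ⟩
      into : ∀ w → w ∈ ⋃ (image f x) → k w ∈ x ×ₛ ν
      into w w∈ with at-spec w∈
      ... | p , q = ∈-× p (proj₁ (injection-spec (h _ p)) w q)
      inj : ∀ w w′ → w ∈ ⋃ (image f x) → w′ ∈ ⋃ (image f x) → k w ≡ k w′ → w ≡ w′
      inj w w′ w∈ w′∈ e with at-spec w∈ | at-spec w′∈ | ⟨⟩-injective e
      ... | p , q | p′ , q′ | e₁ , e₂ = proj₂ (injection-spec (h _ p)) w w′ q
        (subst (λ a → w′ ∈ f a) (sym e₁) q′)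
        (trans e₂ (cong (λ a → injection (f a) ν w′) (sym e₁)))

  -- Regularity appears in the form in which it is applied: sequences shorter than `κ` are bounded.
  Inaccessible : V → Set ℓ
  Inaccessible κ = PowerClosed κ × (∀ α (f : V → V) → α ∈ κ → (∀ i → i ∈ α → f i ∈ κ) →
                                    ∃ λ γ → γ ∈ κ × (∀ i → i ∈ α → f i ⊆ γ))

  module _ {κ : V} (inac : Inaccessible κ) where

    small-bounded : ∀ {x} (f : V → V) → Small κ x → (∀ z → z ∈ x → f z ∈ κ) →
                    ∃ λ γ → γ ∈ κ × (∀ z → z ∈ x → f z ⊆ γ)
    small-bounded {x} f (α , α∈ , a , a∈ , ai) f∈ with proj₂ inac α g α∈ g∈
      where
      g : V → V
      g i = pick (em {∃ λ z → z ∈ x × a z ≡ i}) λ (z , _) → f z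
      g∈ : ∀ i → i ∈ α → g i ∈ κ
      g∈ i i∈ with em {∃ λ z → z ∈ x × a z ≡ i}
      ... | yes (z , z∈ , _) = f∈ z z∈
      ... | no _             = ∅∈-infinite (proj₁ (proj₁ inac))
    ... | γ , γ∈ , h = γ , γ∈ , λ z z∈ → subst (_⊆ γ)
      (pick-yes em _ (z , z∈ , refl) λ (z′ , z′∈ , e) → cong f (ai z′ z z′∈ z∈ e)) (h (a z) (a∈ z z∈))

    small-⋃ : ∀ {x} (f : V → V) → Small κ x → (∀ z → z ∈ x → Small κ (f z)) →
              Small κ (⋃ (image f x))
    small-⋃ {x} f sx h =
      let (γ , γ∈ , sub) = small-bounded b sx λ z z∈ → proj₁ (b-spec z∈)
      in small-≲ (k , into sub , inj sub) (small-× (proj₁ inac) sx (small-∈ γ∈))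
      where
      b : V → V
      b z = ε λ β → β ∈ κ × f z ≲ β
      b-spec : ∀ {z} → z ∈ x → b z ∈ κ × f z ≲ b z
      b-spec {z} z∈ = ε-spec _ (h z z∈)
      at : V → V
      at w = ε λ z → z ∈ x × w ∈ f z
      at-spec : ∀ {w} → w ∈ ⋃ (image f x) → at w ∈ x × w ∈ f (at w)
      at-spec w∈ = ε-spec _ (⋃image⁻ f w∈)
      k : V → V
      k w = ⟨ at w , injection (f (at w)) (b (at w)) w ⟩
      into : ∀ {γ} → (∀ z → z ∈ x → b z ⊆ γ) → ∀ w → w ∈ ⋃ (image f x) → k w ∈ x ×ₛ γ
      into sub w w∈ with at-spec w∈
      ... | p , q = ∈-× p (sub _ p _ (proj₁ (injection-spec (proj₂ (b-spec p))) w q))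
      inj : ∀ {γ} → (∀ z → z ∈ x → b z ⊆ γ) →
            ∀ w w′ → w ∈ ⋃ (image f x) → w′ ∈ ⋃ (image f x) → k w ≡ k w′ → w ≡ w′
      inj sub w w′ w∈ w′∈ e with at-spec w∈ | at-spec w′∈ | ⟨⟩-injective e
      ... | p , q | p′ , q′ | e₁ , e₂ = proj₂ (injection-spec (proj₂ (b-spec p))) w w′ q
        (subst (λ a → w′ ∈ f a) (sym e₁) q′)
        (trans e₂ (cong (λ a → injection (f a) (b a) w′) (sym e₁)))

    inaccessible⇒regular : Regular κ
    inaccessible⇒regular = (proj₁ (proj₁ inac)) , infinite-ord (proj₁ (proj₁ inac)) , (id , (λ _ → id) , λ γ γ∈ → γ , γ∈ , λ _ → id) ,
      λ { α α∈ (f , f∈ , cof) →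
          let (γ , γ∈ , h) = proj₂ inac α f α∈ f∈
              (i , i∈ , k) = cof (S γ) (S∈-infinite (proj₁ (proj₁ inac)) γ∈)
          in ∈-irrefl (h i i∈ γ (k γ ∈-S)) }

  strongLimit⇒powerClosed : ∀ {μ} → StrongLimit μ → PowerClosed μ
  strongLimit⇒powerClosed {μ} (I@(C@(Oμ , _) , _) , h) = I , pow
    where
    pow : ∀ β → β ∈ μ → Small μ (𝒫 β)
    pow β β∈ with small-or-≳ (𝒫 β) C
    ... | inj₁ s = s
    ... | inj₂ μ≲ = ⊥-elim (proj₂ 𝒫ν≺μ (cantor-schröder-bernstein (proj₁ 𝒫ν≺μ)
                      (≲-trans μ≲ (𝒫-≲ (≈⇒≲ (≈-card β))))))
      where
      card∈ : card β ∈ μ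
      card∈ = ⊆-∈ (proj₁ (card-cardinal β)) Oμ
        (≲⇒⊆ (card-cardinal β) (ord-∈ Oμ β∈) (≈⇒≲ (≈-sym (≈-card β)))) β∈
      𝒫ν≺μ = h (card β) (card-cardinal β) card∈

-- Complete filters on measurable and weakly compact cardinals.

module LargeCardinals {ℓ : Level} (𝒵 : ZFC ℓ) where
  open SetTheory 𝒵 renaming (｛_,_｝ to upair)
  open Basic 𝒵
  open Ordinals 𝒵
  open Cardinals 𝒵
  open SmallSets 𝒵

  -- A filter on κ is given by the predicates that hold on one of its members.
  record Filter (κ : V) : Set (Level.suc ℓ) where
    field
      Large     : (V → Set ℓ) → Set ℓ
      mono      : ∀ {P Q : V → Set ℓ} → (∀ α → α ∈ κ → P α → Q α) → Large P → Large Q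
      inhabited : ∀ {P : V → Set ℓ} → Large P → ∃ λ α → α ∈ κ × P α
      complete  : ∀ {a} (P : V → V → Set ℓ) → Small κ a → (∀ x → x ∈ a → Large (P x)) →
                  Large λ α → ∀ x → x ∈ a → P x α
      both      : ∀ {P Q : V → Set ℓ} → Large P → Large Q → Large λ α → P α × Q α
      final     : ∀ {β} → β ∈ κ → Large λ α → β ⊆ α

  Decides : ∀ {κ} → Filter κ → (V → Set ℓ) → Set ℓ
  Decides F P = Filter.Large F P ⊎ Filter.Large F (λ α → ¬ P α)

  module MeasurableCardinal {κ : V} (mκ : Measurable κ) where

    private
      C : Cardinal κ
      C = proj₁ mκ

      Oκ : Ordinal κ
      Oκ = proj₁ C

      ω∈κ : ω ∈ κ
      ω∈κ = proj₁ (proj₂ mκ)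

      U : V
      U = proj₁ (proj₂ (proj₂ mκ))

      ultrafilter : Ultrafilter U κ
      ultrafilter = proj₁ (proj₂ (proj₂ (proj₂ mκ)))

      nonprincipal : Nonprincipal U κ
      nonprincipal = proj₁ (proj₂ (proj₂ (proj₂ (proj₂ mκ))))

      U-complete : Complete κ U κ
      U-complete = proj₂ (proj₂ (proj₂ (proj₂ (proj₂ mκ))))

    infiniteCardinal : InfiniteCardinal κ
    infiniteCardinal = C , proj₁ Oκ ω ω∈κ

    U-inhabited : ∀ {P : V → Set ℓ} → sep κ P ∈ U → ∃ λ α → α ∈ κ × P α
    U-inhabited {P} X∈ = let (_ , _ , ∅∉U , _) = ultrafilter in by-contradiction λ none → ∅∉U (subst (_∈ U)
      (empty λ z z∈ → none (z , sep⁻ P z∈)) X∈)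

    U-mono : ∀ {P Q : V → Set ℓ} → (∀ α → α ∈ κ → P α → Q α) → sep κ P ∈ U → sep κ Q ∈ U
    U-mono {P} {Q} h X∈ = let (_ , _ , _ , _ , ↑U , _) = ultrafilter in ↑U _ _ X∈
      (λ z z∈ → let (z∈κ , p) = sep⁻ P z∈ in ∈-sep Q z∈κ (h z z∈κ p)) λ z z∈ → proj₁ (sep⁻ Q z∈)

    U-both : ∀ {P Q : V → Set ℓ} → sep κ P ∈ U → sep κ Q ∈ U → sep κ (λ α → P α × Q α) ∈ U
    U-both {P} {Q} X∈ Y∈ = let (_ , _ , _ , ∩U , _) = ultrafilter in subst (_∈ U) (ext
      (λ z z∈ → let (p , q) = sep⁻ _ z∈ ; (z∈κ , p′) = sep⁻ P p in
        ∈-sep _ z∈κ (p′ , proj₂ (sep⁻ Q q)))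
      (λ z z∈ → let (z∈κ , p , q) = sep⁻ _ z∈ in ∈-sep _ (∈-sep P z∈κ p) (∈-sep Q z∈κ q)))
      (∩U _ _ X∈ Y∈)

    U-decides : ∀ (P : V → Set ℓ) → sep κ P ∈ U ⊎ sep κ (λ α → ¬ P α) ∈ U
    U-decides P with proj₂ (proj₂ (proj₂ (proj₂ (proj₂ ultrafilter)))) (sep κ P) (λ z z∈ → proj₁ (sep⁻ P z∈))
    ... | inj₁ p = inj₁ p
    ... | inj₂ q = inj₂ (subst (_∈ U) (ext
      (λ z z∈ → let (z∈κ , ¬p) = ∖⁻ z∈ in ∈-sep _ z∈κ λ p → ¬p (∈-sep P z∈κ p))
      (λ z z∈ → let (z∈κ , ¬p) = sep⁻ (λ α → ¬ P α) z∈ in ∈-∖ z∈κ λ p → ¬p (proj₂ (sep⁻ P p)))) q)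

    U-⋂ : ∀ {β} (P : V → V → Set ℓ) → β ∈ κ → (∀ i → i ∈ β → sep κ (P i) ∈ U) →
          sep κ (λ α → ∀ i → i ∈ β → P i α) ∈ U
    U-⋂ {β} P β∈ h = U-mono (λ α α∈ q i i∈ → proj₂ (sep⁻ (P i) (q i i∈)))
      (U-complete β (λ i → sep κ (P i)) β∈ h)

    U-≢ : ∀ {i} → i ∈ κ → sep κ (λ α → α ≢ i) ∈ U
    U-≢ {i} i∈ with U-decides (_≡ i)
    ... | inj₂ q = q
    ... | inj₁ q = ⊥-elim (nonprincipal i i∈ (subst (_∈ U) (ext
      (λ z z∈ → subst (_∈ ｛ i ｝) (sym (proj₂ (sep⁻ (_≡ i) z∈))) ∈-single)
      (λ z z∈ → ∈-sep (_≡ i) (subst (_∈ κ) (sym (single⁻ z∈)) i∈) (single⁻ z∈))) q))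

    U-final : ∀ {β} → β ∈ κ → sep κ (λ α → β ⊆ α) ∈ U
    U-final {β} β∈ = U-mono
      (λ α α∈ q → ∉⇒⊇ (ord-∈ Oκ β∈) (ord-∈ Oκ α∈) λ α∈β → q α α∈β refl)
      (U-⋂ (λ i α → α ≢ i) β∈ λ i i∈ → U-≢ (proj₁ Oκ β β∈ i i∈))

    -- The final segments above the values `f i` are fewer than `κ` members of the ultrafilter, so
    -- some ordinal lies in all of them; it is a bound.
    U-bounded : ∀ α (f : V → V) → α ∈ κ → (∀ i → i ∈ α → f i ∈ κ) →
                ∃ λ γ → γ ∈ κ × (∀ i → i ∈ α → f i ⊆ γ)
    U-bounded α f α∈ f∈ = U-inhabited (U-⋂ (λ i γ → f i ⊆ γ) α∈ λ i i∈ → U-final (f∈ i i∈))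

    -- κ ≲ 𝒫 β would give κ sequences in 2^β; deciding every coordinate
    -- leaves at most one of them.
    U-power : ∀ β → β ∈ κ → Small κ (𝒫 β)
    U-power β β∈ with small-or-≳ (𝒫 β) C
    ... | inj₁ s                = s
    ... | inj₂ (f , f∈ , f-inj) = ⊥-elim (contra (λ i → em))
      where
      Agrees : ∀ i → Dec (sep κ (λ ξ → i ∈ f ξ) ∈ U) → V → Set ℓ
      Agrees i (yes _) ξ = i ∈ f ξ
      Agrees i (no _)  ξ = ¬ i ∈ f ξ
      agrees-U : ∀ i d → sep κ (Agrees i d) ∈ U
      agrees-U i (yes p) = p
      agrees-U i (no q)  = [ (λ p → ⊥-elim (q p)) , id ]′ (U-decides λ ξ → i ∈ f ξ)
      agree : ∀ i d {ξ ξ′} → Agrees i d ξ → Agrees i d ξ′ → i ∈ f ξ → i ∈ f ξ′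
      agree i (yes _) _ q _ = q
      agree i (no _)  p _ r = ⊥-elim (p r)
      contra : ¬ (∀ i → Dec (sep κ (λ ξ → i ∈ f ξ) ∈ U))
      contra d =
        let all = U-⋂ (λ i → Agrees i (d i)) β∈ λ i _ → agrees-U i (d i)
            (ξ , ξ∈ , p)        = U-inhabited all
            (ξ′ , ξ′∈ , q , ne) = U-inhabited (U-both all (U-≢ ξ∈))
        in ne (f-inj ξ′ ξ ξ′∈ ξ∈ (ext
             (λ i i∈ → agree i (d i) (q i (𝒫⁻ (f∈ ξ′ ξ′∈) i i∈)) (p i (𝒫⁻ (f∈ ξ′ ξ′∈) i i∈)) i∈)
             (λ i i∈ → agree i (d i) (p i (𝒫⁻ (f∈ ξ ξ∈) i i∈)) (q i (𝒫⁻ (f∈ ξ ξ∈) i i∈)) i∈)))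

    inaccessible : Inaccessible κ
    inaccessible = (infiniteCardinal , U-power) , U-bounded

    filter : Filter κ
    filter = record
      { Large     = λ P → sep κ P ∈ U
      ; mono      = U-mono
      ; inhabited = U-inhabited
      ; complete  = λ { P (β , β∈ , f , f∈ , f-inj) h → U-mono
          (λ α _ q x x∈ → q (f x) (f∈ x x∈) x x∈ refl)
          (U-⋂ (λ i α → ∀ x → x ∈ _ → f x ≡ i → P x α) β∈ λ i i∈ → pre P f f-inj h i em) }
      ; both      = U-both
      ; final     = U-final
      }
      where
      pre : ∀ {a} (P : V → V → Set ℓ) (f : V → V) →
            (∀ x y → x ∈ a → y ∈ a → f x ≡ f y → x ≡ y) → (∀ x → x ∈ a → sep κ (P x) ∈ U) →
            ∀ i → Dec (∃ λ x → x ∈ a × f x ≡ i) → sep κ (λ α → ∀ x → x ∈ a → f x ≡ i → P x α) ∈ U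
      pre P f f-inj h i (yes (x , x∈ , e)) = U-mono
        (λ α _ p y y∈ e′ → subst (λ z → P z α) (f-inj x y x∈ y∈ (trans e (sym e′))) p) (h x x∈)
      -- For an index outside the range of `f` the condition is vacuous, and any known member of `U`
      -- will do.
      pre P f f-inj h i (no none) = U-mono
        (λ α _ _ x x∈ e → ⊥-elim (none (x , x∈ , e))) (U-final (proj₁ Oκ ω ω∈κ ∅ ∅∈ω))

    filter-decides : ∀ P → Decides filter P
    filter-decides = U-decides

  module WeaklyCompactCardinal {κ : V} (wκ : WeaklyCompact κ) where

    private
      C : Cardinal κ
      C = proj₁ wκ

      Oκ : Ordinal κ
      Oκ = proj₁ C

      ω∈κ : ω ∈ κ
      ω∈κ = proj₁ (proj₂ wκ)

    infiniteCardinal : InfiniteCardinal κ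
    infiniteCardinal = C , proj₁ Oκ ω ω∈κ

    Unbounded : V → Set ℓ
    Unbounded H = H ⊆ κ × (∀ γ → γ ∈ κ → ∃ λ α → α ∈ H × γ ⊆ α)

    unbounded : ∀ {H} → H ⊆ κ → H ≈ κ → Unbounded H
    unbounded {H} H⊆ H≈ = H⊆ , λ γ γ∈ → by-contradiction λ none →
      ∈⇒⋨ C γ∈ (≲-trans (≈⇒≲ (≈-sym H≈)) (⊆⇒≲ λ α α∈ → by-contradiction λ α∉ →
        none (α , α∈ , ∉⇒⊇ (ord-∈ Oκ γ∈) (ord-∈ Oκ (H⊆ α α∈)) α∉)))

    -- The partition relation concerns unordered pairs; a binary relation becomes a colouring by
    -- reading each pair with its smaller member first.
    homogeneous : ∀ (R : V → V → Set ℓ) → ∃ λ H → Unbounded H × H ≈ κ ×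
      ((∀ α β → α ∈ β → α ∈ H → β ∈ H → R α β) ⊎ (∀ α β → α ∈ β → α ∈ H → β ∈ H → ¬ R α β))
    homogeneous R with proj₂ (proj₂ wκ) c
      where
      c = sep (𝒫 κ) λ p → ∃ λ α → ∃ λ β → α ∈ β × R α β × p ≡ upair α β
    ... | H , H⊆ , H≈ , inj₁ hom = H , unbounded H⊆ H≈ , H≈ , inj₁ λ α β α∈β α∈ β∈ →
      let (_ , α′ , β′ , lt , r , e) = sep⁻ _ (hom α β α∈ β∈ λ { refl → ∈-irrefl α∈β })
          (p , q) = ordered α∈β lt e
      in subst₂ R (sym p) (sym q) r
      where
      ordered : ∀ {α β α′ β′} → α ∈ β → α′ ∈ β′ → upair α β ≡ upair α′ β′ → α ≡ α′ × β ≡ β′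
      ordered {α} {β} {α′} {β′} lt lt′ e
        with pair⁻ (subst (α ∈_) e ∈-pairˡ) | pair⁻ (subst (β ∈_) e ∈-pairʳ)
      ... | inj₁ refl | inj₂ q    = refl , q
      ... | inj₁ refl | inj₁ refl = ⊥-elim (∈-irrefl lt)
      ... | inj₂ refl | inj₁ refl = ⊥-elim (∈-asym lt lt′)
      ... | inj₂ refl | inj₂ refl = ⊥-elim (∈-irrefl lt)
    ... | H , H⊆ , H≈ , inj₂ hom = H , unbounded H⊆ H≈ , H≈ , inj₂ λ α β α∈β α∈ β∈ r →
      hom α β α∈ β∈ (λ { refl → ∈-irrefl α∈β })
        (∈-sep _ (∈-𝒫 (upair-⊆ (H⊆ α α∈) (H⊆ β β∈))) (α , β , α∈β , r , refl))

    -- If f were unbounded on α, colour a pair by whether its members first lie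
    -- below the same f i.
    wc-bounded : ∀ α (f : V → V) → α ∈ κ → (∀ i → i ∈ α → f i ∈ κ) →
                 ∃ λ γ → γ ∈ κ × (∀ i → i ∈ α → f i ⊆ γ)
    wc-bounded α f α∈ f∈ = by-contradiction λ unbdd → contra (cover unbdd) (homogeneous Same)
      where
      Oα = ord-∈ Oκ α∈
      Block : V → V → Set ℓ
      Block ξ i = i ∈ α × ξ ∈ f i × (∀ j → j ∈ i → ¬ ξ ∈ f j)
      Same : V → V → Set ℓ
      Same ξ η = ∃ λ i → Block ξ i × Block η i
      cover : ¬ (∃ λ γ → γ ∈ κ × (∀ i → i ∈ α → f i ⊆ γ)) → ∀ ξ → ξ ∈ κ → ∃ (Block ξ)
      cover unbdd ξ ξ∈ =
        let (i , i∈ , ¬sub) = ¬∀⇒∃ λ h → unbdd (ξ , ξ∈ , h)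
            ξ∈fi = [ (λ p → ⊥-elim (¬sub p)) , id ]′ (⊆-or-∋ (ord-∈ Oκ (f∈ i i∈)) (ord-∈ Oκ ξ∈))
            (j , Oj , p , j⊆i , min) = least (λ j → ξ ∈ f j) (ord-∈ Oα i∈) ξ∈fi
        in j , ⊆-∈ Oj Oα j⊆i i∈ , p , min
      unique : ∀ {ξ i j} → Block ξ i → Block ξ j → i ≡ j
      unique (i∈ , p , min) (j∈ , q , min′) with trichotomy (ord-∈ Oα i∈) (ord-∈ Oα j∈)
      ... | inj₁ lt        = ⊥-elim (min′ _ lt p)
      ... | inj₂ (inj₁ e)  = e
      ... | inj₂ (inj₂ lt) = ⊥-elim (min _ lt q)
      Homogeneous : Set ℓ
      Homogeneous = ∃ λ H → Unbounded H × H ≈ κ ×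
        ((∀ α β → α ∈ β → α ∈ H → β ∈ H → Same α β) ⊎ (∀ α β → α ∈ β → α ∈ H → β ∈ H → ¬ Same α β))
      contra : (∀ ξ → ξ ∈ κ → ∃ (Block ξ)) → ¬ Homogeneous
      -- A set inside one block lies below a single `f i`, against unboundedness.
      contra blocks (H , (H⊆ , unbd) , _ , inj₁ same) =
        let (ξ , ξ∈ , _)            = unbd ∅ (proj₁ Oκ ω ω∈κ ∅ ∅∈ω)
            (i , bl@(i∈ , _))       = blocks ξ (H⊆ ξ ξ∈)
            (η , η∈ , sub)          = unbd (S ξ ∪ f i)
              (∪-∈ Oκ (S∈-infinite infiniteCardinal (H⊆ ξ ξ∈)) (f∈ i i∈))
            (j , bl′ , _ , η∈fj , _) = same ξ η (sub ξ (∪ˡ ∈-S)) ξ∈ η∈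
        in ∈-irrefl (sub η (∪ʳ (subst (λ k → η ∈ f k) (unique bl′ bl) η∈fj)))
      -- A set that meets each block at most once injects into `α`, against `H ≈ κ`.
      contra blocks (H , (H⊆ , _) , H≈ , inj₂ diff) =
        ∈⇒⋨ C α∈ (≲-trans (≈⇒≲ (≈-sym H≈))
          ((λ ξ → ε (Block ξ)) , (λ ξ ξ∈ → proj₁ (block ξ∈)) , inj))
        where
        block : ∀ {ξ} → ξ ∈ H → Block ξ (ε (Block ξ))
        block {ξ} ξ∈ = ε-spec (Block ξ) (blocks ξ (H⊆ ξ ξ∈))
        inj : ∀ ξ η → ξ ∈ H → η ∈ H → ε (Block ξ) ≡ ε (Block η) → ξ ≡ η
        inj ξ η ξ∈ η∈ e with trichotomy (ord-∈ Oκ (H⊆ ξ ξ∈)) (ord-∈ Oκ (H⊆ η η∈))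
        ... | inj₂ (inj₁ p) = p
        ... | inj₁ lt =
          ⊥-elim (diff ξ η lt ξ∈ η∈ (_ , block ξ∈ , subst (Block η) (sym e) (block η∈)))
        ... | inj₂ (inj₂ lt) =
          ⊥-elim (diff η ξ lt η∈ ξ∈ (_ , block η∈ , subst (Block ξ) e (block ξ∈)))

    -- As `α` and `β` may be exchanged, the single implication makes the truth value of `A i`
    -- constant on `H` from `γ` on.
    Settled : (V → V → Set ℓ) → V → V → V → Set ℓ
    Settled A H i γ = ∀ α β → α ∈ H → β ∈ H → γ ⊆ α → γ ⊆ β → A i α → A i β

    -- A pair is coloured by whether its characteristic sequences i ↦ A i increase
    -- lexicographically; on a homogeneous set the sequences are monotone, and by
    -- induction each of their initial segments is eventually constant.
    settling : ∀ (A : V → V → Set ℓ) →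
               ∃ λ H → Unbounded H × (∀ i → i ∈ κ → ∃ λ γ → γ ∈ κ × Settled A H i γ)
    settling A =
      let (H , U , _ , hom) = homogeneous Lex
      in H , U , λ i i∈ → ord-ind (λ i → i ∈ κ → ∃ λ γ → γ ∈ κ × Settled A H i γ)
           (step H U hom) i (ord-∈ Oκ i∈) i∈
      where
      Lex : V → V → Set ℓ
      Lex α β = ∃ λ i → i ∈ κ × ¬ A i α × A i β × (∀ j → j ∈ i → A j α ⇔ A j β)
      Hom : V → Set ℓ
      Hom H = (∀ α β → α ∈ β → α ∈ H → β ∈ H → Lex α β) ⊎
              (∀ α β → α ∈ β → α ∈ H → β ∈ H → ¬ Lex α β)
      step : ∀ H → Unbounded H → Hom H → ∀ i → Ordinal i →
             (∀ j → j ∈ i → j ∈ κ → ∃ λ γ → γ ∈ κ × Settled A H j γ) →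
             i ∈ κ → ∃ λ γ → γ ∈ κ × Settled A H i γ
      step H (H⊆ , _) hom i Oi ih i∈ =
        let (γ , γ∈ , bd) = wc-bounded i g i∈ λ j j∈ → proj₁ (g-spec j∈) in finish γ γ∈ bd hom
        where
        g : V → V
        g j = ε λ γ → γ ∈ κ × Settled A H j γ
        g-spec : ∀ {j} → j ∈ i → g j ∈ κ × Settled A H j (g j)
        g-spec {j} j∈ = ε-spec _ (ih j j∈ (proj₁ Oκ i i∈ j j∈))
        module _ (γ : V) (γ∈ : γ ∈ κ) (bd : ∀ j → j ∈ i → g j ⊆ γ) where
          below : ∀ {j α β} → j ∈ i → α ∈ H → β ∈ H → γ ⊆ α → γ ⊆ β → A j α → A j β
          below j∈ α∈ β∈ p q = proj₂ (g-spec j∈) _ _ α∈ β∈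
            (λ z z∈ → p z (bd _ j∈ z z∈)) (λ z z∈ → q z (bd _ j∈ z z∈))
          above : ∀ {α₀ β} → β ∈ H → γ ⊆ α₀ → S α₀ ⊆ β → γ ⊆ β
          above β∈ p q z z∈ = proj₁ (ord-∈ Oκ (H⊆ _ β∈)) _ (q _ ∈-S) z (p z z∈)
          finish : Hom H → ∃ λ γ → γ ∈ κ × Settled A H i γ
          -- Beyond `γ` the coordinates below `i` no longer change, so in an increasing family
          -- coordinate `i` can change only from false to true.
          finish (inj₁ inc) with em {∃ λ α₀ → α₀ ∈ H × γ ⊆ α₀ × A i α₀}
          ... | no none = γ , γ∈ , λ α β α∈ β∈ p q a → ⊥-elim (none (α , α∈ , p , a))
          ... | yes (α₀ , α₀∈ , p , a₀) = S α₀ , S∈-infinite infiniteCardinal (H⊆ _ α₀∈) , λ α β α∈ β∈ _ q _ → stays β∈ q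
            where
            stays : ∀ {β} → β ∈ H → S α₀ ⊆ β → A i β
            stays β∈ q with inc α₀ _ (q _ ∈-S) α₀∈ β∈
            ... | k , k∈ , ¬a , a , agree with trichotomy (ord-∈ Oκ k∈) Oi
            ...   | inj₁ k∈i         = ⊥-elim (¬a (below k∈i β∈ α₀∈ (above β∈ p q) p a))
            ...   | inj₂ (inj₁ refl) = a
            ...   | inj₂ (inj₂ i∈k)  = to (agree i i∈k) a₀
          -- In a family that never increases, coordinate `i` can change beyond `γ` only from true
          -- to false: the opposite change would be a lexicographic increase at `i`.
          finish (inj₂ dec) with em {∃ λ α₀ → α₀ ∈ H × γ ⊆ α₀ × ¬ A i α₀}
          ... | no none = γ , γ∈ , λ α β α∈ β∈ p q a →
            by-contradiction λ ¬b → none (β , β∈ , q , ¬b)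
          ... | yes (α₀ , α₀∈ , p , ¬a₀) = S α₀ , S∈-infinite infiniteCardinal (H⊆ _ α₀∈) , λ α β α∈ β∈ q _ a →
            ⊥-elim (dec α₀ α (q _ ∈-S) α₀∈ α∈ (i , i∈ , ¬a₀ , a , λ j j∈ → mk⇔
              (below j∈ α₀∈ α∈ p (above α∈ p q)) (below j∈ α∈ α₀∈ (above α∈ p q) p)))

    -- An injection of `κ` into `𝒫 β` gives `κ` binary sequences of length `β`. Beyond a common
    -- bound all coordinates are settled, so two different sequences coincide.
    wc-power : ∀ β → β ∈ κ → Small κ (𝒫 β)
    wc-power β β∈ with small-or-≳ (𝒫 β) C
    ... | inj₁ s                = s
    ... | inj₂ (f , f∈ , f-inj) =
      let (H , (H⊆ , unbd) , settled) = settling A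
          s : ∀ {i} → i ∈ β → ∃ λ γ → γ ∈ κ × Settled A H i γ
          s i∈ = settled _ (proj₁ Oκ β β∈ _ i∈)
          g-spec : ∀ {i} → i ∈ β → g H i ∈ κ × Settled A H i (g H i)
          g-spec i∈ = ε-spec _ (s i∈)
          (γ , γ∈ , bd)      = wc-bounded β (g H) β∈ λ i i∈ → proj₁ (g-spec i∈)
          (ξ , ξ∈ , γ⊆ξ)     = unbd γ γ∈
          (ξ′ , ξ′∈ , sub)   = unbd (S ξ ∪ γ)
            (∪-∈ Oκ (S∈-infinite infiniteCardinal (H⊆ ξ ξ∈)) γ∈)
          half : ∀ {ξ ξ′} → ξ ∈ H → ξ′ ∈ H → γ ⊆ ξ → γ ⊆ ξ′ → f ξ ⊆ f ξ′
          half ξ∈ ξ′∈ p q i i∈ = let i∈β = 𝒫⁻ (f∈ _ (H⊆ _ ξ∈)) i i∈ in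
            proj₂ (g-spec i∈β) _ _ ξ∈ ξ′∈ (λ z z∈ → p z (bd i i∈β z z∈))
              (λ z z∈ → q z (bd i i∈β z z∈)) i∈
          γ⊆ξ′ : γ ⊆ ξ′
          γ⊆ξ′ z z∈ = sub z (∪ʳ z∈)
      in ⊥-elim (∈-irrefl (subst (ξ ∈_)
           (sym (f-inj ξ ξ′ (H⊆ ξ ξ∈) (H⊆ ξ′ ξ′∈) (ext (half ξ∈ ξ′∈ γ⊆ξ γ⊆ξ′) (half ξ′∈ ξ∈ γ⊆ξ′ γ⊆ξ))))
           (sub ξ (∪ˡ ∈-S))))
      where
      A : V → V → Set ℓ
      A i ξ = i ∈ f ξ
      g : V → V → V
      g H i = ε λ γ → γ ∈ κ × Settled A H i γ

    inaccessible : Inaccessible κ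
    inaccessible = (infiniteCardinal , wc-power) , wc-bounded

    -- The final segments of a settling set `H` generate the filter; it is complete because `κ` is
    -- regular.
    deciding-filter : ∀ (A : V → V → Set ℓ) → Σ (Filter κ) λ F → ∀ i → i ∈ κ → Decides F (A i)
    deciding-filter A =
      let (H , U , settled) = settling A in F H U , decide H U settled
      where
      module _ (H : V) (U : Unbounded H) where
        F : Filter κ
        F = record
          { Large     = λ P → ∃ λ γ → γ ∈ κ × (∀ α → α ∈ H → γ ⊆ α → P α)
          ; mono      = λ h (γ , γ∈ , p) → γ , γ∈ , λ α α∈ q → h α (proj₁ U α α∈) (p α α∈ q)
          ; inhabited = λ (γ , γ∈ , p) → let (α , α∈ , q) = proj₂ U γ γ∈ in α , proj₁ U α α∈ , p α α∈ q
          ; complete  = λ P sa h →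
              let g-spec : ∀ {x} → x ∈ _ → _
                  g-spec {x} x∈ = ε-spec (λ γ → γ ∈ κ × (∀ α → α ∈ H → γ ⊆ α → P x α)) (h x x∈)
                  (γ , γ∈ , bd) = small-bounded inaccessible _ sa λ x x∈ → proj₁ (g-spec x∈)
              in γ , γ∈ , λ α α∈ q x x∈ → proj₂ (g-spec x∈) α α∈ λ z z∈ → q z (bd x x∈ z z∈)
          ; both      = λ (γ , γ∈ , p) (δ , δ∈ , q) → γ ∪ δ , ∪-∈ Oκ γ∈ δ∈ , λ α α∈ sub →
              p α α∈ (λ z z∈ → sub z (∪ˡ z∈)) , q α α∈ (λ z z∈ → sub z (∪ʳ z∈))
          ; final     = λ β∈ → _ , β∈ , λ α α∈ q → q
          }
        decide : (∀ i → i ∈ κ → ∃ λ γ → γ ∈ κ × Settled A H i γ) → ∀ i → i ∈ κ → Decides F (A i)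
        decide settled i i∈ with settled i i∈
        ... | γ , γ∈ , s with em {∃ λ α₀ → α₀ ∈ H × γ ⊆ α₀ × A i α₀}
        ...   | yes (α₀ , α₀∈ , p , a) = inj₁ (γ , γ∈ , λ α α∈ q → s α₀ α α₀∈ α∈ p q a)
        ...   | no none                = inj₂ (γ , γ∈ , λ α α∈ q a → none (α , α∈ , q , a))

module SetTheoryLemmas {ℓ : Level} (𝒵 : ZFC ℓ) where
  open SetTheory 𝒵 hiding (｛_,_｝) public
  open Basic 𝒵 public
  open Ordinals 𝒵 public
  open Cardinals 𝒵 public
  open SmallSets 𝒵 public
  open LargeCardinals 𝒵 public

-- Structures, isomorphisms and transport of structure.

module StructureLemmas {ℓ : Level} (𝒵 : ZFC ℓ) (τ : SetTheory.Vocabulary 𝒵) where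
  open SetTheoryLemmas 𝒵
  open Structures τ

  mapTuple-∈ : ∀ {f a b n x} → (∀ z → z ∈ a → f z ∈ b) → x ∈ a ^ₛ n → mapTuple f n x ∈ b ^ₛ n
  mapTuple-∈ {f} {b = b} {x = x} h x∈ = ∈-^ (lam-function _) λ i i∈ →
    subst (_∈ b) (sym (lam-β (λ i → f (x ′ i)) i∈)) (h _ (proj₂ (^⁻ x∈) i i∈))

  mapTuple-cong : ∀ {f g a n x} → (∀ z → z ∈ a → f z ≡ g z) → x ∈ a ^ₛ n →
                  mapTuple f n x ≡ mapTuple g n x
  mapTuple-cong h x∈ = lam-cong λ i i∈ → h _ (proj₂ (^⁻ x∈) i i∈)

  mapTuple-id : ∀ {f a n x} → (∀ z → z ∈ a → f z ≡ z) → x ∈ a ^ₛ n → mapTuple f n x ≡ x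
  mapTuple-id {f} {x = x} h x∈ = function-ext (lam-function _) (proj₁ (^⁻ x∈)) λ i i∈ →
    trans (lam-β (λ i → f (x ′ i)) i∈) (h _ (proj₂ (^⁻ x∈) i i∈))

  mapTuple-∘ : ∀ f g n x → mapTuple g n (mapTuple f n x) ≡ mapTuple (g ∘ f) n x
  mapTuple-∘ f g n x = lam-cong λ i i∈ → cong g (lam-β (λ i → f (x ′ i)) i∈)

  univ-⟨⟩ : ∀ {A I} → univ ⟨ A , I ⟩ ≡ A
  univ-⟨⟩ = π₁-⟨⟩

  interp-⟨⟩ : ∀ {A} (I : V → V) {s} → s ∈ Sym → interp ⟨ A , lam Sym I ⟩ s ≡ I s
  interp-⟨⟩ I {s} s∈ = trans (cong (_′ s) π₂-⟨⟩) (lam-β I s∈)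

  structure-⟨⟩ : ∀ {A} (I : V → V) →
    (∀ s → s ∈ Sym → ¬ s ∈ Fun → I s ⊆ A ^ₛ arity s) →
    (∀ s → s ∈ Fun → FunctionOn (I s) (A ^ₛ arity s) × (∀ x → x ∈ A ^ₛ arity s → I s ′ x ∈ A)) →
    Structure ⟨ A , lam Sym I ⟩
  structure-⟨⟩ {A} I rel fun =
    cong₂ ⟨_,_⟩ (sym π₁-⟨⟩) (sym π₂-⟨⟩) ,
    subst (λ J → FunctionOn J Sym) (sym π₂-⟨⟩) (lam-function I) ,
    (λ s s∈ s∉ → subst₂ (λ B J → J ⊆ B ^ₛ arity s) (sym univ-⟨⟩) (sym (interp-⟨⟩ I s∈)) (rel s s∈ s∉)) ,
    λ s s∈ → subst₂
      (λ B J → FunctionOn J (B ^ₛ arity s) × (∀ x → x ∈ B ^ₛ arity s → J ′ x ∈ B))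
      (sym univ-⟨⟩) (sym (interp-⟨⟩ I (Fun⊆Sym s s∈))) (fun s s∈)

  function-closed : ∀ {M s x} → Structure M → s ∈ Fun → x ∈ tuples M s → interp M s ′ x ∈ univ M
  function-closed (_ , _ , _ , fun) s∈ x∈ = proj₂ (fun _ s∈) _ x∈

  structure-ext : ∀ {M N} → Structure M → Structure N → univ M ≡ univ N →
                  (∀ s → s ∈ Sym → interp M s ≡ interp N s) → M ≡ N
  structure-ext (eM , FM , _) (eN , FN , _) e h =
    trans eM (trans (cong₂ ⟨_,_⟩ e (function-ext FM FN h)) (sym eN))

  interp-⊆ : ∀ {M N s} → M ⊆ₘ N → s ∈ Sym → interp M s ⊆ interp N s
  interp-⊆ {M} {N} {s} ((_ , _ , relM , funM) , (_ , _ , _ , funN) , sub , rel , fun) s∈ with em {s ∈ Fun}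
  ... | yes p = function-⊆ (proj₁ (funM s p)) (proj₁ (funN s p)) (^-mono sub) (fun s p)
  ... | no p  = λ x x∈ → to (rel s s∈ p x (relM s s∈ p x x∈)) x∈

  ⊆ₘ-antisym : ∀ {M N} → M ⊆ₘ N → N ⊆ₘ M → M ≡ N
  ⊆ₘ-antisym p@(SM , SN , sub , _) q@(_ , _ , sub′ , _) =
    structure-ext SM SN (ext sub sub′) λ s s∈ → ext (interp-⊆ p s∈) (interp-⊆ q s∈)

  ⊆ₘ-within : ∀ {M N P} → M ⊆ₘ P → N ⊆ₘ P → univ M ⊆ univ N → M ⊆ₘ N
  ⊆ₘ-within (SM , _ , _ , rel , fun) (SN , _ , _ , rel′ , fun′) sub = SM , SN , sub ,
    (λ s s∈ s∉ x x∈ → mk⇔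
      (λ h → from (rel′ s s∈ s∉ x (^-mono sub x x∈)) (to (rel s s∈ s∉ x x∈) h))
      (λ h → from (rel s s∈ s∉ x x∈) (to (rel′ s s∈ s∉ x (^-mono sub x x∈)) h))) ,
    λ s s∈ x x∈ → trans (fun s s∈ x x∈) (sym (fun′ s s∈ x (^-mono sub x x∈)))

  Iso-id : ∀ {M} → Structure M → Iso id M M
  Iso-id {M} SM = SM , SM , ((((λ _ → id) , λ _ _ _ _ e → e)) , λ w w∈ → w , w∈ , refl) ,
    (λ s s∈ s∉ x x∈ → mk⇔ (subst (_∈ interp M s) (sym (mapTuple-id (λ _ _ → refl) x∈)))
                          (subst (_∈ interp M s) (mapTuple-id (λ _ _ → refl) x∈))) ,
    λ s s∈ x x∈ → cong (interp M s ′_) (sym (mapTuple-id (λ _ _ → refl) x∈))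

  Iso-cong : ∀ {f g M N} → (∀ z → z ∈ univ M → f z ≡ g z) → Iso f M N → Iso g M N
  Iso-cong {f} {g} {M} {N} h (SM , SN , ((f∈ , fi) , fs) , rel , fun) = SM , SN ,
    (((λ z z∈ → subst (_∈ univ N) (h z z∈) (f∈ z z∈)) ,
      λ z z′ z∈ z′∈ e → fi z z′ z∈ z′∈ (trans (h z z∈) (trans e (sym (h z′ z′∈))))) ,
     λ w w∈ → let (z , z∈ , e) = fs w w∈ in z , z∈ , trans (sym (h z z∈)) e) ,
    (λ s s∈ s∉ x x∈ → subst (λ y → x ∈ interp M s ⇔ y ∈ interp N s) (mapTuple-cong h x∈)
                        (rel s s∈ s∉ x x∈)) ,
    λ s s∈ x x∈ → trans (sym (h _ (function-closed SM s∈ x∈)))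
      (trans (fun s s∈ x x∈) (cong (interp N s ′_) (mapTuple-cong h x∈)))

  Iso-∘ : ∀ {f g M N P} → Iso f M N → Iso g N P → Iso (g ∘ f) M P
  Iso-∘ {f} {g} {M} {N} {P} (SM , _ , (fi , fs) , rel , fun) (_ , SP , (gi , gs) , rel′ , fun′) =
    SM , SP , proj₂ (≈-trans {univ M} {univ N} {univ P} (f , fi , fs) (g , gi , gs)) ,
    (λ s s∈ s∉ x x∈ → subst (λ y → x ∈ interp M s ⇔ y ∈ interp P s) (mapTuple-∘ f g _ x) (mk⇔
      (λ h → to (rel′ s s∈ s∉ _ (mapTuple-∈ (proj₁ fi) x∈)) (to (rel s s∈ s∉ x x∈) h))
      (λ h → from (rel s s∈ s∉ x x∈) (from (rel′ s s∈ s∉ _ (mapTuple-∈ (proj₁ fi) x∈)) h)))) ,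
    λ s s∈ x x∈ → trans (cong g (fun s s∈ x x∈))
      (trans (fun′ s s∈ _ (mapTuple-∈ (proj₁ fi) x∈)) (cong (interp P s ′_) (mapTuple-∘ f g _ x)))

  Iso-inverse : ∀ {f M N} → Iso f M N → Iso (inverse f (univ M)) N M
  Iso-inverse {f} {M} {N} (SM , SN , b@(fi , fs) , rel , fun) =
    SN , SM , inverse-bijective b ,
    (λ s s∈ s∉ y y∈ → mk⇔
      (λ h → from (rel s s∈ s∉ _ (back y∈)) (subst (_∈ interp N s) (sym (fg y∈)) h))
      (λ h → subst (_∈ interp N s) (fg y∈) (to (rel s s∈ s∉ _ (back y∈)) h))) ,
    λ s s∈ y y∈ → trans (cong g (trans (cong (interp N s ′_) (sym (fg y∈)))
                                       (sym (fun s s∈ _ (back y∈)))))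
                        (inverse-β fi (function-closed SM s∈ (back y∈)))
    where
    g = inverse f (univ M)
    back : ∀ {n y} → y ∈ univ N ^ₛ n → mapTuple g n y ∈ univ M ^ₛ n
    back = mapTuple-∈ (proj₁ (proj₁ (inverse-bijective b)))
    fg : ∀ {n y} → y ∈ univ N ^ₛ n → mapTuple f n (mapTuple g n y) ≡ y
    fg {n} {y} y∈ = trans (mapTuple-∘ g f n y)
      (mapTuple-id (λ z z∈ → proj₂ (inverse-spec f (fs z z∈))) y∈)

  -- A bijection determines the structure that it carries over. Equalities between models are proved
  -- by exhibiting both as images of one model under one map.
  Iso-unique : ∀ {f M N N′} → Iso f M N → Iso f M N′ → N ≡ N′
  Iso-unique {f} {M} {N} {N′} i j = ⊆ₘ-antisym (half i j) (half j i)
    where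
    half : ∀ {N N′} → Iso f M N → Iso f M N′ → N ⊆ₘ N′
    half {N} {N′} i@(SM , SN , (fi , fs) , rel , fun) (_ , SN′ , (fi′ , fs′) , rel′ , fun′) =
      SN , SN′ , sub , (λ s s∈ s∉ y y∈ → mk⇔
        (λ h → subst (_∈ interp N′ s) (fg y∈) (to (rel′ s s∈ s∉ _ (back y∈))
          (from (rel s s∈ s∉ _ (back y∈)) (subst (_∈ interp N s) (sym (fg y∈)) h))))
        (λ h → subst (_∈ interp N s) (fg y∈) (to (rel s s∈ s∉ _ (back y∈))
          (from (rel′ s s∈ s∉ _ (back y∈)) (subst (_∈ interp N′ s) (sym (fg y∈)) h))))) ,
      λ s s∈ y y∈ → trans (cong (interp N s ′_) (sym (fg y∈))) (trans (sym (fun s s∈ _ (back y∈)))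
        (trans (fun′ s s∈ _ (back y∈)) (cong (interp N′ s ′_) (fg y∈))))
      where
      sub : univ N ⊆ univ N′
      sub z z∈ = let (w , w∈ , e) = fs z z∈ in subst (_∈ univ N′) e (proj₁ fi′ w w∈)
      g = inverse f (univ M)
      back : ∀ {n y} → y ∈ univ N ^ₛ n → mapTuple g n y ∈ univ M ^ₛ n
      back = mapTuple-∈ λ z z∈ → proj₁ (inverse-spec f (fs z z∈))
      fg : ∀ {n y} → y ∈ univ N ^ₛ n → mapTuple f n (mapTuple g n y) ≡ y
      fg {n} {y} y∈ = trans (mapTuple-∘ g f n y)
        (mapTuple-id (λ z z∈ → proj₂ (inverse-spec f (fs z z∈))) y∈)

  InjectiveOn : (V → V) → V → Set ℓ
  InjectiveOn f a = ∀ z z′ → z ∈ a → z′ ∈ a → f z ≡ f z′ → z ≡ z′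

  transferInterp : (V → V) → V → V → V
  transferInterp f M s with em {s ∈ Fun}
  ... | yes _ = lam (image f (univ M) ^ₛ arity s)
                    (λ y → f (interp M s ′ mapTuple (inverse f (univ M)) (arity s) y))
  ... | no _  = sep (image f (univ M) ^ₛ arity s)
                    (λ y → mapTuple (inverse f (univ M)) (arity s) y ∈ interp M s)

  abstract
    transfer : (V → V) → V → V
    transfer f M = ⟨ image f (univ M) , lam Sym (transferInterp f M) ⟩

    univ-transfer : ∀ {f M} → univ (transfer f M) ≡ image f (univ M)
    univ-transfer = univ-⟨⟩

    transfer-Iso : ∀ {f M} → Structure M → InjectiveOn f (univ M) → Iso f M (transfer f M)
    transfer-Iso {f} {M} SM@(_ , _ , relM , funM) inj = SM , structure-⟨⟩ I Irel Ifun ,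
      subst (Bijective f (univ M)) (sym univ-⟨⟩) (proj₂ (image-≈ fi)) ,
      (λ s s∈ s∉ x x∈ → subst (λ J → x ∈ interp M s ⇔ mapTuple f (arity s) x ∈ J)
        (sym (interp-⟨⟩ I s∈)) (rel s s∈ s∉ x x∈)) ,
      λ s s∈ x x∈ → subst (λ J → f (interp M s ′ x) ≡ J ′ mapTuple f (arity s) x)
        (sym (interp-⟨⟩ I (Fun⊆Sym s s∈))) (fun s s∈ x x∈)
      where
      A : V
      A = image f (univ M)
      I g : V → V
      I = transferInterp f M
      g = inverse f (univ M)
      fi : Injective f (univ M) A
      fi = (λ _ → ∈-image f) , inj
      g∈ : ∀ z → z ∈ A → g z ∈ univ M
      g∈ z z∈ = proj₁ (inverse-spec f (image⁻ f z∈))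
      gf : ∀ {n x} → x ∈ univ M ^ₛ n → mapTuple g n (mapTuple f n x) ≡ x
      gf {n} {x} x∈ = trans (mapTuple-∘ f g n x) (mapTuple-id (λ z z∈ → inverse-β fi z∈) x∈)
      Irel : ∀ s → s ∈ Sym → ¬ s ∈ Fun → I s ⊆ A ^ₛ arity s
      Irel s s∈ s∉ with em {s ∈ Fun}
      ... | yes p = ⊥-elim (s∉ p)
      ... | no _  = λ y y∈ → proj₁ (sep⁻ _ y∈)
      Ifun : ∀ s → s ∈ Fun →
             FunctionOn (I s) (A ^ₛ arity s) × (∀ x → x ∈ A ^ₛ arity s → I s ′ x ∈ A)
      Ifun s s∈ with em {s ∈ Fun}
      ... | no ¬p = ⊥-elim (¬p s∈)
      ... | yes p = lam-function _ , λ y y∈ → subst (_∈ A)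
        (sym (lam-β (λ y → f (interp M s ′ mapTuple g (arity s) y)) y∈))
        (∈-image f (function-closed SM s∈ (mapTuple-∈ g∈ y∈)))
      rel : ∀ s → s ∈ Sym → ¬ s ∈ Fun → ∀ x → x ∈ tuples M s →
            x ∈ interp M s ⇔ mapTuple f (arity s) x ∈ I s
      rel s s∈ s∉ x x∈ with em {s ∈ Fun}
      ... | yes p = ⊥-elim (s∉ p)
      ... | no _  = mk⇔
        (λ h → ∈-sep _ (mapTuple-∈ (λ _ → ∈-image f) x∈) (subst (_∈ interp M s) (sym (gf x∈)) h))
        (λ h → subst (_∈ interp M s) (gf x∈) (proj₂ (sep⁻ _ h)))
      fun : ∀ s → s ∈ Fun → ∀ x → x ∈ tuples M s → f (interp M s ′ x) ≡ I s ′ mapTuple f (arity s) x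
      fun s s∈ x x∈ with em {s ∈ Fun}
      ... | no ¬p = ⊥-elim (¬p s∈)
      ... | yes p = trans (cong (λ y → f (interp M s ′ y)) (sym (gf x∈)))
        (sym (lam-β (λ y → f (interp M s ′ mapTuple g (arity s) y)) (mapTuple-∈ (λ _ → ∈-image f) x∈)))

  transfer-back : ∀ {e β N} → Structure N → Bijective e β (univ N) →
                  let g = inverse e β ; A = transfer g N in univ A ≡ β × Iso g N A × Iso e A N
  transfer-back {e} {β} {N} SN b = u , i , Iso-cong (λ z z∈ → let z∈β = subst (z ∈_) u z∈ in
      trans (cong (inverse g (univ N)) (sym (inverse-β (proj₁ b) z∈β)))
        (inverse-β (proj₁ b⁻¹) (proj₁ (proj₁ b) z z∈β))) (Iso-inverse i)
    where
    g : V → V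
    g = inverse e β
    b⁻¹ : Bijective g (univ N) β
    b⁻¹ = inverse-bijective b
    u : univ (transfer g N) ≡ β
    u = trans univ-transfer (image-bijective b⁻¹)
    i : Iso g N (transfer g N)
    i = transfer-Iso SN (proj₂ (proj₁ b⁻¹))

-- Submodels, restriction of isomorphisms and renaming in the class.

module AECLemmas {ℓ : Level} (𝒵 : ZFC ℓ) (τ : SetTheory.Vocabulary 𝒵) (𝔨 : SetTheory.AEC 𝒵 τ) where
  open SetTheoryLemmas 𝒵
  open AEC 𝔨
  open StructureLemmas 𝒵 τ

  ≼⇒univ⊆ : ∀ {M N} → M ≼ N → univ M ⊆ univ N
  ≼⇒univ⊆ h = proj₁ (proj₂ (proj₂ (≼-⊆ₘ _ _ h)))

  -- The form in which coherence is applied: inside a common extension only universes have to be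
  -- compared.
  ≼-within : ∀ {M N P} → M ≼ P → N ≼ P → univ M ⊆ univ N → M ≼ N
  ≼-within h k sub = coherence _ _ _ (⊆ₘ-within (≼-⊆ₘ _ _ h) (≼-⊆ₘ _ _ k) sub) h k

  ≼-restrict : ∀ {f M M′ N} → M′ ≼ M → Iso f M N → transfer f M′ ≼ N × Iso f M′ (transfer f M′)
  ≼-restrict {f} {M} {M′} {N} h i@(_ , _ , ((_ , inj) , _) , _) = ≼-iso f M M′ N _ i j h , j
    where
    j : Iso f M′ (transfer f M′)
    j = transfer-Iso (K-structure M′ (proj₁ (≼-K _ _ h)))
          λ z z′ z∈ z′∈ → inj z z′ (≼⇒univ⊆ h z z∈) (≼⇒univ⊆ h z′ z′∈)

  univ-Iso : ∀ {f M N} → Iso f M N → univ N ≡ image f (univ M)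
  univ-Iso (_ , _ , b , _) = sym (image-bijective b)

  abstract
    -- Elements outside j[A] are renamed to pairs ⟨ A , q ⟩, which foundation keeps out of A.
    rename : ∀ {N A j} → K N → (∀ x → x ∈ A → j x ∈ univ N) → InjectiveOn j A →
             ∃ λ k → ∃ λ N′ → Iso k N N′ × (∀ x → x ∈ A → k (j x) ≡ x)
    rename {N} {A} {j} KN j∈ inj = k , transfer k N , transfer-Iso (K-structure N KN) k-inj , kj
      where
      branch : ∀ q → Dec (q ∈ image j A) → V
      branch q (yes _) = inverse j A q
      branch q (no _)  = ⟨ A , q ⟩
      k : V → V
      k q = branch q em
      kj′ : ∀ {x} → x ∈ A → ∀ d → branch (j x) d ≡ x
      kj′ x∈ (yes _) = inverse-β {y = univ N} (j∈ , inj) x∈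
      kj′ x∈ (no ¬p) = ⊥-elim (¬p (∈-image j x∈))
      kj : ∀ x → x ∈ A → k (j x) ≡ x
      kj x x∈ = kj′ x∈ em
      inv : ∀ {q} → q ∈ image j A → inverse j A q ∈ A × j (inverse j A q) ≡ q
      inv p = inverse-spec j (image⁻ j p)
      k-inj′ : ∀ q q′ d d′ → branch q d ≡ branch q′ d′ → q ≡ q′
      k-inj′ q q′ (yes p) (yes p′) e =
        trans (sym (proj₂ (inv p))) (trans (cong j e) (proj₂ (inv p′)))
      k-inj′ q q′ (yes p) (no _)  e = ⊥-elim (⟨⟩∉ (subst (_∈ A) e (proj₁ (inv p))))
      k-inj′ q q′ (no _)  (yes p) e = ⊥-elim (⟨⟩∉ (subst (_∈ A) (sym e) (proj₁ (inv p))))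
      k-inj′ q q′ (no _)  (no _)  e = proj₂ (⟨⟩-injective e)
      k-inj : InjectiveOn k (univ N)
      k-inj q q′ _ _ = k-inj′ q q′ em em

-- Sublists of finite lists.

module Sublists {a} {A : Set a} where

  properSublists : List A → List (List A)
  properSublists []      = []
  properSublists (x ∷ p) = p ∷ (properSublists p ++ map (x ∷_) (properSublists p))

  ⊑⁻ : ∀ {p q} → p ⊑ q → p ≡ q ⊎ p ∈ˡ properSublists q
  ⊑⁻ [] = inj₁ refl
  ⊑⁻ (refl ∷ h) with ⊑⁻ h
  ... | inj₁ refl = inj₁ refl
  ... | inj₂ m    = inj₂ (there (∈-++⁺ʳ _ (∈-map⁺ _ m)))
  ⊑⁻ (_ ∷ʳ h) with ⊑⁻ h
  ... | inj₁ refl = inj₂ (here refl)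
  ... | inj₂ m    = inj₂ (there (∈-++⁺ˡ m))

  properSublists-All : ∀ {ℓ} {P : A → Set ℓ} {p} → All P p → All (All P) (properSublists p)
  properSublists-All []       = []
  properSublists-All (x ∷ px) = px ∷ ++⁺ (properSublists-All px)
    (map⁺ (All.map (x ∷_) (properSublists-All px)))

  properSublists-shorter : ∀ p {n} → length p ≤ n → All (λ q → suc (length q) ≤ n) (properSublists p)
  properSublists-shorter [] _ = []
  properSublists-shorter (_ ∷ p) {suc n} (s≤s h) = s≤s h ∷
    ++⁺ (All.map m≤n⇒m≤1+n (properSublists-shorter p h)) (map⁺ (All.map s≤s (properSublists-shorter p h)))

-- Unions of directed systems from unions of chains.

module DirectedUnions {ℓ : Level} (𝒵 : ZFC ℓ) (τ : SetTheory.Vocabulary 𝒵)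
                      (𝔨 : SetTheory.AEC 𝒵 τ) where
  open SetTheoryLemmas 𝒵
  open AEC 𝔨
  open StructureLemmas 𝒵 τ
  open AECLemmas 𝒵 τ 𝔨
  open Sublists

  -- The conclusions of `chain-upper` and `chain-least`, for an arbitrary family.
  HasUnion : (V → V) → V → Set ℓ
  HasUnion M J = K (⋃ₘ M J) × (∀ s → s ∈ J → M s ≼ ⋃ₘ M J)
               × (∀ N → (∀ s → s ∈ J → M s ≼ N) → ⋃ₘ M J ≼ N)

  interp-mono : ∀ {M N s} → M ≼ N → s ∈ Sym → interp M s ⊆ interp N s
  interp-mono h = interp-⊆ (≼-⊆ₘ _ _ h)

  univ-⋃ₘ : ∀ M J → univ (⋃ₘ M J) ≡ ⋃ (image (λ α → univ (M α)) J)
  univ-⋃ₘ M J = univ-⟨⟩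

  interp-⋃ₘ : ∀ M J {s} → s ∈ Sym → interp (⋃ₘ M J) s ≡ ⋃ (image (λ α → interp (M α) s) J)
  interp-⋃ₘ M J s∈ = interp-⟨⟩ (λ s → ⋃ (image (λ α → interp (M α) s) J)) s∈

  ⋃ₘ-cong : ∀ {M M′ J J′} →
            ⋃ (image (λ α → univ (M α)) J) ≡ ⋃ (image (λ α → univ (M′ α)) J′) →
            (∀ s → s ∈ Sym → ⋃ (image (λ α → interp (M α) s) J) ≡ ⋃ (image (λ α → interp (M′ α) s) J′)) →
            ⋃ₘ M J ≡ ⋃ₘ M′ J′
  ⋃ₘ-cong e h = cong₂ ⟨_,_⟩ e (lam-cong h)

  ⋃image-⊆ : ∀ (f g : V → V) {J J′} → (∀ s → s ∈ J → ∃ λ t → t ∈ J′ × f s ⊆ g t) →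
             ⋃ (image f J) ⊆ ⋃ (image g J′)
  ⋃image-⊆ f g h z z∈ = let (s , s∈ , z∈s) = ⋃image⁻ f z∈ ; (t , t∈ , sub) = h s s∈ in
    ∈-⋃image g t∈ (sub z z∈s)

  Dominates : (V → V) → V → V → Set ℓ
  Dominates M J′ J = ∀ s → s ∈ J → ∃ λ t → t ∈ J′ × M s ≼ M t

  ⋃ₘ-cofinal : ∀ {M J J′} → Dominates M J′ J → Dominates M J J′ → ⋃ₘ M J ≡ ⋃ₘ M J′
  ⋃ₘ-cofinal {M} {J} {J′} d d′ = ⋃ₘ-cong {M} {M} {J} {J′} (ext (u d) (u d′)) λ s s∈ → ext (i d s∈) (i d′ s∈)
    where
    u : ∀ {J J′} → Dominates M J′ J → ⋃ (image (univ ∘ M) J) ⊆ ⋃ (image (univ ∘ M) J′)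
    u d = ⋃image-⊆ _ _ λ s s∈ → let (t , t∈ , h) = d s s∈ in t , t∈ , ≼⇒univ⊆ h
    i : ∀ {J J′ s} → Dominates M J′ J → s ∈ Sym →
        ⋃ (image (λ α → interp (M α) s) J) ⊆ ⋃ (image (λ α → interp (M α) s) J′)
    i d s∈ = ⋃image-⊆ _ _ λ t t∈ → let (t′ , t′∈ , h) = d t t∈ in t′ , t′∈ , interp-mono h s∈

  HasUnion-cofinal : ∀ {M J J′} → Dominates M J′ J → Dominates M J J′ → HasUnion M J′ → HasUnion M J
  HasUnion-cofinal {M} {J} {J′} d d′ (KU , upper , lst) =
    subst K (sym e) KU ,
    (λ s s∈ → let (t , t∈ , h) = d s s∈ in subst (M s ≼_) (sym e) (≼-trans _ _ _ h (upper t t∈))) ,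
    λ N h → subst (_≼ N) (sym e) (lst N λ t t∈ → let (s , s∈ , k) = d′ t t∈ in
      ≼-trans _ _ _ k (h s s∈))
    where
    e : ⋃ₘ M J ≡ ⋃ₘ M J′
    e = ⋃ₘ-cofinal d d′

  HasUnion-top : ∀ {M J t} → t ∈ J → (∀ s → s ∈ J → M s ≼ M t) → HasUnion M J
  HasUnion-top {M} {J} {t} t∈ h =
    subst K (sym e) Kt , (λ s s∈ → subst (M s ≼_) (sym e) (h s s∈)) ,
    λ N k → subst (_≼ N) (sym e) (k t t∈)
    where
    Kt : K (M t)
    Kt = proj₁ (≼-K _ _ (h t t∈))
    e : ⋃ₘ M J ≡ M t
    e = let (eq , F , _) = K-structure (M t) Kt in
      trans (cong₂ ⟨_,_⟩
        (ext (λ z z∈ → let (s , s∈ , z∈s) = ⋃image⁻ (univ ∘ M) z∈ in ≼⇒univ⊆ (h s s∈) z z∈s)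
             (λ z z∈ → ∈-⋃image (univ ∘ M) t∈ z∈))
        (function-ext (lam-function _) F λ s s∈ → trans (lam-β _ s∈)
          (ext (λ z z∈ → let (r , r∈ , z∈r) = ⋃image⁻ (λ α → interp (M α) s) z∈ in
                  interp-mono (h r r∈) s∈ z z∈r)
               (λ z z∈ → ∈-⋃image (λ α → interp (M α) s) t∈ z∈))))
      (sym eq)

  ⋃ₘ-⋃ₘ : ∀ M (J : V → V) {J∞ δ} → (∀ i → i ∈ δ → J i ⊆ J∞) →
          (∀ s → s ∈ J∞ → ∃ λ i → i ∈ δ × s ∈ J i) → ⋃ₘ M J∞ ≡ ⋃ₘ (λ i → ⋃ₘ M (J i)) δ
  ⋃ₘ-⋃ₘ M J {J∞} {δ} sub cov = ⋃ₘ-cong {M} {λ i → ⋃ₘ M (J i)} {J∞} {δ}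
    (flatten (univ ∘ M) λ i → univ-⋃ₘ M (J i))
    λ s s∈ → flatten (λ α → interp (M α) s) λ i → interp-⋃ₘ M (J i) s∈
    where
    flatten : ∀ (f : V → V) {g : V → V} → (∀ i → g i ≡ ⋃ (image f (J i))) →
              ⋃ (image f J∞) ≡ ⋃ (image g δ)
    flatten f {g} h = ext
      (λ z z∈ → let (s , s∈ , z∈s) = ⋃image⁻ f z∈ ; (i , i∈ , s∈i) = cov s s∈ in
        ∈-⋃image g i∈ (subst (z ∈_) (sym (h i)) (∈-⋃image f s∈i z∈s)))
      (λ z z∈ → let (i , i∈ , z∈i) = ⋃image⁻ g z∈
                    (s , s∈ , z∈s) = ⋃image⁻ f (subst (z ∈_) (h i) z∈i)
                in ∈-⋃image f (sub i i∈ s s∈) z∈s)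

  -- Upper bounds of finite lists of indices are chosen monotonically in the list.
  -- J β p consists of the bounds of the lists obtained from p by consing
  -- s γ₁, s γ₂, … with β > γ₁ > γ₂ > …  Adding γ to β has, up to cofinality, the
  -- effect of consing s γ to p, and limits are unions of chains; so induction on β
  -- shows that all these families have unions.
  module Directed (M : V → V) (I s₀ : V) (s₀∈ : s₀ ∈ I)
                  (directed : ∀ s t → s ∈ I → t ∈ I → ∃ λ u → u ∈ I × M s ≼ M u × M t ≼ M u) where

    join : V → V → V
    join s t = ε λ u → u ∈ I × M s ≼ M u × M t ≼ M u

    join-spec : ∀ {s t} → s ∈ I → t ∈ I →
                join s t ∈ I × M s ≼ M (join s t) × M t ≼ M (join s t)
    join-spec s∈ t∈ = ε-spec _ (directed _ _ s∈ t∈)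

    ≼-self : ∀ {s} → s ∈ I → M s ≼ M s
    ≼-self s∈ = ≼-refl _ (proj₁ (≼-K _ _ (proj₁ (proj₂ (join-spec s∈ s∈)))))

    joins : List V → V
    joins []      = s₀
    joins (x ∷ p) = join x (joins p)

    joins-∈ : ∀ {p} → All (_∈ I) p → joins p ∈ I
    joins-∈ []       = s₀∈
    joins-∈ (x∈ ∷ h) = proj₁ (join-spec x∈ (joins-∈ h))

    joins-upper : ∀ {p x} → All (_∈ I) p → x ∈ˡ p → M x ≼ M (joins p)
    joins-upper (x∈ ∷ h) (here refl) = proj₁ (proj₂ (join-spec x∈ (joins-∈ h)))
    joins-upper (x∈ ∷ h) (there m)   =
      ≼-trans _ _ _ (joins-upper h m) (proj₂ (proj₂ (join-spec x∈ (joins-∈ h))))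

    -- The number is fuel for a recursion on length. The bounds of all proper sublists are joined in
    -- as well: this is what makes bounds monotone, since `join` and `joins` are mere choices.
    boundAt : ℕ → List V → V
    boundAt zero    p = s₀
    boundAt (suc n) p = joins (p ++ map (boundAt n) (properSublists p))

    boundAt-∈ : ∀ n {p} → All (_∈ I) p → boundAt n p ∈ I
    boundAt-∈ zero    h = s₀∈
    boundAt-∈ (suc n) h = joins-∈ (++⁺ h (map⁺ (All.map (boundAt-∈ n) (properSublists-All h))))

    boundAt-stable : ∀ {n m} p → length p ≤ n → length p ≤ m → boundAt n p ≡ boundAt m p
    boundAt-stable {zero}  {zero}  p h k = refl
    boundAt-stable {zero}  {suc m} [] h k = refl
    boundAt-stable {suc n} {zero}  [] h k = refl
    boundAt-stable {suc n} {suc m} p h k = cong (λ l → joins (p ++ l)) (map-cong-local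
      (All.zipWith (λ (a , b) → boundAt-stable _ (≤-pred a) (≤-pred b))
        (properSublists-shorter p h , properSublists-shorter p k)))

    bound : List V → V
    bound p = boundAt (length p) p

    bound-∈ : ∀ {p} → All (_∈ I) p → bound p ∈ I
    bound-∈ {p} = boundAt-∈ (length p)

    bound-head : ∀ {x p} → All (_∈ I) (x ∷ p) → M x ≼ M (bound (x ∷ p))
    bound-head {x} {p} h =
      joins-upper (++⁺ h (map⁺ (All.map (boundAt-∈ (length p)) (properSublists-All h)))) (here refl)

    bound-mono : ∀ {p q} → All (_∈ I) q → p ⊑ q → M (bound p) ≼ M (bound q)
    bound-mono {p} {q} h sub with ⊑⁻ sub
    ... | inj₁ refl = ≼-self (bound-∈ h)
    ... | inj₂ m    = proper q h m
      where
      proper : ∀ q → All (_∈ I) q → p ∈ˡ properSublists q → M (bound p) ≼ M (bound q)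
      proper (x ∷ q) h m = subst (λ t → M t ≼ M (bound (x ∷ q)))
        (boundAt-stable p (≤-pred (All.lookup (properSublists-shorter (x ∷ q) ≤-refl) m)) ≤-refl)
        (joins-upper (++⁺ h (map⁺ (All.map (boundAt-∈ (length q)) (properSublists-All h))))
          (∈-++⁺ʳ (x ∷ q) (∈-map⁺ (boundAt (length q)) m)))

    module Enumerated (α : V) (Oα : Ordinal α) (s : V → V) (s∈ : ∀ i → i ∈ α → s i ∈ I)
                      (s-onto : Surjective s α I) where

      data Reach (β : V) (p : List V) : V → Set ℓ where
        stop : Reach β p (bound p)
        step : ∀ {γ t} → γ ∈ β → Reach γ (s γ ∷ p) t → Reach β p t

      J : V → List V → V
      J β p = sep I (Reach β p)

      J⁻ : ∀ {β p t} → t ∈ J β p → Reach β p t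
      J⁻ t∈ = proj₂ (sep⁻ _ t∈)

      J-mono : ∀ {β β′ p} → β ⊆ β′ → J β p ⊆ J β′ p
      J-mono {β} {β′} {p} sub t t∈ = let (t∈I , r) = sep⁻ _ t∈ in ∈-sep _ t∈I (widen r)
        where
        widen : ∀ {t} → Reach β p t → Reach β′ p t
        widen stop       = stop
        widen (step γ∈ r) = step (sub _ γ∈) r

      Reach-∈ : ∀ {β p t} → β ⊆ α → All (_∈ I) p → Reach β p t → t ∈ I
      Reach-∈ sub h stop        = bound-∈ h
      Reach-∈ sub h (step γ∈ r) = Reach-∈ (proj₁ Oα _ (sub _ γ∈)) (s∈ _ (sub _ γ∈) ∷ h) r

      -- The same indices are consed onto the longer list, and bounds are monotone in the list.
      Reach-⊑ : ∀ {β p q t} → β ⊆ α → All (_∈ I) q → p ⊑ q → Reach β p t →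
                ∃ λ t′ → Reach β q t′ × M t ≼ M t′
      Reach-⊑ sub h le stop        = _ , stop , bound-mono h le
      Reach-⊑ sub h le (step γ∈ r) =
        let (t′ , r′ , k) = Reach-⊑ (proj₁ Oα _ (sub _ γ∈)) (s∈ _ (sub _ γ∈) ∷ h) (refl ∷ le) r
        in t′ , step γ∈ r′ , k

      Claim : V → Set ℓ
      Claim β = ∀ p → All (_∈ I) p → β ⊆ α → HasUnion M (J β p)

      claim-∅ : Claim ∅
      claim-∅ p h sub = HasUnion-top (∈-sep _ (bound-∈ h) stop) λ t t∈ → only (J⁻ t∈)
        where
        only : ∀ {t} → Reach ∅ p t → M t ≼ M (bound p)
        only stop        = ≼-self (bound-∈ h)
        only (step γ∈ _) = ⊥-elim (∉∅ γ∈)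

      claim-S : ∀ {γ} → Claim γ → Claim (S γ)
      claim-S {γ} ih p h sub = HasUnion-cofinal down up (ih (s γ ∷ p) h′ sub′)
        where
        sub′ : γ ⊆ α
        sub′ z z∈ = sub z (⊆-S z∈)
        h′ : All (_∈ I) (s γ ∷ p)
        h′ = s∈ γ (sub γ ∈-S) ∷ h
        lift-⊑ : ∀ {t} → Reach γ p t → ∃ λ t′ → t′ ∈ J γ (s γ ∷ p) × M t ≼ M t′
        lift-⊑ r = let (t′ , r′ , k) = Reach-⊑ sub′ h′ (_ ∷ʳ ⊆-refl) r in
          t′ , ∈-sep _ (Reach-∈ sub′ h′ r′) r′ , k
        lower-S : ∀ {t} → Reach (S γ) p t → ∃ λ t′ → t′ ∈ J γ (s γ ∷ p) × M t ≼ M t′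
        lower-S stop = lift-⊑ stop
        lower-S (step δ∈ r) with S⁻ δ∈
        ... | inj₁ p    = lift-⊑ (step p r)
        ... | inj₂ refl = let t∈ = Reach-∈ sub′ h′ r in _ , ∈-sep _ t∈ r , ≼-self t∈
        down : Dominates M (J γ (s γ ∷ p)) (J (S γ) p)
        down t t∈ = lower-S (J⁻ t∈)
        up : Dominates M (J (S γ) p) (J γ (s γ ∷ p))
        up t t∈ = let (t∈I , r) = sep⁻ _ t∈ in t , ∈-sep _ t∈I (step ∈-S r) , ≼-self t∈I

      -- Indices are consed in decreasing order, so the first one dominates the rest, and its
      -- successor is still below the limit.
      J-limit : ∀ {δ p t} → Limit δ → t ∈ J δ p → ∃ λ γ → γ ∈ δ × t ∈ J γ p
      J-limit {δ} {p} (_ , ∅∈ , S∈) t∈ = let (t∈I , r) = sep⁻ _ t∈ in go t∈I r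
        where
        go : ∀ {t} → t ∈ I → Reach δ p t → ∃ λ γ → γ ∈ δ × t ∈ J γ p
        go t∈I stop        = ∅ , ∅∈ , ∈-sep _ t∈I stop
        go t∈I (step γ∈ r) = _ , S∈ _ γ∈ , ∈-sep _ t∈I (step ∈-S r)

      claim-limit : ∀ {δ} → Limit δ → (∀ γ → γ ∈ δ → Claim γ) → Claim δ
      claim-limit {δ} L@(Oδ , _) ih p h sub =
        subst K (sym e) (proj₁ up) ,
        (λ t t∈ → let (γ , γ∈ , t∈γ) = J-limit L t∈ in
          subst (M t ≼_) (sym e) (≼-trans _ _ _ (proj₁ (proj₂ (at γ∈)) t t∈γ) (proj₂ up γ γ∈))) ,
        λ N k → subst (_≼ N) (sym e) (chain-least C δ N L chain λ γ γ∈ →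
          proj₂ (proj₂ (at γ∈)) N λ t t∈ → k t (J-mono (proj₁ Oδ γ γ∈) t t∈))
        where
        C : V → V
        C γ = ⋃ₘ M (J γ p)
        at : ∀ {γ} → γ ∈ δ → HasUnion M (J γ p)
        at {γ} γ∈ = ih γ γ∈ p h λ z z∈ → sub z (proj₁ Oδ γ γ∈ z z∈)
        unions : ∀ {γ} → Limit γ → ⋃ₘ M (J γ p) ≡ ⋃ₘ C γ
        unions {γ} L′@(Oγ , _) = ⋃ₘ-⋃ₘ M (λ i → J i p) (λ i i∈ → J-mono (proj₁ Oγ i i∈))
          (λ t t∈ → J-limit L′ t∈)
        e : ⋃ₘ M (J δ p) ≡ ⋃ₘ C δ
        e = unions L
        chain : IncreasingContinuous C δ
        chain = (λ γ γ∈ → proj₁ (at γ∈)) ,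
          (λ γ γ′ γ∈ γ′∈ → proj₂ (proj₂ (at (proj₁ Oδ γ γ∈ γ′ γ′∈))) (C γ) λ t t∈ →
            proj₁ (proj₂ (at γ∈)) t (J-mono (proj₁ (ord-∈ Oδ γ∈) γ′ γ′∈) t t∈)) ,
          λ γ γ∈ Lγ → unions Lγ
        up : K (⋃ₘ C δ) × (∀ γ → γ ∈ δ → C γ ≼ ⋃ₘ C δ)
        up = chain-upper C δ L chain

      claim : ∀ β → Ordinal β → Claim β
      claim = ord-ind Claim λ β Oβ ih →
        [ (λ e → subst Claim (sym e) claim-∅)
        , [ (λ (γ , γ∈ , e) → subst Claim (sym e) (claim-S (ih γ γ∈)))
          , (λ L → claim-limit L ih) ]′ ]′ (ord-cases Oβ)

      -- `J α []` is cofinal in `I`: the bound of a one-element list lies above that element.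
      directed-union : HasUnion M I
      directed-union = HasUnion-cofinal
        (λ t t∈ → let (i , i∈ , e) = s-onto t t∈ ; h = s∈ i i∈ ∷ [] in
          bound (s i ∷ []) , ∈-sep _ (bound-∈ h) (step i∈ stop) ,
          subst (λ t → M t ≼ M (bound (s i ∷ []))) e (bound-head h))
        (λ t t∈ → let t∈I = proj₁ (sep⁻ _ t∈) in t , t∈I , ≼-self t∈I)
        (claim α Oα [] [] λ _ → id)

    directed-union : HasUnion M I
    directed-union = let (α , Oα , I≈α) = well-ordered I ; (s , (s∈ , _) , onto) = ≈-sym I≈α in
      Enumerated.directed-union α Oα s s∈ onto

-- Löwenheim-Skolem hulls and small submodels.

module SmallSubmodels {ℓ : Level} (𝒵 : ZFC ℓ) (τ : SetTheory.Vocabulary 𝒵)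
                      (𝔨 : SetTheory.AEC 𝒵 τ) (LST : SetTheory.V 𝒵) (lsb : SetTheory.AEC.LSBound 𝔨 LST) where
  open SetTheoryLemmas 𝒵
  open AEC 𝔨
  open StructureLemmas 𝒵 τ
  open AECLemmas 𝒵 τ 𝔨
  open DirectedUnions 𝒵 τ 𝔨

  arity-⊆LST : ∀ {s} → s ∈ Sym → arity s ⊆ LST
  arity-⊆LST {s} s∈ = proj₁ (proj₁ (proj₁ (proj₁ lsb))) (arity s) (proj₂ (proj₁ lsb) (arity s) (arity∈ω s s∈))

  small-Sym : ∀ {ν} → LST ∈ ν → Small ν Sym
  small-Sym LST∈ = LST , LST∈ , proj₁ (proj₂ lsb)

  small-^ : ∀ {ν B s} → PowerClosed ν → LST ∈ ν → Small ν B → s ∈ Sym → Small ν (B ^ₛ arity s)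
  small-^ PC LST∈ sB s∈ = small-⊆ (λ x x∈ → proj₁ (sep⁻ _ x∈))
    (small-𝒫 PC (small-× PC (small-⊆ (arity-⊆LST s∈) (small-∈ LST∈)) sB))

  -- The Löwenheim-Skolem property is stated for cardinals that include `LST`; the larger of
  -- `card x` and `LST` is one, and it is still below `ν`.
  bounding-cardinal : ∀ {ν x} → Cardinal ν → LST ∈ ν → Small ν x →
                      ∃ λ μ → μ ∈ ν × Cardinal μ × LST ⊆ μ × x ≲ μ
  bounding-cardinal {ν} {x} (Oν , _) LST∈ (β , β∈ , x≲β) =
    [ (λ p → LST , LST∈ , CL , (λ _ → id) , ≲-trans x≲ρ (⊆⇒≲ p))
    , (λ p → ρ , ⊆-∈ (proj₁ Cρ) Oν ρ⊆β β∈ , Cρ , proj₁ (proj₁ Cρ) LST p , x≲ρ) ]′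
    (⊆-or-∋ (proj₁ Cρ) (proj₁ CL))
    where
    ρ : V
    ρ = card x
    Cρ : Cardinal ρ
    Cρ = card-cardinal x
    CL : Cardinal LST
    CL = proj₁ (proj₁ lsb)
    x≲ρ : x ≲ ρ
    x≲ρ = ≈⇒≲ (≈-card x)
    ρ⊆β : ρ ⊆ β
    ρ⊆β = ≲⇒⊆ Cρ (ord-∈ Oν β∈) (≲-trans (≈⇒≲ (≈-sym (≈-card x))) x≲β)

  hull : ∀ {ν N x} → Cardinal ν → LST ∈ ν → K N → x ⊆ univ N → Small ν x →
         ∃ λ M → M ≼ N × x ⊆ univ M × Small ν (univ M)
  hull {N = N} C LST∈ KN x⊆ sx =
    let (μ , μ∈ , Cμ , L⊆ , x≲) = bounding-cardinal C LST∈ sx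
        (M , M≼ , x⊆M , M≲)     = proj₂ (proj₂ lsb) μ N _ Cμ L⊆ KN x⊆ x≲
    in M , M≼ , x⊆M , μ , μ∈ , M≲

  -- `N` is the directed union of its small submodels, and such a union lies below every upper
  -- bound. This yields `≼` between large models where only small ones can be compared directly.
  small-submodels-≼ : ∀ {ν N X} → PowerClosed ν → LST ∈ ν → K N →
                      (∀ M → M ≼ N → Small ν (univ M) → M ≼ X) → N ≼ X
  small-submodels-≼ {ν} {N} {X} PC@((C , _) , _) LST∈ KN h = subst (_≼ X) whole≡N
    (proj₂ (proj₂ whole) X λ A A∈ → let (p , _ , s) = chosen A∈ in h _ p s)
    where
    Hull : V → V → Set ℓ
    Hull A M = M ≼ N × univ M ≡ A × Small ν (univ M)
    I : V
    I = sep (𝒫 (univ N)) λ A → ∃ (Hull A)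
    at : V → V
    at A = ε (Hull A)
    chosen : ∀ {A} → A ∈ I → Hull A (at A)
    chosen A∈ = ε-spec _ (proj₂ (sep⁻ _ A∈))
    index : ∀ {M} → M ≼ N → Small ν (univ M) → univ M ∈ I
    index p s = ∈-sep _ (∈-𝒫 (≼⇒univ⊆ p)) (_ , p , refl , s)
    over : ∀ {x} → x ⊆ univ N → Small ν x → ∃ λ A → A ∈ I × x ⊆ A
    over x⊆ sx = let (M , p , sub , s) = hull C LST∈ KN x⊆ sx in univ M , index p s , sub
    at-mono : ∀ {A B} → A ∈ I → B ∈ I → A ⊆ B → at A ≼ at B
    at-mono A∈ B∈ sub = let (p , e , _) = chosen A∈ ; (q , e′ , _) = chosen B∈ in
      ≼-within p q (subst₂ _⊆_ (sym e) (sym e′) sub)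
    small-∈I : ∀ {A} → A ∈ I → Small ν A
    small-∈I A∈ = let (_ , e , s) = chosen A∈ in subst (Small ν) e s
    directed : ∀ A B → A ∈ I → B ∈ I → ∃ λ D → D ∈ I × at A ≼ at D × at B ≼ at D
    directed A B A∈ B∈ =
      let (D , D∈ , sub) = over
            (∪-least (𝒫⁻ (proj₁ (sep⁻ _ A∈))) (𝒫⁻ (proj₁ (sep⁻ _ B∈))))
            (small-∪ PC (small-∈I A∈) (small-∈I B∈))
      in D , D∈ , at-mono A∈ D∈ (λ z z∈ → sub z (∪ˡ z∈)) , at-mono B∈ D∈ (λ z z∈ → sub z (∪ʳ z∈))
    first : ∃ λ A → A ∈ I × ∅ ⊆ A
    first = over (λ z z∈ → ⊥-elim (∉∅ z∈)) (small-⊆ (λ z z∈ → ⊥-elim (∉∅ z∈)) (small-∈ LST∈))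
    whole : HasUnion at I
    whole = Directed.directed-union at I (proj₁ first) (proj₁ (proj₂ first)) directed
    whole≼N : ⋃ₘ at I ≼ N
    whole≼N = proj₂ (proj₂ whole) N λ A A∈ → proj₁ (chosen A∈)
    N⊆whole : univ N ⊆ univ (⋃ₘ at I)
    N⊆whole x x∈ =
      let (A , A∈ , sub) = over (λ z z∈ → subst (_∈ univ N) (sym (single⁻ z∈)) x∈) (small-single PC)
          (_ , e , _)    = chosen A∈
      in subst (x ∈_) (sym (univ-⋃ₘ at I))
           (∈-⋃image (univ ∘ at) A∈ (subst (x ∈_) (sym e) (sub x ∈-single)))
    whole≡N : ⋃ₘ at I ≡ N
    whole≡N = ⊆ₘ-antisym (≼-⊆ₘ _ _ whole≼N)
      (⊆ₘ-within (≼-⊆ₘ _ _ (≼-refl N KN)) (≼-⊆ₘ _ _ whole≼N) N⊆whole)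

-- Reduced products of models in the class.

module Families {ℓ : Level} (𝒵 : ZFC ℓ) (τ : SetTheory.Vocabulary 𝒵) (𝔨 : SetTheory.AEC 𝒵 τ)
                (κ : SetTheory.V 𝒵) (P : SetTheory.V 𝒵 → SetTheory.V 𝒵) where
  open SetTheoryLemmas 𝒵
  open AEC 𝔨

  IsFamily : V → Set ℓ
  IsFamily e = FunctionOn e κ × (∀ α → α ∈ κ → e ′ α ∈ univ (P α))

  Same : V → V → V → Set ℓ
  Same e e′ α = e ′ α ≡ e′ ′ α

  Holds : V → V → V → Set ℓ
  Holds s x α = mapTuple (_′ α) (arity s) x ∈ interp (P α) s

  Value : V → V → V → V → Set ℓ
  Value s x e α = interp (P α) s ′ mapTuple (_′ α) (arity s) x ≡ e ′ α

  -- The values of `B` at `α` make up a submodel in the sense of `≼`; this stands in for closure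
  -- under Skolem functions.
  Traces : V → V → V → Set ℓ
  Traces B α N = N ≼ P α × univ N ≡ image (_′ α) B

  Closed : V → Set ℓ
  Closed B = ∀ α → α ∈ κ → ∃ (Traces B α)

-- A reduced product of models P α, α ∈ κ, that need only contain the classes of a
-- set E of functions.  Only atomic formulas in the members of E have to be decided
-- by the filter, as small submodels are transported as a whole.
module ReducedProduct {ℓ : Level} (𝒵 : ZFC ℓ) (τ : SetTheory.Vocabulary 𝒵)
    (𝔨 : SetTheory.AEC 𝒵 τ) (LST : SetTheory.V 𝒵) (lsb : SetTheory.AEC.LSBound 𝔨 LST)
    {κ : SetTheory.V 𝒵} (inac : SmallSets.Inaccessible 𝒵 κ) (LST∈κ : ZFC._∈_ 𝒵 LST κ)
    (F : LargeCardinals.Filter 𝒵 κ) (P : SetTheory.V 𝒵 → SetTheory.V 𝒵) where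
  open SetTheoryLemmas 𝒵
  open AEC 𝔨
  open StructureLemmas 𝒵 τ
  open AECLemmas 𝒵 τ 𝔨
  open DirectedUnions 𝒵 τ 𝔨
  open SmallSubmodels 𝒵 τ 𝔨 LST lsb
  open Families 𝒵 τ 𝔨 κ P
  open Filter F

  Cκ : Cardinal κ
  Cκ = proj₁ (proj₁ (proj₁ inac))

  Oκ : Ordinal κ
  Oκ = proj₁ Cκ

  Decided : V → Set ℓ
  Decided B = (∀ e e′ → e ∈ B → e′ ∈ B → Decides F (Same e e′))
            × (∀ s x → s ∈ Sym → x ∈ B ^ₛ arity s → Decides F (Holds s x))
            × (∀ s x e → s ∈ Sym → x ∈ B ^ₛ arity s → e ∈ B → Decides F (Value s x e))

  -- Łoś's theorem for atomic formulas about `B`, at an individual index: truth at `α` is truth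
  -- prescribed by the filter.
  Typical : V → V → Set ℓ
  Typical B α = (∀ e → e ∈ B → ∀ e′ → e′ ∈ B → Same e e′ α ⇔ Large (Same e e′))
              × (∀ s → s ∈ Sym → ∀ x → x ∈ B ^ₛ arity s → Holds s x α ⇔ Large (Holds s x))
              × (∀ s → s ∈ Sym → ∀ x → x ∈ B ^ₛ arity s → ∀ e → e ∈ B →
                   Value s x e α ⇔ Large (Value s x e))

  decided⇒agrees : ∀ {Q : V → Set ℓ} → Decides F Q → Large λ α → Q α ⇔ Large Q
  decided⇒agrees (inj₁ p) = mono (λ _ _ q → mk⇔ (λ _ → p) (λ _ → q)) p
  decided⇒agrees (inj₂ p) = mono (λ _ _ ¬q → mk⇔ (λ q → ⊥-elim (¬q q))
    (λ l → let (_ , _ , q , ¬q′) = inhabited (both l p) in ⊥-elim (¬q′ q))) p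

  -- There are fewer than `κ` atomic formulas about `B`, because `LST ∈ κ` bounds the vocabulary and
  -- `κ` is a strong limit; so completeness treats them all at once.
  typical : ∀ {B} → Small κ B → Decided B → Large (Typical B)
  typical {B} sB (same , holds , value) = both
    (complete _ sB λ e e∈ → complete _ sB λ e′ e′∈ → decided⇒agrees (same e e′ e∈ e′∈))
    (both
      (complete _ (small-Sym LST∈κ) λ s s∈ → complete _ (small-^ (proj₁ inac) LST∈κ sB s∈) λ x x∈ → decided⇒agrees (holds s x s∈ x∈))
      (complete _ (small-Sym LST∈κ) λ s s∈ → complete _ (small-^ (proj₁ inac) LST∈κ sB s∈) λ x x∈ → complete _ sB λ e e∈ →
        decided⇒agrees (value s x e s∈ x∈ e∈)))

  lookup : V → V → V → V
  lookup B α = inverse (_′ α) B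

  lookup-spec : ∀ {B α N y} → Traces B α N → y ∈ univ N → lookup B α y ∈ B × lookup B α y ′ α ≡ y
  lookup-spec {B} {α} {N} {y} (_ , eq) y∈ = inverse-spec (_′ α) (image⁻ (_′ α) (subst (y ∈_) eq y∈))

  ∈-trace : ∀ {B α N e} → Traces B α N → e ∈ B → e ′ α ∈ univ N
  ∈-trace {α = α} {e = e} (_ , eq) e∈ = subst (e ′ α ∈_) (sym eq) (∈-image (_′ α) e∈)

  -- Both traces realize the atomic diagram that the filter prescribes for `B`, so sending the value
  -- of a function at `α` to its value at `β` does not depend on the function chosen.
  typical-Iso : ∀ {B α β N N′} → Typical B α → Typical B β → Traces B α N → Traces B β N′ →
                Iso (λ y → lookup B α y ′ β) N N′
  typical-Iso {B} {α} {β} {N} {N′} (sameα , holdsα , valueα) (sameβ , holdsβ , valueβ) T@(N≼ , _) T′@(N′≼ , _) =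
    proj₁ (≼-⊆ₘ _ _ N≼) , proj₁ (≼-⊆ₘ _ _ N′≼) , ((h∈ , h-inj) , h-onto) ,
    (λ s s∈ s∉ x x∈ → mk⇔
      (λ p → from (relN′ s s∈ s∉ _ (mapTuple-∈ h∈ x∈)) (subst (_∈ interp (P β) s) (there≡ x∈)
        (from (holdsβ s s∈ _ (hat∈ x∈)) (to (holdsα s s∈ _ (hat∈ x∈))
          (subst (_∈ interp (P α) s) (sym (here≡ x∈)) (to (relN s s∈ s∉ x x∈) p))))))
      (λ p → from (relN s s∈ s∉ x x∈) (subst (_∈ interp (P α) s) (here≡ x∈)
        (from (holdsα s s∈ _ (hat∈ x∈)) (to (holdsβ s s∈ _ (hat∈ x∈))
          (subst (_∈ interp (P β) s) (sym (there≡ x∈)) (to (relN′ s s∈ s∉ _ (mapTuple-∈ h∈ x∈)) p))))))) ,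
    λ s s∈ x x∈ →
      let y   = interp N s ′ x
          (e∈ , eq) = lookup-spec T (function-closed (proj₁ (≼-⊆ₘ _ _ N≼)) s∈ x∈)
          valα : Value s (hat (arity s) x) (lookup B α y) α
          valα = trans (cong (interp (P α) s ′_) (here≡ x∈)) (trans (sym (funN s s∈ x x∈)) (sym eq))
          s∈′ = Fun⊆Sym s s∈
          valβ = from (valueβ s s∈′ _ (hat∈ x∈) _ e∈) (to (valueα s s∈′ _ (hat∈ x∈) _ e∈) valα)
      in trans (sym valβ) (trans (cong (interp (P β) s ′_) (there≡ x∈))
           (sym (funN′ s s∈ _ (mapTuple-∈ h∈ x∈))))
    where
    h : V → V
    h y = lookup B α y ′ β
    relN = proj₁ (proj₂ (proj₂ (proj₂ (≼-⊆ₘ _ _ N≼))))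
    funN = proj₂ (proj₂ (proj₂ (proj₂ (≼-⊆ₘ _ _ N≼))))
    relN′ = proj₁ (proj₂ (proj₂ (proj₂ (≼-⊆ₘ _ _ N′≼))))
    funN′ = proj₂ (proj₂ (proj₂ (proj₂ (≼-⊆ₘ _ _ N′≼))))
    hat : V → V → V
    hat = mapTuple (lookup B α)
    hat∈ : ∀ {n x} → x ∈ univ N ^ₛ n → hat n x ∈ B ^ₛ n
    hat∈ = mapTuple-∈ λ y y∈ → proj₁ (lookup-spec T y∈)
    here≡ : ∀ {n x} → x ∈ univ N ^ₛ n → mapTuple (_′ α) n (hat n x) ≡ x
    here≡ {n} {x} x∈ = trans (mapTuple-∘ (lookup B α) (_′ α) n x)
      (mapTuple-id (λ y y∈ → proj₂ (lookup-spec T y∈)) x∈)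
    there≡ : ∀ {n x} → x ∈ univ N ^ₛ n → mapTuple (_′ β) n (hat n x) ≡ mapTuple h n x
    there≡ {n} {x} x∈ = mapTuple-∘ (lookup B α) (_′ β) n x
    h∈ : ∀ y → y ∈ univ N → h y ∈ univ N′
    h∈ y y∈ = ∈-trace T′ (proj₁ (lookup-spec T y∈))
    α⇒β : ∀ {e e′} → e ∈ B → e′ ∈ B → Same e e′ α → Same e e′ β
    α⇒β e∈ e′∈ p = from (sameβ _ e∈ _ e′∈) (to (sameα _ e∈ _ e′∈) p)
    h-inj : InjectiveOn h (univ N)
    h-inj y y′ y∈ y′∈ eq = let (p , q) = lookup-spec T y∈ ; (p′ , q′) = lookup-spec T y′∈ in
      trans (sym q) (trans (from (sameα _ p _ p′) (to (sameβ _ p _ p′) eq)) q′)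
    h-onto : Surjective h (univ N) (univ N′)
    h-onto w w∈ =
      let (e∈ , eq) = lookup-spec T′ w∈
          y∈        = ∈-trace T e∈
          (p , q)   = lookup-spec T y∈
      in lookup B β w ′ α , y∈ , trans (α⇒β p e∈ q) eq

  module Classes (E : V)
      (cofinal : ∀ B → B ⊆ E → Small κ B →
                 ∃ λ B′ → B′ ⊆ E × Small κ B′ × B ⊆ B′ × Closed B′ × Decided B′) where

    classOf : V → V
    classOf e = sep E λ e′ → Large (Same e e′)

    -- Equal classes arise from predicates that are equivalent, not equal. Forming the class as a
    -- set lets extensionality make the choices agree.
    rep : V → V
    rep e = ε λ e′ → e′ ∈ classOf e

    Large-refl : ∀ {e} → Large (Same e e)
    Large-refl = mono (λ _ _ _ → refl) (final (∅∈-infinite (proj₁ (proj₁ inac))))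

    Large-sym : ∀ {e e′} → Large (Same e e′) → Large (Same e′ e)
    Large-sym = mono λ _ _ → sym

    Large-trans : ∀ {e e′ e″} → Large (Same e e′) → Large (Same e′ e″) → Large (Same e e″)
    Large-trans p q = mono (λ _ _ (a , b) → trans a b) (both p q)

    rep-spec : ∀ {e} → e ∈ E → rep e ∈ E × Large (Same e (rep e))
    rep-spec {e} e∈ = sep⁻ _ (ε-spec (_∈ classOf e) (e , ∈-sep _ e∈ Large-refl))

    rep-cong : ∀ {e e′} → Large (Same e e′) → rep e ≡ rep e′
    rep-cong {e} {e′} h = cong (λ c → ε (_∈ c)) (ext
      (λ z z∈ → let (p , q) = sep⁻ _ z∈ in ∈-sep _ p (Large-trans (Large-sym h) q))
      (λ z z∈ → let (p , q) = sep⁻ _ z∈ in ∈-sep _ p (Large-trans h q)))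

    rep-reflects : ∀ {e e′} → e ∈ E → e′ ∈ E → rep e ≡ rep e′ → Large (Same e e′)
    rep-reflects {e} {e′} e∈ e′∈ eq = Large-trans (proj₂ (rep-spec e∈))
      (subst (λ r → Large (Same r e′)) (sym eq) (Large-sym (proj₂ (rep-spec e′∈))))

    Q : V
    Q = image rep E

    Q⊆E : Q ⊆ E
    Q⊆E = image-elim (_∈ E) λ e e∈ → proj₁ (rep-spec e∈)

    rep-Q : ∀ {q} → q ∈ Q → rep q ≡ q
    rep-Q = image-elim (λ q → rep q ≡ q) (λ e e∈ → sym (rep-cong (proj₂ (rep-spec e∈)))) _

    -- A small piece of the future product, living on representatives: for almost all `α` evaluation
    -- embeds it into `P α`.
    Good : V → V → Set ℓ
    Good A G = K G × univ G ≡ A × A ⊆ Q × Small κ A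
             × Large (λ α → ∃ λ N → N ≼ P α × Iso (_′ α) G N)

    -- Both structures are compared at one common `α`, inside `P α`, where coherence applies; the
    -- comparison is pulled back along evaluation.
    good-≼ : ∀ {A A′ G G′} → Good A G → Good A′ G′ → A ⊆ A′ → G ≼ G′
    good-≼ {A} {A′} {G} {G′} (_ , refl , _ , _ , l) (_ , refl , _ , _ , l′) sub =
      let (α , _ , (N , N≼ , i) , (N′ , N′≼ , i′)) = inhabited (both l l′)
          (_ , _ , ((_ , inj′) , _) , _) = i′
          ι : Injective (_′ α) (univ G′) (image (_′ α) (univ G′))
          ι = (λ _ → ∈-image (_′ α)) , inj′
          ιG : Injective (_′ α) (univ G) (image (_′ α) (univ G′))
          ιG = (λ z z∈ → ∈-image (_′ α) (sub z z∈)) , λ z z′ z∈ z′∈ → inj′ z z′ (sub z z∈) (sub z′ z′∈)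
          N⊆ : univ N ⊆ univ N′
          N⊆ z z∈ = subst (z ∈_) (sym (univ-Iso i′)) (image-elim (_∈ image (_′ α) (univ G′))
            (λ w w∈ → ∈-image (_′ α) (sub w w∈)) z (subst (z ∈_) (univ-Iso i) z∈))
          agree : ∀ z → z ∈ univ N → inverse (_′ α) (univ G) z ≡ inverse (_′ α) (univ G′) z
          agree z z∈ = image-elim (λ z → inverse (_′ α) (univ G) z ≡ inverse (_′ α) (univ G′) z)
            (λ w w∈ → trans (inverse-β ιG w∈) (sym (inverse-β ι (sub w w∈)))) z
            (subst (z ∈_) (univ-Iso i) z∈)
      in ≼-iso _ N′ N G′ G (Iso-inverse i′) (Iso-cong agree (Iso-inverse i)) (≼-within N≼ N′≼ N⊆)

    module Copy {B α N : V} (B⊆ : B ⊆ E) (sB : Small κ B) (closed : Closed B) (decided : Decided B)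
                (typα : Typical B α) (T : Traces B α N) where

      f : V → V
      f y = rep (lookup B α y)

      f-inj : InjectiveOn f (univ N)
      f-inj y y′ y∈ y′∈ eq =
        let (p , q) = lookup-spec T y∈ ; (p′ , q′) = lookup-spec T y′∈ in
        trans (sym q) (trans (from (proj₁ typα _ p _ p′) (rep-reflects (B⊆ _ p) (B⊆ _ p′) eq)) q′)

      iso : Iso f N (transfer f N)
      iso = transfer-Iso (proj₁ (≼-⊆ₘ _ _ (proj₁ T))) f-inj

      f-value : ∀ {e} → e ∈ B → f (e ′ α) ≡ rep e
      f-value e∈ = let (p , q) = lookup-spec T (∈-trace T e∈) in
        rep-cong (to (proj₁ typα _ p _ e∈) q)

      univ-copy : univ (transfer f N) ≡ image rep B
      univ-copy = trans (univ-Iso iso) (ext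
        (image-elim (_∈ image rep B) λ y y∈ → ∈-image rep (proj₁ (lookup-spec T y∈)))
        (image-elim (_∈ image f (univ N)) λ e e∈ →
          subst (_∈ image f (univ N)) (f-value e∈) (∈-image f (∈-trace T e∈))))

      values : ∀ {β q} → (∀ e → e ∈ B → Same e (rep e) β) → q ∈ univ (transfer f N) →
               lookup B α (inverse f (univ N) q) ′ β ≡ q ′ β
      values {β} {q} same q∈ =
        let (p , eq) = inverse-spec f (image⁻ f (subst (q ∈_) (univ-Iso iso) q∈))
        in trans (same _ (proj₁ (lookup-spec T p))) (cong (_′ β) eq)

      -- The copy is made from the trace at one typical `α`. Evaluating it at another typical `β`,
      -- where representatives agree with the members of `B`, amounts to `typical-Iso` from `α` to
      -- `β`.
      copies : Large λ β → ∃ λ N′ → N′ ≼ P β × Iso (_′ β) (transfer f N) N′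
      copies = mono
        (λ β β∈ (typβ , same) → let (N′ , T′) = closed β β∈ in
          N′ , proj₁ T′ , Iso-cong (λ q → values same) (Iso-∘ (Iso-inverse iso) (typical-Iso typα typβ T T′)))
        (both (typical sB decided) (complete (λ e → Same e (rep e)) sB λ e e∈ → proj₂ (rep-spec (B⊆ e e∈))))

      good : Good (image rep B) (transfer f N)
      good = K-iso f N _ iso (proj₁ (≼-K _ _ (proj₁ T))) , univ-copy ,
        image-elim (_∈ Q) (λ e e∈ → ∈-image rep (B⊆ e e∈)) ,
        small-image rep sB , copies

    good-closed : ∀ {B} → B ⊆ E → Small κ B → Closed B → Decided B → ∃ λ G → Good (image rep B) G
    good-closed B⊆ sB closed decided =
      let (α , α∈ , typα) = inhabited (typical sB decided)
          (N , T)         = closed α α∈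
      in _ , Copy.good B⊆ sB closed decided typα T

    I : V
    I = sep (𝒫 Q) λ A → ∃ (Good A)

    at : V → V
    at A = ε (Good A)

    at-good : ∀ {A} → A ∈ I → Good A (at A)
    at-good A∈ = ε-spec _ (proj₂ (sep⁻ _ A∈))

    index : ∀ {A G} → Good A G → A ∈ I
    index g@(_ , _ , A⊆ , _) = ∈-sep _ (∈-𝒫 A⊆) (_ , g)

    over : ∀ {A} → A ⊆ Q → Small κ A → ∃ λ D → D ∈ I × A ⊆ D
    over {A} A⊆ sA =
      let (B , B⊆ , sB , A⊆B , closed , decided) = cofinal A (λ z z∈ → Q⊆E z (A⊆ z z∈)) sA
      in image rep B , index (proj₂ (good-closed B⊆ sB closed decided)) ,
         λ z z∈ → subst (_∈ image rep B) (rep-Q (A⊆ z z∈)) (∈-image rep (A⊆B z z∈))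

    product-union : HasUnion at I
    product-union = Directed.directed-union at I (proj₁ first) (proj₁ (proj₂ first)) directed
      where
      first : ∃ λ D → D ∈ I × ∅ ⊆ D
      first = over (λ z z∈ → ⊥-elim (∉∅ z∈)) (small-⊆ (λ z z∈ → ⊥-elim (∉∅ z∈)) (small-∈ LST∈κ))
      directed : ∀ A B → A ∈ I → B ∈ I → ∃ λ D → D ∈ I × at A ≼ at D × at B ≼ at D
      directed A B A∈ B∈ =
        let gA@(_ , _ , A⊆ , sA , _) = at-good A∈
            gB@(_ , _ , B⊆ , sB , _) = at-good B∈
            (D , D∈ , sub) = over (∪-least A⊆ B⊆) (small-∪ (proj₁ inac) sA sB)
        in D , D∈ , good-≼ gA (at-good D∈) (λ z z∈ → sub z (∪ˡ z∈)) ,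
           good-≼ gB (at-good D∈) (λ z z∈ → sub z (∪ʳ z∈))

    abstract
      product : V
      product = ⋃ₘ at I

      product-K : K product
      product-K = proj₁ product-union

      good-≼-product : ∀ {A G} → Good A G → G ≼ product
      good-≼-product {A} {G} g = ≼-trans G (at A) product (good-≼ g (at-good (index g)) λ _ → id)
        (proj₁ (proj₂ product-union) A (index g))

    -- The exceptional set of indices may depend on the small submodel; an embedding of all of `N`
    -- need not exist at any single `α`.
    Local : V → (V → V) → Set ℓ
    Local N j = (∀ x → x ∈ univ N → j x ∈ E)
              × (∀ M → M ≼ N → Small κ (univ M) →
                 Large λ α → ∃ λ G → G ≼ P α × Iso (λ x → j x ′ α) M G)

    module Embedding {N : V} {j : V → V} (KN : K N) (L : Local N j) where

      j∈ : ∀ x → x ∈ univ N → j x ∈ E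
      j∈ = proj₁ L

      ρ : V → V
      ρ x = rep (j x)

      ρ-inj-small : ∀ {M} → M ≼ N → Small κ (univ M) → InjectiveOn ρ (univ M)
      ρ-inj-small M≼ sM x y x∈ y∈ eq =
        let l = rep-reflects (j∈ x (≼⇒univ⊆ M≼ x x∈)) (j∈ y (≼⇒univ⊆ M≼ y y∈)) eq
            (α , _ , same , (_ , _ , i)) = inhabited (both l (proj₂ L _ M≼ sM))
        in proj₂ (proj₁ (proj₁ (proj₂ (proj₂ i)))) x y x∈ y∈ same

      image-good : ∀ {M} → M ≼ N → Small κ (univ M) →
                   Iso ρ M (transfer ρ M) × Good (image ρ (univ M)) (transfer ρ M)
      image-good {M} M≼ sM = iso , K-iso ρ M _ iso (proj₁ (≼-K _ _ M≼)) , univ-Iso iso ,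
        image-elim (_∈ Q) (λ x x∈ → ∈-image rep (j∈ x (≼⇒univ⊆ M≼ x x∈))) ,
        small-image ρ sM ,
        mono (λ α _ ((G , G≼ , i) , same) → G , G≼ , Iso-cong (values same) (Iso-∘ (Iso-inverse iso) i))
          (both (proj₂ L _ M≼ sM)
            (complete (λ x → Same (j x) (ρ x)) sM λ x x∈ → proj₂ (rep-spec (j∈ x (≼⇒univ⊆ M≼ x x∈)))))
        where
        iso : Iso ρ M (transfer ρ M)
        iso = transfer-Iso (proj₁ (≼-⊆ₘ _ _ M≼)) (ρ-inj-small M≼ sM)
        values : ∀ {α} → (∀ x → x ∈ univ M → Same (j x) (ρ x) α) →
                 ∀ q → q ∈ univ (transfer ρ M) → j (inverse ρ (univ M) q) ′ α ≡ q ′ α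
        values {α} same q q∈ =
          let (p , eq) = inverse-spec ρ (image⁻ ρ (subst (q ∈_) (univ-Iso iso) q∈))
          in trans (same _ p) (cong (_′ α) eq)

      hull₂ : ∀ {x y} → x ∈ univ N → y ∈ univ N →
              ∃ λ M → M ≼ N × x ∈ univ M × y ∈ univ M × Small κ (univ M)
      hull₂ {x} {y} x∈ y∈ =
        let (M , M≼ , sub , sM) = hull Cκ LST∈κ KN
              (∪-least {x = ｛ x ｝} {y = ｛ y ｝} (λ z z∈ → subst (_∈ univ N) (sym (single⁻ z∈)) x∈)
                (λ z z∈ → subst (_∈ univ N) (sym (single⁻ z∈)) y∈))
              (small-∪ (proj₁ inac) (small-single (proj₁ inac)) (small-single (proj₁ inac)))
        in M , M≼ , sub x (∪ˡ ∈-single) , sub y (∪ʳ ∈-single) , sM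

      ρ-inj : InjectiveOn ρ (univ N)
      ρ-inj x y x∈ y∈ = let (M , M≼ , x∈M , y∈M , sM) = hull₂ x∈ y∈ in ρ-inj-small M≼ sM x y x∈M y∈M

      ρ-∈ : ∀ x → x ∈ univ N → ρ x ∈ univ product
      ρ-∈ x x∈ =
        let (M , M≼ , x∈M , _ , sM)          = hull₂ x∈ x∈
            ((_ , _ , ((f∈ , _) , _) , _) , g) = image-good M≼ sM
        in ≼⇒univ⊆ (good-≼-product g) (ρ x) (f∈ x x∈M)

      abstract
        -- A renaming turns `ρ` into the identity on `N`. Each small submodel of `N` then lies below
        -- the renamed product, and `small-submodels-≼` passes from these to `N`.
        renamed : ∃ λ k → ∃ λ N′ → Iso k product N′ × (∀ x → x ∈ univ N → k (ρ x) ≡ x) × N ≼ N′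
        renamed =
          let (k , N′ , i , kρ) = rename product-K ρ-∈ ρ-inj
          in k , N′ , i , kρ , small-submodels-≼ (proj₁ inac) LST∈κ KN λ M M≼ sM →
            let (iM , g) = image-good M≼ sM
                (t≼ , i′) = ≼-restrict (good-≼-product g) i
            in subst (_≼ N′) (Iso-unique
                 (Iso-cong (λ x x∈ → kρ x (≼⇒univ⊆ M≼ x x∈)) (Iso-∘ iM i′))
                 (Iso-id (proj₁ (≼-⊆ₘ _ _ M≼)))) t≼

      embedded : ∃ λ N′ → N′ ≼ product × Iso ρ N N′
      embedded = let (k , N′ , i , kρ , N≼) = renamed in pull-back i kρ N≼
        where
        pull-back : ∀ {k N′} → Iso k product N′ → (∀ x → x ∈ univ N → k (ρ x) ≡ x) → N ≼ N′ →
                    ∃ λ N″ → N″ ≼ product × Iso ρ N N″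
        pull-back {k} i@(_ , _ , (k-inj , _) , _) kρ N≼ =
          let (t≼ , i′) = ≼-restrict N≼ (Iso-inverse i)
          in transfer (inverse k (univ product)) N , t≼ ,
             Iso-cong (λ x x∈ → trans (cong (inverse k (univ product)) (sym (kρ x x∈)))
               (inverse-β k-inj (ρ-∈ x x∈))) i′

    -- `N₁` becomes a submodel of the renamed product, and `N₂` follows along the same renaming;
    -- elements of `M` get the same class from both sides.
    amalgam : ∀ {M N₁ N₂ j₁ j₂} → M ≼ N₁ → M ≼ N₂ → Local N₁ j₁ → Local N₂ j₂ →
              (∀ x → x ∈ univ M → Large (Same (j₁ x) (j₂ x))) →
              ∃ λ M₃ → M ≼ M₃ × EmbedsOver M N₁ M₃ × EmbedsOver M N₂ M₃
    amalgam {M} {N₁} {N₂} M≼₁ M≼₂ L₁ L₂ same =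
      let K₁ = proj₂ (≼-K _ _ M≼₁)
          (k , M₃ , i , kρ , N₁≼) = Embedding.renamed K₁ L₁
          (N′ , N′≼ , i′)         = Embedding.embedded (proj₂ (≼-K _ _ M≼₂)) L₂
          (t≼ , i″)               = ≼-restrict N′≼ i
      in M₃ , ≼-trans _ _ _ M≼₁ N₁≼ ,
         (id , (N₁ , N₁≼ , Iso-id (K-structure N₁ K₁)) , λ _ _ → refl) ,
         (_ , (_ , t≼ , Iso-∘ i′ i″) , λ x x∈ →
           trans (cong k (sym (rep-cong (same x x∈)))) (kρ x (≼⇒univ⊆ M≼₁ x x∈)))

-- Amalgamation from approximate embeddings at a compact cardinal.

module CompactAmalgamation {ℓ : Level} (𝒵 : ZFC ℓ) (τ : SetTheory.Vocabulary 𝒵)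
    (𝔨 : SetTheory.AEC 𝒵 τ) (LST : SetTheory.V 𝒵) (lsb : SetTheory.AEC.LSBound 𝔨 LST) where
  open SetTheoryLemmas 𝒵
  open AEC 𝔨
  open StructureLemmas 𝒵 τ
  open AECLemmas 𝒵 τ 𝔨
  open SmallSubmodels 𝒵 τ 𝔨 LST lsb

  Amalgam : V → V → V → Set ℓ
  Amalgam M N₁ N₂ = ∃ λ M₃ → M ≼ M₃ × EmbedsOver M N₁ M₃ × EmbedsOver M N₂ M₃

  EmbedsOver-≼ : ∀ {M N N′} → N ≼ N′ → EmbedsOver M N N′
  EmbedsOver-≼ {M} {N} N≼ =
    id , (N , N≼ , Iso-id (K-structure N (proj₁ (≼-K _ _ N≼)))) , λ _ _ → refl

  Eventually : V → (V → Set ℓ) → Set ℓ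
  Eventually κ Q = ∃ λ β → β ∈ κ × (∀ α → α ∈ κ → β ⊆ α → Q α)

  Approximates : V → (V → V) → (V → V → V) → V → Set ℓ
  Approximates κ P h N = (∀ α → α ∈ κ → ∀ x → x ∈ univ N → h α x ∈ univ (P α))
    × (∀ M → M ≼ N → Small κ (univ M) → Eventually κ λ α → ∃ λ G → G ≼ P α × Iso (h α) M G)

  -- Stated with eventual validity in place of a filter, since for weakly compact κ the
  -- filter depends on the functions involved.
  Compact : V → V → Set ℓ
  Compact κ χ = ∀ (P : V → V) (h₁ h₂ : V → V → V) M N₁ N₂ →
    M ≼ N₁ → M ≼ N₂ → univ N₁ ≲ χ → univ N₂ ≲ χ → (∀ α → α ∈ κ → K (P α)) →
    Approximates κ P h₁ N₁ → Approximates κ P h₂ N₂ →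
    (∀ x → x ∈ univ M → Eventually κ λ α → h₁ α x ≡ h₂ α x) → Amalgam M N₁ N₂

  module Closure {κ : V} (inac : Inaccessible κ) (LST∈κ : LST ∈ κ) {P : V → V}
                 (KP : ∀ α → α ∈ κ → K (P α)) {pt : V} (pt-family : Families.IsFamily 𝒵 τ 𝔨 κ P pt) where
    open Families 𝒵 τ 𝔨 κ P

    PC : PowerClosed κ
    PC = proj₁ inac

    pointed : V → V
    pointed B = B ∪ ｛ pt ｝

    Bound : V → V → Set ℓ
    Bound B μ = μ ∈ κ × Cardinal μ × LST ⊆ μ × pointed B ≲ μ

    -- One cardinal bounds the hulls at all `α` simultaneously, so that this many new functions name
    -- all elements of all hulls.
    size : V → V
    size B = ε (Bound B)

    HullAt : V → V → V → Set ℓ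
    HullAt B α N = N ≼ P α × image (_′ α) (pointed B) ⊆ univ N × univ N ≲ size B

    hullAt : V → V → V
    hullAt B α = ε (HullAt B α)

    Codes : V → V → V → V → Set ℓ
    Codes B i α z = z ∈ univ (hullAt B α) × injection (univ (hullAt B α)) (size B) z ≡ i

    -- The new function with number `i` picks at `α` the element of the hull with code `i`. If there
    -- is none, it takes the value of `pt`, which lies in every hull.
    entry′ : ∀ B i α → Dec (∃ (Codes B i α)) → V
    entry′ B i α (yes (z , _)) = z
    entry′ B i α (no _)        = pt ′ α

    new : V → V → V
    new B i = lam κ λ α → entry′ B i α em

    abstract
      closure : V → V
      closure B = pointed B ∪ image (new B) (size B)

      ⊆-closure : ∀ {B} → B ⊆ closure B
      ⊆-closure z z∈ = ∪ˡ (∪ˡ z∈)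

    module _ {B : V} (sB : Small κ B) (family : ∀ e → e ∈ B → IsFamily e) where

      pointed-family : ∀ e → e ∈ pointed B → IsFamily e
      pointed-family e e∈ =
        [ family e , (λ p → subst IsFamily (sym (single⁻ p)) pt-family) ]′ (∪⁻ e∈)

      size-spec : Bound B (size B)
      size-spec = ε-spec (Bound B)
        (bounding-cardinal (proj₁ (proj₁ PC)) LST∈κ (small-∪ PC sB (small-single PC)))

      hullAt-spec : ∀ {α} → α ∈ κ → HullAt B α (hullAt B α)
      hullAt-spec {α} α∈ = let (_ , Cμ , L⊆ , B≲) = size-spec in
        ε-spec (HullAt B α) (proj₂ (proj₂ lsb) (size B) (P α) _ Cμ L⊆ (KP α α∈)
          (image-elim (_∈ univ (P α)) λ e e∈ → proj₂ (pointed-family e e∈) α α∈)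
          (≲-trans (image-≲ (_′ α)) B≲))

      entry-∈ : ∀ i {α} → α ∈ κ → ∀ d → entry′ B i α d ∈ univ (hullAt B α)
      entry-∈ i {α} α∈ (yes (_ , z∈ , _)) = z∈
      entry-∈ i {α} α∈ (no _) =
        proj₁ (proj₂ (hullAt-spec α∈)) _ (∈-image (_′ α) (∪ʳ ∈-single))

      new-value : ∀ i {α} → α ∈ κ → new B i ′ α ∈ univ (hullAt B α)
      new-value i {α} α∈ = subst (_∈ univ (hullAt B α)) (sym (lam-β (λ α → entry′ B i α em) α∈))
        (entry-∈ i α∈ em)

      new-family : ∀ i → IsFamily (new B i)
      new-family i = lam-function _ , λ α α∈ →
        ≼⇒univ⊆ (proj₁ (hullAt-spec α∈)) _ (new-value i α∈)

      abstract
        closure-family : ∀ e → e ∈ closure B → IsFamily e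
        closure-family e e∈ =
          [ pointed-family e , image-elim IsFamily (λ i _ → new-family i) e ]′ (∪⁻ e∈)

        closure-small : Small κ (closure B)
        closure-small = small-∪ PC (small-∪ PC sB (small-single PC))
          (small-image (new B) (small-∈ (proj₁ size-spec)))

        closure-closed : Closed (closure B)
        closure-closed α α∈ = hullAt B α , N≼ , ext covered values
          where
          N≼ : hullAt B α ≼ P α
          N≼ = proj₁ (hullAt-spec α∈)
          ι : Injective (injection (univ (hullAt B α)) (size B)) (univ (hullAt B α)) (size B)
          ι = injection-spec (proj₂ (proj₂ (hullAt-spec α∈)))
          decode : ∀ {z} → z ∈ univ (hullAt B α) →
                   ∀ d → entry′ B (injection (univ (hullAt B α)) (size B) z) α d ≡ z
          decode {z} z∈ (yes (w , w∈ , eq)) = proj₂ ι w z w∈ z∈ eq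
          decode {z} z∈ (no none)           = ⊥-elim (none (z , z∈ , refl))
          covered : univ (hullAt B α) ⊆ image (_′ α) (closure B)
          covered z z∈ = subst (_∈ image (_′ α) (closure B))
            (trans (lam-β (λ α → entry′ B _ α em) α∈) (decode z∈ em))
            (∈-image (_′ α) (∪ʳ (∈-image (new B) (proj₁ ι z z∈))))
          values : image (_′ α) (closure B) ⊆ univ (hullAt B α)
          values = image-elim (_∈ univ (hullAt B α)) λ e e∈ →
            [ (λ p → proj₁ (proj₂ (hullAt-spec α∈)) _ (∈-image (_′ α) p))
            , image-elim (λ e → e ′ α ∈ univ (hullAt B α)) (λ i _ → new-value i α∈) e ]′ (∪⁻ e∈)

  module Setting {κ : V} (inac : Inaccessible κ) (LST∈κ : LST ∈ κ) (P : V → V) (h₁ h₂ : V → V → V)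
                 {M N₁ N₂ : V} (M≼₁ : M ≼ N₁) (M≼₂ : M ≼ N₂) (KP : ∀ α → α ∈ κ → K (P α))
                 (approx₁ : Approximates κ P h₁ N₁) (approx₂ : Approximates κ P h₂ N₂)
                 (agree : ∀ x → x ∈ univ M → Eventually κ λ α → h₁ α x ≡ h₂ α x)
                 {x₀ : V} (x₀∈ : x₀ ∈ univ N₁) where
    open Families 𝒵 τ 𝔨 κ P public

    j : (V → V → V) → V → V
    j h x = lam κ λ α → h α x

    j-family : ∀ {h N} → Approximates κ P h N → ∀ x → x ∈ univ N → IsFamily (j h x)
    j-family {h} (into , _) x x∈ = lam-function _ , λ α α∈ →
      subst (_∈ univ (P α)) (sym (lam-β (λ α → h α x) α∈)) (into α α∈ x x∈)

    open Closure inac LST∈κ KP (j-family approx₁ x₀ x₀∈) public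

    module _ (F : Filter κ) where
      open Filter F
      open ReducedProduct 𝒵 τ 𝔨 LST lsb inac LST∈κ F P

      conclude : ∀ E → (∀ B → B ⊆ E → Small κ B →
                   ∃ λ B′ → B′ ⊆ E × Small κ B′ × B ⊆ B′ × Closed B′ × Decided B′) →
                 (∀ x → x ∈ univ N₁ → j h₁ x ∈ E) → (∀ x → x ∈ univ N₂ → j h₂ x ∈ E) → Amalgam M N₁ N₂
      conclude E cofinal j₁∈ j₂∈ = amalgam M≼₁ M≼₂ (j₁∈ , local approx₁) (j₂∈ , local approx₂)
        λ x x∈ → eventually (agree x x∈) λ α α∈ p →
          trans (lam-β (λ α → h₁ α x) α∈) (trans p (sym (lam-β (λ α → h₂ α x) α∈)))
        where
        open Classes E cofinal
        eventually : ∀ {Q R : V → Set ℓ} → Eventually κ Q → (∀ α → α ∈ κ → Q α → R α) → Large R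
        eventually (β , β∈ , q) f = mono (λ α α∈ sub → f α α∈ (q α α∈ sub)) (final β∈)
        local : ∀ {h N} → Approximates κ P h N → ∀ M → M ≼ N → Small κ (univ M) →
                Large λ α → ∃ λ G → G ≼ P α × Iso (λ x → j h x ′ α) M G
        local {h} (_ , loc) M M≼ sM = eventually (loc M M≼ sM) λ α α∈ (G , G≼ , i) →
          G , G≼ , Iso-cong (λ x _ → sym (lam-β (λ α → h α x) α∈)) i

  -- An empty N₁ is a submodel of N₂.
  nonempty-suffices : ∀ {M N₁ N₂} → M ≼ N₁ → M ≼ N₂ →
                      (∀ x₀ → x₀ ∈ univ N₁ → Amalgam M N₁ N₂) → Amalgam M N₁ N₂
  nonempty-suffices {M} {N₁} {N₂} M≼₁ M≼₂ f with em {univ N₁ ≡ ∅}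
  ... | yes e = N₂ , M≼₂ ,
    EmbedsOver-≼ (empty-≼ N₁ N₂ (proj₂ (≼-K _ _ M≼₁)) (proj₂ (≼-K _ _ M≼₂)) e) ,
    EmbedsOver-≼ (≼-refl N₂ (proj₂ (≼-K _ _ M≼₂)))
  ... | no ne = let (x₀ , x₀∈) = nonempty ne in f x₀ x₀∈

  -- The ultrafilter decides every set, so the full product of the `P α` can serve as `E`, whatever
  -- its size.
  measurable⇒compact : ∀ {κ χ} → Measurable κ → LST ∈ κ → Compact κ χ
  measurable⇒compact {κ} mκ LST∈κ P h₁ h₂ M N₁ N₂ M≼₁ M≼₂ _ _ KP approx₁ approx₂ agree =
    nonempty-suffices M≼₁ M≼₂ λ x₀ x₀∈ → Ultraproduct.result x₀∈
    where
    open MeasurableCardinal mκ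
    module Ultraproduct {x₀ : V} (x₀∈ : x₀ ∈ univ N₁) where
      open Setting inaccessible LST∈κ P h₁ h₂ M≼₁ M≼₂ KP approx₁ approx₂ agree x₀∈

      E : V
      E = sep (𝒫 (κ ×ₛ ⋃ (image (univ ∘ P) κ))) IsFamily

      ∈E : ∀ {e} → IsFamily e → e ∈ E
      ∈E {e} fam@(f , into) = ∈-sep IsFamily (∈-𝒫 λ p p∈ →
        let (α , α∈ , eq) = function⁻ f p∈ in subst (_∈ κ ×ₛ ⋃ (image (univ ∘ P) κ)) (sym eq)
          (∈-× α∈ (∈-⋃image (univ ∘ P) α∈ (into α α∈)))) fam

      result : Amalgam M N₁ N₂
      result = conclude filter E
        (λ B B⊆ sB → let fam = λ e e∈ → proj₂ (sep⁻ IsFamily (B⊆ e e∈)) in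
          closure B , (λ e e∈ → ∈E (closure-family sB fam e e∈)) , closure-small sB fam , ⊆-closure ,
          closure-closed sB fam ,
          (λ _ _ _ _ → filter-decides _) , (λ _ _ _ _ → filter-decides _) , λ _ _ _ _ _ _ → filter-decides _)
        (λ x x∈ → ∈E (j-family approx₁ x x∈)) (λ x x∈ → ∈E (j-family approx₂ x x∈))

  -- The filter decides only `κ` prescribed sets, so `E` is built as a union of `κ` small closed
  -- stages before the filter is chosen. By regularity each small subset of `E` lies in one stage.
  weaklyCompact⇒compact : ∀ {κ} → WeaklyCompact κ → LST ∈ κ → Compact κ κ
  weaklyCompact⇒compact {κ} wκ LST∈κ P h₁ h₂ M N₁ N₂ M≼₁ M≼₂ N₁≲ N₂≲ KP approx₁ approx₂ agree =
    nonempty-suffices M≼₁ M≼₂ λ x₀ x₀∈ → WeakUltraproduct.result x₀∈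
    where
    open WeaklyCompactCardinal wκ
    Oκ : Ordinal κ
    Oκ = proj₁ (proj₁ wκ)
    module WeakUltraproduct {x₀ : V} (x₀∈ : x₀ ∈ univ N₁) where
      open Setting inaccessible LST∈κ P h₁ h₂ M≼₁ M≼₂ KP approx₁ approx₂ agree x₀∈

      -- A set with at most one member: codes that are not taken contribute nothing to the stages.
      listed : V → V → V
      listed N i = sep (univ N) λ x → injection (univ N) κ x ≡ i

      listed-small : ∀ {N} i → univ N ≲ κ → Small κ (listed N i)
      listed-small i N≲ = small-≲ {y = ｛ ∅ ｝}
        ((λ _ → ∅) , (λ _ _ → ∈-single) , λ x y x∈ y∈ _ →
          let (p , q) = sep⁻ _ x∈ ; (p′ , q′) = sep⁻ _ y∈ in
          proj₂ (injection-spec N≲) x y p p′ (trans q (sym q′)))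
        (small-single PC)

      added : V → V
      added i = image (j h₁) (listed N₁ i) ∪ image (j h₂) (listed N₂ i)

      added-family : ∀ i e → e ∈ added i → IsFamily e
      added-family i e e∈ = [ go approx₁ , go approx₂ ]′ (∪⁻ e∈)
        where
        go : ∀ {h N} → Approximates κ P h N → e ∈ image (j h) (listed N i) → IsFamily e
        go ap = image-elim IsFamily (λ x x∈ → j-family ap x (proj₁ (sep⁻ _ x∈))) e

      step : V → V → V
      step i g = closure (⋃ (image (g ′_) i) ∪ added i)

      stage before : V → V
      stage = trec step
      before i = ⋃ (image stage i) ∪ added i

      stage-≡ : ∀ {i} → Ordinal i → stage i ≡ closure (before i)
      stage-≡ {i} O = trans (trec-≡ step O)
        (cong (λ u → closure (⋃ u ∪ added i)) (image-cong _ _ i λ k k∈ → lam-β stage k∈))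

      Fine : V → Set ℓ
      Fine B = Small κ B × (∀ e → e ∈ B → IsFamily e)

      before-fine : ∀ {i} → i ∈ κ → (∀ k → k ∈ i → Fine (stage k)) → Fine (before i)
      before-fine {i} i∈ fine =
        small-∪ PC (small-⋃ inaccessible stage (small-∈ i∈) λ k k∈ → proj₁ (fine k k∈))
          (small-∪ PC (small-image (j h₁) (listed-small i N₁≲)) (small-image (j h₂) (listed-small i N₂≲))) ,
        λ e e∈ → [ (λ p → let (k , k∈ , e∈k) = ⋃image⁻ stage p in proj₂ (fine k k∈) e e∈k)
                 , added-family i e ]′ (∪⁻ e∈)

      stage-fine : ∀ i → Ordinal i → i ∈ κ → Fine (stage i)
      stage-fine = ord-ind (λ i → i ∈ κ → Fine (stage i)) λ i O ih i∈ →
        let (s , fam) = before-fine i∈ λ k k∈ → ih k k∈ (proj₁ Oκ i i∈ k k∈) in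
        subst Fine (sym (stage-≡ O)) (closure-small s fam , closure-family s fam)

      fine : ∀ {i} → i ∈ κ → Fine (stage i)
      fine i∈ = stage-fine _ (ord-∈ Oκ i∈) i∈

      before-⊆ : ∀ {i} → i ∈ κ → before i ⊆ stage i
      before-⊆ i∈ z z∈ = subst (z ∈_) (sym (stage-≡ (ord-∈ Oκ i∈))) (⊆-closure z z∈)

      stage-closed : ∀ {i} → i ∈ κ → Closed (stage i)
      stage-closed {i} i∈ =
        let (s , fam) = before-fine i∈ λ k k∈ → fine (proj₁ Oκ i i∈ k k∈) in
        subst Closed (sym (stage-≡ (ord-∈ Oκ i∈))) (closure-closed s fam)

      E : V
      E = ⋃ (image stage κ)

      j∈E : ∀ {h N} → univ N ≲ κ → (∀ i → image (j h) (listed N i) ⊆ added i) →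
            ∀ x → x ∈ univ N → j h x ∈ E
      j∈E {h} {N} N≲ sub x x∈ =
        let i∈ = proj₁ (injection-spec N≲) x x∈ in
        ∈-⋃image stage i∈ (before-⊆ i∈ _ (∪ʳ (sub _ _ (∈-image (j h) (∈-sep _ x∈ refl)))))

      absorbed : ∀ B → B ⊆ E → Small κ B → ∃ λ i → i ∈ κ × B ⊆ stage i
      absorbed B B⊆ sB = bounded-stage (small-bounded inaccessible at sB λ e e∈ → proj₁ (at-spec e∈))
        where
        At : V → V → Set ℓ
        At e i = i ∈ κ × e ∈ stage i
        at : V → V
        at e = ε (At e)
        at-spec : ∀ {e} → e ∈ B → At e (at e)
        at-spec {e} e∈ = ε-spec (At e) (⋃image⁻ stage (B⊆ e e∈))
        bounded-stage : (∃ λ γ → γ ∈ κ × (∀ e → e ∈ B → at e ⊆ γ)) → ∃ λ i → i ∈ κ × B ⊆ stage i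
        bounded-stage (γ , γ∈ , bd) = S γ , Sγ∈ , λ e e∈ →
          let (a∈ , e∈a) = at-spec e∈ in before-⊆ Sγ∈ e (∪ˡ (∈-⋃image stage
            (⊆-∈ (ord-∈ Oκ a∈) (S-ord (ord-∈ Oκ γ∈)) (bd e e∈) ∈-S) e∈a))
          where
          Sγ∈ : S γ ∈ κ
          Sγ∈ = S∈-infinite infiniteCardinal γ∈

      -- the sets of those α at which a given atomic formula holds
      sames holdses values atoms : V → V
      sames B   = ⋃ (image (λ e → image (λ e′ → sep κ (Same e e′)) B) B)
      holdses B = ⋃ (image (λ s → image (λ x → sep κ (Holds s x)) (B ^ₛ arity s)) Sym)
      values B  =
        ⋃ (image (λ s → ⋃ (image (λ x → image (λ e → sep κ (Value s x e)) B) (B ^ₛ arity s))) Sym)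
      atoms B   = sames B ∪ (holdses B ∪ values B)

      atoms-small : ∀ {B} → Small κ B → Small κ (atoms B)
      atoms-small sB = small-∪ PC (small-⋃ inaccessible _ sB λ _ _ → small-image _ sB)
        (small-∪ PC
          (small-⋃ inaccessible _ (small-Sym LST∈κ) λ s s∈ → small-image _ (small-^ PC LST∈κ sB s∈))
          (small-⋃ inaccessible _ (small-Sym LST∈κ) λ s s∈ →
            small-⋃ inaccessible _ (small-^ PC LST∈κ sB s∈) λ _ _ → small-image _ sB))

      C : V
      C = ⋃ (image (λ i → atoms (stage i)) κ)

      C≲κ : C ≲ κ
      C≲κ = ≲-⋃ PC (λ i → atoms (stage i)) ≲-refl λ i i∈ → small⇒≲ Oκ (atoms-small (proj₁ (fine i∈)))

      -- Presents the members of `C` as a sequence indexed by `κ`, the form that `deciding-filter`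
      -- takes; at codes not taken it holds vacuously.
      Coded : V → V → Set ℓ
      Coded i α = ∀ c → c ∈ C → injection C κ c ≡ i → α ∈ c

      decides-atom : ∀ {F : Filter κ} {c} → c ∈ C → Decides F (Coded (injection C κ c)) → Decides F (_∈ c)
      decides-atom {F} {c} c∈ = [ (λ p → inj₁ (mono (λ α _ q → q c c∈ refl) p))
        , (λ p → inj₂ (mono (λ α _ ¬q α∈ → ¬q λ c′ c′∈ eq →
            subst (α ∈_) (proj₂ (injection-spec C≲κ) c c′ c∈ c′∈ (sym eq)) α∈) p)) ]′
        where open Filter F

      decides-sep : ∀ {F : Filter κ} {R : V → Set ℓ} → Decides F (_∈ sep κ R) → Decides F R
      decides-sep {F} {R} = [ (λ p → inj₁ (mono (λ α _ q → proj₂ (sep⁻ R q)) p))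
        , (λ p → inj₂ (mono (λ α α∈ ¬q r → ¬q (∈-sep R α∈ r)) p)) ]′
        where open Filter F

      module _ (F : Filter κ) (decides : ∀ i → i ∈ κ → Decides F (Coded i)) where
        open ReducedProduct 𝒵 τ 𝔨 LST lsb inaccessible LST∈κ F P using (Decided)

        decides-C : ∀ {i} {R : V → Set ℓ} → i ∈ κ → sep κ R ∈ atoms (stage i) → Decides F R
        decides-C {R = R} i∈ c∈ = decides-sep {F} (decides-atom {F} c∈C
          (decides _ (proj₁ (injection-spec C≲κ) _ c∈C)))
          where
          c∈C : sep κ R ∈ C
          c∈C = ∈-⋃image (λ i → atoms (stage i)) i∈ c∈

        stage-decided : ∀ {i} → i ∈ κ → Decided (stage i)
        stage-decided i∈ =
          (λ e e′ e∈ e′∈ → decides-C i∈ (∪ˡ (∈-⋃image _ e∈ (∈-image _ e′∈)))) ,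
          (λ s x s∈ x∈ → decides-C i∈ (∪ʳ (∪ˡ (∈-⋃image _ s∈ (∈-image _ x∈))))) ,
          λ s x e s∈ x∈ e∈ →
            decides-C i∈ (∪ʳ (∪ʳ (∈-⋃image _ s∈ (∈-⋃image _ x∈ (∈-image _ e∈)))))

        conclusion : Amalgam M N₁ N₂
        conclusion = conclude F E
          (λ B B⊆ sB → let (i , i∈ , sub) = absorbed B B⊆ sB in
            stage i , (λ e e∈ → ∈-⋃image stage i∈ e∈) , proj₁ (fine i∈) , sub ,
            stage-closed i∈ , stage-decided i∈)
          (j∈E N₁≲ λ i z z∈ → ∪ˡ z∈) (j∈E N₂≲ λ i z z∈ → ∪ʳ z∈)

      result : Amalgam M N₁ N₂
      result = let (F , decides) = deciding-filter Coded in conclusion F decides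

-- Amalgamation at the end of a chain, and models on ordinals.

module Majorities {ℓ : Level} (𝒵 : ZFC ℓ) (τ : SetTheory.Vocabulary 𝒵)
    (𝔨 : SetTheory.AEC 𝒵 τ) (LST : SetTheory.V 𝒵) (lsb : SetTheory.AEC.LSBound 𝔨 LST) where
  open SetTheoryLemmas 𝒵
  open AEC 𝔨
  open StructureLemmas 𝒵 τ
  open AECLemmas 𝒵 τ 𝔨
  open DirectedUnions 𝒵 τ 𝔨 using (univ-⋃ₘ)
  open CompactAmalgamation 𝒵 τ 𝔨 LST lsb

  twice : V → V
  twice = trec λ α g → ⋃ (image (λ δ → S (S (g ′ δ))) α)

  twice-≡ : ∀ {α} → Ordinal α → twice α ≡ ⋃ (image (λ δ → S (S (twice δ))) α)
  twice-≡ {α} O = trans (trec-≡ _ O)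
    (cong ⋃ (image-cong _ _ α λ δ δ∈ → cong (λ x → S (S x)) (lam-β twice δ∈)))

  twice-Twice : ∀ {α} → Ordinal α → Twice α (twice α)
  twice-Twice O = twice , (λ γ γ∈ → twice-≡ (ord-∈ (S-ord O) γ∈)) , refl

  twice-ord : ∀ α → Ordinal α → Ordinal (twice α)
  twice-ord = ord-ind (λ α → Ordinal (twice α)) λ α O ih → subst Ordinal (sym (twice-≡ O))
    (⋃image-ord _ λ δ δ∈ → S-ord (S-ord (ih δ δ∈)))

  ⊆-twice : ∀ α → Ordinal α → α ⊆ twice α
  ⊆-twice = ord-ind (λ α → α ⊆ twice α) λ α O ih δ δ∈ → subst (δ ∈_) (sym (twice-≡ O))
    (∈-⋃image (λ δ → S (S (twice δ))) δ∈ (⊆-S (⊆-∈ (ord-∈ O δ∈) (S-ord (twice-ord δ (ord-∈ O δ∈))) (ih δ δ∈) ∈-S)))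

  twice-∈ : ∀ {θ} → Inaccessible θ → ∀ α → Ordinal α → α ∈ θ → twice α ∈ θ
  twice-∈ {θ} ((I@((Oθ , _) , _) , _) , bounded) =
    ord-ind (λ α → α ∈ θ → twice α ∈ θ) λ α O ih α∈ →
      let (γ , γ∈ , bd) = bounded α (λ δ → S (S (twice δ))) α∈ λ δ δ∈ →
            S∈-infinite I (S∈-infinite I (ih δ δ∈ (proj₁ Oθ α α∈ δ δ∈)))
      in ⊆-∈ (twice-ord α O) Oθ (λ z z∈ →
           let (δ , δ∈ , z∈δ) = ⋃image⁻ (λ δ → S (S (twice δ))) (subst (z ∈_) (twice-≡ O) z∈)
           in bd δ δ∈ z z∈δ) γ∈

  module _ {θ : V} (mθ : Measurable θ) (LST∈θ : LST ∈ θ) where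
    open MeasurableCardinal mθ

    private
      Iθ : InfiniteCardinal θ
      Iθ = infiniteCardinal

      Oθ : Ordinal θ
      Oθ = proj₁ (proj₁ Iθ)

    module ChainAmalgam {M : V → V} {N₁ N₂ : V} (chain : IncreasingContinuous M (S θ))
        (M≼₁ : M θ ≼ N₁) (M≼₂ : M θ ≼ N₂) (index : V → V) (index∈ : ∀ α → α ∈ θ → index α ∈ θ)
        (index-above : ∀ α → α ∈ θ → α ∈ index α)
        (amalgams : ∀ α → α ∈ θ → Amalgam (M (index α)) N₁ N₂) where

      Embeds : V → (V → V) → V → V → Set ℓ
      Embeds α f N X = (∃ λ N′ → N′ ≼ X × Iso f N N′) × (∀ x → x ∈ univ (M (index α)) → f x ≡ x)

      chosen : ∃ λ (A : V → V × (V → V) × (V → V)) → ∀ α → α ∈ θ → let (X , f₁ , f₂) = A α in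
               M (index α) ≼ X × Embeds α f₁ N₁ X × Embeds α f₂ N₂ X
      chosen = choice-on
        (λ α (X , f₁ , f₂) → M (index α) ≼ X × Embeds α f₁ N₁ X × Embeds α f₂ N₂ X) (∅ , id , id)
        λ α α∈ → let (X , M≼ , (f₁ , e₁) , (f₂ , e₂)) = amalgams α α∈ in (X , f₁ , f₂) , M≼ , e₁ , e₂

      P : V → V
      P α = proj₁ (proj₁ chosen α)

      h₁ h₂ : V → V → V
      h₁ α = proj₁ (proj₂ (proj₁ chosen α))
      h₂ α = proj₂ (proj₂ (proj₁ chosen α))

      embeds₁ : ∀ α → α ∈ θ → Embeds α (h₁ α) N₁ (P α)
      embeds₁ α α∈ = proj₁ (proj₂ (proj₂ chosen α α∈))

      embeds₂ : ∀ α → α ∈ θ → Embeds α (h₂ α) N₂ (P α)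
      embeds₂ α α∈ = proj₂ (proj₂ (proj₂ chosen α α∈))

      approximates : ∀ {h N} → (∀ α → α ∈ θ → Embeds α (h α) N (P α)) → Approximates θ P h N
      approximates {h} {N} emb =
        (λ α α∈ x x∈ → let ((N′ , N′≼ , (_ , _ , ((f∈ , _) , _) , _)) , _) = emb α α∈ in
          ≼⇒univ⊆ N′≼ (h α x) (f∈ x x∈)) ,
        λ G G≼ _ → ∅ , ∅∈-infinite Iθ , λ α α∈ _ →
          let ((N′ , N′≼ , i) , _) = emb α α∈ ; (t≼ , j) = ≼-restrict G≼ i in
          transfer (h α) G , ≼-trans _ _ _ t≼ N′≼ , j

      -- By continuity at the limit `θ`, `x` appears in some `M β`. For `β ⊆ α` both embeddings at
      -- `α` fix `M (index α)` pointwise, and `x` lies in it.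
      agree : ∀ x → x ∈ univ (M θ) → Eventually θ λ α → h₁ α x ≡ h₂ α x
      agree x x∈ =
        let (β , β∈ , x∈β) = ⋃image⁻ (λ α → univ (M α)) (subst (x ∈_)
              (trans (cong univ (proj₂ (proj₂ chain) θ ∈-S (infinite-limit Iθ))) (univ-⋃ₘ M θ)) x∈)
        in β , β∈ , λ α α∈ β⊆α →
          let β∈idx = ⊆-∈ (ord-∈ Oθ β∈) (ord-∈ Oθ (index∈ α α∈)) β⊆α (index-above α α∈)
              x∈idx = ≼⇒univ⊆ (proj₁ (proj₂ chain) (index α) β (⊆-S (index∈ α α∈)) β∈idx) x x∈β
          in trans (proj₂ (embeds₁ α α∈) x x∈idx) (sym (proj₂ (embeds₂ α α∈) x x∈idx))

      result : Amalgam (M θ) N₁ N₂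
      result = measurable⇒compact mθ LST∈θ P h₁ h₂ (M θ) N₁ N₂ M≼₁ M≼₂
        -- `measurable⇒compact` allows any size bound; the union of the two universes serves for
        -- both models.
        (⊆⇒≲ {y = univ N₁ ∪ univ N₂} λ _ → ∪ˡ) (⊆⇒≲ λ _ → ∪ʳ)
        (λ α α∈ → proj₂ (≼-K _ _ (proj₁ (proj₂ chosen α α∈))))
        (approximates embeds₁) (approximates embeds₂) agree

    -- `F` chooses an extension as in the hypothesis. Models above `M θ` are above the model with
    -- index 2α+2, which is `F` of the one with index 2α+1, and hence amalgamate over the latter;
    -- `ChainAmalgam` passes to `M θ`.
    majority : ∀ {ν χ₁ χ₂} →
      (∀ M → Dom ν M → univ M ≲ χ₁ × univ M ≲ χ₂) →
      (∀ M → Dom ν M → ∃ λ M′ → (M ≼ M′ × Dom ν M′) ×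
         (∀ N₁ N₂ → M′ ≼ N₁ → M′ ≼ N₂ → K[ χ₁ ] N₁ → K[ χ₂ ] N₂ → Amalgam M N₁ N₂)) →
      HasAmalgamationBases₂ χ₁ χ₂ ν θ
    majority {ν} {χ₁} {χ₂} sizes extend = inaccessible⇒regular inaccessible , F ,
      (λ M d → proj₁ (F-spec d)) , λ M chain dom F≡ →
        proj₁ chain θ ∈-S , proj₁ (sizes (M θ) (dom θ ∈-S)) , proj₂ (sizes (M θ) (dom θ ∈-S)) ,
        λ N₁ N₂ M≼₁ M≼₂ k₁ k₂ →
          let amalgams : ∀ α → α ∈ θ → Amalgam (M (S (twice α))) N₁ N₂
              amalgams α α∈ =
                let i∈ = index∈ α α∈
                    FM≼ = subst (_≼ M θ) (F≡ α (twice α) α∈ (twice-Twice (ord-∈ Oθ α∈)))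
                            (proj₁ (proj₂ chain) θ (S (S (twice α))) ∈-S (S∈-infinite Iθ i∈))
                in proj₂ (F-spec (dom (S (twice α)) (⊆-S i∈))) N₁ N₂
                     (≼-trans _ _ _ FM≼ M≼₁) (≼-trans _ _ _ FM≼ M≼₂) k₁ k₂
          in ChainAmalgam.result chain M≼₁ M≼₂ (λ α → S (twice α)) index∈
               (λ α α∈ → ⊆-∈ (ord-∈ Oθ α∈) (S-ord (twice-ord α (ord-∈ Oθ α∈)))
                  (⊆-twice α (ord-∈ Oθ α∈)) ∈-S) amalgams
      where
      Extends : V → V → Set ℓ
      Extends M M′ = (M ≼ M′ × Dom ν M′) ×
        (∀ N₁ N₂ → M′ ≼ N₁ → M′ ≼ N₂ → K[ χ₁ ] N₁ → K[ χ₂ ] N₂ → Amalgam M N₁ N₂)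
      F : V → V
      F M = ε (Extends M)
      F-spec : ∀ {M} → Dom ν M → Extends M (F M)
      F-spec d = ε-spec _ (extend _ d)
      index∈ : ∀ α → α ∈ θ → S (twice α) ∈ θ
      index∈ α α∈ = S∈-infinite Iθ (twice-∈ inaccessible α (ord-∈ Oθ α∈) α∈)

  -- A cardinality above `ν` would be at least `ν⁺`, and then `univ M` would contain itself.
  Dom⇒≈ : ∀ {ν M} → Cardinal ν → Dom ν M → univ M ≈ ν
  Dom⇒≈ {ν} {M} Cν (_ , OM , ν⊆ , ν⁺ , (_ , _ , least⁺) , M∈) = cantor-schröder-bernstein
    (≲-trans (≈⇒≲ (≈-card (univ M))) (⊆⇒≲ (∉⇒⊇ (proj₁ Cρ) (proj₁ Cν) λ ν∈ρ →
      ∈-irrefl (ρ⊆ (univ M) (least⁺ (card (univ M)) Cρ ν∈ρ (univ M) M∈)))))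
    (⊆⇒≲ ν⊆)
    where
    Cρ : Cardinal (card (univ M))
    Cρ = card-cardinal (univ M)
    ρ⊆ : card (univ M) ⊆ univ M
    ρ⊆ = ≲⇒⊆ Cρ OM (≈⇒≲ (≈-sym (≈-card (univ M))))

  K[]-≈ : ∀ {ν N N′ f} → Iso f N N′ → K[ ν ] N → K[ ν ] N′
  K[]-≈ {f = f} i@(_ , _ , b , _) (KN , C , N≈) = K-iso f _ _ i KN , C , ≈-trans (≈-sym (f , b)) N≈

  OrdinalCopy : V → V → V → V → (V → V) → Set ℓ
  OrdinalCopy ν M N M′ g = (M ≼ M′ × Dom ν M′) × Iso g N M′ × (∀ x → x ∈ univ M → g x ≡ x)

  -- The values of `F` have to live on ordinals. Since `univ M` is an ordinal, the identity on it
  -- can start an enumeration of `N`, which keeps `M` in place.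
  ordinal-copy : ∀ {ν M N} → Dom ν M → M ≼ N → K[ ν ] N → ∃ λ M′ → ∃ λ g → OrdinalCopy ν M N M′ g
  ordinal-copy {ν} {M} {N} (KM , OM , ν⊆ , ν⁺ , suc⁺@((Oν⁺ , Cν⁺) , ν∈ , _) , _) M≼ (KN , _ , N≈ν) =
    let (β , e , enum) = enumeration (univ N) (univ M) id OM (≼⇒univ⊆ M≼ , λ _ _ _ _ eq → eq)
    in copy β e enum
    where
    copy : ∀ β e → Enumerates id (univ M) e β (univ N) → ∃ λ M′ → ∃ λ g → OrdinalCopy ν M N M′ g
    copy β e (Oβ , M⊆β , b , e-id) =
      transfer g N , g , (subst (_≼ transfer g N) same t≼ , K-iso g N _ i KN , subst Ordinal (sym univ≡) Oβ ,
        (λ z z∈ → subst (z ∈_) (sym univ≡) (M⊆β z (ν⊆ z z∈))) , ν⁺ , suc⁺ ,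
        subst (_∈ ν⁺) (sym univ≡) β∈) , i , g-id
      where
      g : V → V
      g = inverse e β
      moved : univ (transfer g N) ≡ β × Iso g N (transfer g N) × Iso e (transfer g N) N
      moved = transfer-back (K-structure N KN) b
      univ≡ = proj₁ moved
      i = proj₁ (proj₂ moved)
      g-id : ∀ x → x ∈ univ M → g x ≡ x
      g-id x x∈ = trans (cong g (sym (e-id x x∈))) (inverse-β (proj₁ b) (M⊆β x x∈))
      t≼ : transfer g M ≼ transfer g N
      t≼ = proj₁ (≼-restrict M≼ i)
      same : transfer g M ≡ M
      same = Iso-unique (Iso-cong g-id (proj₂ (≼-restrict M≼ i))) (Iso-id (K-structure M KM))
      β∈ : β ∈ ν⁺
      β∈ with ⊆-or-∋ Oν⁺ Oβ
      ... | inj₂ p = p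
      ... | inj₁ p = ⊥-elim (Cν⁺ ν ν∈ (cantor-schröder-bernstein (⊆⇒≲ (proj₁ Oν⁺ ν ν∈))
                       (≲-trans (⊆⇒≲ p) (≲-trans (e , proj₁ b) (≈⇒≲ N≈ν)))))

  AmalgamatesOver : V → V → V → V → Set ℓ
  AmalgamatesOver χ₁ χ₂ M N =
    ∀ N₁ N₂ → N ≼ N₁ → N ≼ N₂ → K[ χ₁ ] N₁ → K[ χ₂ ] N₂ → Amalgam M N₁ N₂

  -- Extensions of the copy M′ of N are renamed to extensions of N.
  amalgamates-copy : ∀ {χ₁ χ₂ M N M′ g} → M ≼ N → Iso g N M′ → (∀ x → x ∈ univ M → g x ≡ x) →
                     AmalgamatesOver χ₁ χ₂ M N → AmalgamatesOver χ₁ χ₂ M M′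
  amalgamates-copy {χ₁} {χ₂} {M} {N} {M′} {g} M≼ i@(_ , _ , ((g∈ , g-inj) , _) , _) g-id amal
                   N₁ N₂ ≼₁ ≼₂ k₁ k₂ =
    let (f₁ , N₁′ , i₁ , N≼₁ , id₁) = renamed ≼₁
        (f₂ , N₂′ , i₂ , N≼₂ , id₂) = renamed ≼₂
        (M₃ , M≼₃ , emb₁ , emb₂) = amal N₁′ N₂′ N≼₁ N≼₂ (K[]-≈ i₁ k₁) (K[]-≈ i₂ k₂)
    in M₃ , M≼₃ , compose i₁ id₁ emb₁ , compose i₂ id₂ emb₂
    where
    Renamed : V → Set ℓ
    Renamed X = ∃ λ f → ∃ λ X′ → Iso f X X′ × N ≼ X′ × (∀ x → x ∈ univ M → f x ≡ x)
    renamed : ∀ {X} → M′ ≼ X → Renamed X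
    renamed {X} M′≼ = build (rename (proj₂ (≼-K _ _ M′≼)) (λ x x∈ → ≼⇒univ⊆ M′≼ (g x) (g∈ x x∈)) g-inj)
      where
      build : (∃ λ f → ∃ λ X′ → Iso f X X′ × (∀ x → x ∈ univ N → f (g x) ≡ x)) → Renamed X
      build (f , X′ , j , fg) = f , X′ , j , subst (_≼ X′)
        (Iso-unique (Iso-cong fg (Iso-∘ i (proj₂ (≼-restrict M′≼ j))))
                    (Iso-id (K-structure N (proj₂ (≼-K _ _ M≼)))))
        (proj₁ (≼-restrict M′≼ j)) ,
        λ x x∈ → trans (cong f (sym (g-id x x∈))) (fg x (≼⇒univ⊆ M≼ x x∈))
    compose : ∀ {f X X′ M₃} → Iso f X X′ → (∀ x → x ∈ univ M → f x ≡ x) →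
              EmbedsOver M X′ M₃ → EmbedsOver M X M₃
    compose {f} j f-id (k , (Y , Y≼ , j′) , k-id) = k ∘ f , (Y , Y≼ , Iso-∘ j j′) ,
      λ x x∈ → trans (cong k (f-id x x∈)) (k-id x x∈)

  extension-on-ordinal : ∀ {ν χ₁ χ₂ M N} → Dom ν M → M ≼ N → K[ ν ] N → AmalgamatesOver χ₁ χ₂ M N →
    ∃ λ M′ → (M ≼ M′ × Dom ν M′) × AmalgamatesOver χ₁ χ₂ M M′
  extension-on-ordinal d M≼ k amal =
    let (M′ , g , d′ , i , g-id) = ordinal-copy d M≼ k
    in M′ , d′ , amalgamates-copy M≼ i g-id amal

-- Extensions that realize all small tasks.

module Realizing {ℓ : Level} (𝒵 : ZFC ℓ) (τ : SetTheory.Vocabulary 𝒵)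
    (𝔨 : SetTheory.AEC 𝒵 τ) (LST : SetTheory.V 𝒵) (lsb : SetTheory.AEC.LSBound 𝔨 LST) where
  open SetTheoryLemmas 𝒵
  open AEC 𝔨
  open StructureLemmas 𝒵 τ
  open AECLemmas 𝒵 τ 𝔨
  open DirectedUnions 𝒵 τ 𝔨 using (⋃ₘ-cong; univ-⋃ₘ)
  open SmallSubmodels 𝒵 τ 𝔨 LST lsb
  open CompactAmalgamation 𝒵 τ 𝔨 LST lsb
  open Majorities 𝒵 τ 𝔨 LST lsb

  -- A crude superset of the structures on subsets of `δ`, chosen for its small size. Arities are
  -- subsets of `LST`, so a tuple is a subset of `LST ×ₛ δ`; relations consist of tuples, functions
  -- of pairs of a tuple and a value.
  tuplesBelow structuresBelow : V → V
  tuplesBelow δ     = 𝒫 (LST ×ₛ δ)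
  structuresBelow δ = 𝒫 δ ×ₛ 𝒫 (Sym ×ₛ 𝒫 (tuplesBelow δ ∪ tuplesBelow δ ×ₛ δ))

  structuresBelow-small : ∀ {ν δ} → PowerClosed ν → LST ∈ ν → Small ν δ → Small ν (structuresBelow δ)
  structuresBelow-small {ν} {δ} PC LST∈ sδ = small-× PC (small-𝒫 PC sδ) (small-𝒫 PC
    (small-× PC (small-Sym LST∈) (small-𝒫 PC (small-∪ PC tup (small-× PC tup sδ)))))
    where
    tup : Small ν (tuplesBelow δ)
    tup = small-𝒫 PC (small-× PC (small-∈ LST∈) sδ)

  ∈-structuresBelow : ∀ {A δ} → Structure A → univ A ⊆ δ → A ∈ structuresBelow δ
  ∈-structuresBelow {A} {δ} SA@(eq , F , rel , fun) sub =
    subst (_∈ structuresBelow δ) (sym eq) (∈-× (∈-𝒫 sub) (∈-𝒫 λ p p∈ →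
      let (s , s∈ , e) = function⁻ F p∈ in
      subst (_∈ Sym ×ₛ 𝒫 (tuplesBelow δ ∪ tuplesBelow δ ×ₛ δ)) (sym e) (∈-× s∈ (∈-𝒫 (interp⊆ s s∈ em)))))
    where
    tuple∈ : ∀ {s x} → s ∈ Sym → x ∈ tuples A s → x ∈ tuplesBelow δ
    tuple∈ {s} {x} s∈ x∈ = ∈-𝒫 λ p p∈ →
      let (i , i∈ , e) = function⁻ (proj₁ (^⁻ x∈)) p∈ in subst (_∈ LST ×ₛ δ) (sym e)
        (∈-× (arity-⊆LST s∈ i i∈) (sub _ (proj₂ (^⁻ x∈) i i∈)))
    interp⊆ : ∀ s → s ∈ Sym → Dec (s ∈ Fun) → interp A s ⊆ tuplesBelow δ ∪ tuplesBelow δ ×ₛ δ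
    interp⊆ s s∈ (no s∉) p p∈ = ∪ˡ (tuple∈ s∈ (rel s s∈ s∉ p p∈))
    interp⊆ s s∈ (yes f) p p∈ =
      let (x , x∈ , e) = function⁻ (proj₁ (fun s f)) p∈ in
      subst (_∈ tuplesBelow δ ∪ tuplesBelow δ ×ₛ δ) (sym e)
        (∪ʳ (∈-× (tuple∈ s∈ x∈) (sub _ (function-closed SA f x∈))))

  -- M is covered by the small submodels part j, j ∈ κ.  A task ⟨ j , A ⟩ is a structure A
  -- on an ordinal in ν, to be thought of as an extension of part j; a chain of length ν
  -- gives an extension of M in which each task is realized that is realized in some
  -- further extension in K[ ν ].
  module Tasks {ν κ : V} (PC : PowerClosed ν) (LST∈ν : LST ∈ ν) (inac : Inaccessible κ) (κ⊆ν : κ ⊆ ν)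
      (c : V → V) (c∈ : ∀ j → j ∈ κ → c j ∈ ν) (cover : ∀ γ → γ ∈ ν → Eventually κ λ j → γ ∈ c j)
      {M : V} (kM : K[ ν ] M) where

    Cν : Cardinal ν
    Cν = proj₁ (proj₁ PC)

    Oν : Ordinal ν
    Oν = proj₁ Cν

    initial : V → V → V
    initial N j = sep (univ N) λ x → injection (univ N) ν x ∈ c j

    initial-small : ∀ {N j} → j ∈ κ → univ N ≲ ν → Small ν (initial N j)
    initial-small {N} {j} j∈ N≲ = c j , c∈ j j∈ , injection (univ N) ν ,
      (λ x x∈ → proj₂ (sep⁻ _ x∈)) , λ x y x∈ y∈ →
        proj₂ (injection-spec N≲) x y (proj₁ (sep⁻ _ x∈)) (proj₁ (sep⁻ _ y∈))

    initial-cover : ∀ {N x} → univ N ≲ ν → x ∈ univ N → Eventually κ λ j → x ∈ initial N j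
    initial-cover {N} {x} N≲ x∈ =
      let (β , β∈ , h) = cover _ (proj₁ (injection-spec N≲) x x∈)
      in β , β∈ , λ j j∈ sub → ∈-sep _ x∈ (h j j∈ sub)

    Part : V → V → Set ℓ
    Part j X = X ≼ M × initial M j ⊆ univ X × Small ν (univ X)

    part : V → V
    part j = ε (Part j)

    part-spec : ∀ {j} → j ∈ κ → Part j (part j)
    part-spec {j} j∈ = ε-spec (Part j) (hull Cν LST∈ν (proj₁ kM) (λ x x∈ → proj₁ (sep⁻ _ x∈))
      (initial-small j∈ (≈⇒≲ (proj₂ (proj₂ kM)))))

    -- The ordinals below `order j` serve in tasks as names for the elements of `part j`.
    order : V → V
    order j = card (univ (part j))

    list : V → V → V
    list j = proj₁ (≈-sym (≈-card (univ (part j))))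

    list-bijective : ∀ j → Bijective (list j) (order j) (univ (part j))
    list-bijective j = proj₂ (≈-sym (≈-card (univ (part j))))

    -- Compatibility with the part is a condition on the map `f` rather than on tasks, which keeps
    -- the set of tasks easy to bound.
    Realized : V → V → Set ℓ
    Realized p N = ∃ λ f → (∃ λ G → G ≼ N × Iso f (π₂ p) G)
                         × (∀ i → i ∈ order (π₁ p) → f i ≡ list (π₁ p) i)

    Realized-mono : ∀ {p N N′} → N ≼ N′ → Realized p N → Realized p N′
    Realized-mono N≼ (f , (G , G≼ , i) , h) = f , (G , ≼-trans _ _ _ G≼ N≼ , i) , h

    IsTask : V → Set ℓ
    IsTask p = Structure (π₂ p) × univ (π₂ p) ∈ ν

    abstract
      tasks : V
      tasks = sep (κ ×ₛ ⋃ (image structuresBelow ν)) IsTask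

      ∈-tasks : ∀ {j A} → j ∈ κ → Structure A → univ A ∈ ν → ⟨ j , A ⟩ ∈ tasks
      ∈-tasks {j} {A} j∈ SA A∈ = ∈-sep IsTask
        (∈-× j∈ (∈-⋃image structuresBelow A∈ (∈-structuresBelow SA λ _ → id)))
        (subst (λ B → Structure B × univ B ∈ ν) (sym π₂-⟨⟩) (SA , A∈))

      -- Tasks are ranked by the larger of `j` and the ordinal that carries `A`; as `ν` is a strong
      -- limit, only a small set of structures lives below each `δ`.
      tasks-≲ : tasks ≲ ν
      tasks-≲ = rank-≲ (λ p → π₁ p ∪ univ (π₂ p)) (proj₁ PC)
        (λ p p∈ → let (p∈′ , _ , u∈) = sep⁻ IsTask p∈ in ∪-∈ Oν (π₁∈ p∈′) u∈) initial-segments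
        where
        π₁∈ : ∀ {p z} → p ∈ κ ×ₛ z → π₁ p ∈ ν
        π₁∈ p∈ = let (x , y , x∈ , _ , e) = ×⁻ p∈ in
          subst (_∈ ν) (trans (sym π₁-⟨⟩) (cong π₁ e)) (κ⊆ν x x∈)
        initial-segments : ∀ δ → δ ∈ ν → Small ν (sep tasks λ p → π₁ p ∪ univ (π₂ p) ∈ δ)
        initial-segments δ δ∈ = small-⊆ sub
          (small-× PC (small-∈ δ∈) (structuresBelow-small PC LST∈ν (small-∈ δ∈)))
          where
          Oδ : Ordinal δ
          Oδ = ord-∈ Oν δ∈
          sub : sep tasks (λ p → π₁ p ∪ univ (π₂ p) ∈ δ) ⊆ δ ×ₛ structuresBelow δ
          sub p p∈ =
            let (p∈T , r)         = sep⁻ (λ p → π₁ p ∪ univ (π₂ p) ∈ δ) p∈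
                (p∈′ , SA , u∈)   = sep⁻ IsTask p∈T
                (x , y , _ , _ , e) = ×⁻ p∈′
            in subst (_∈ δ ×ₛ structuresBelow δ)
                 (trans (cong₂ ⟨_,_⟩ (trans (cong π₁ (sym e)) π₁-⟨⟩) (trans (cong π₂ (sym e)) π₂-⟨⟩)) e)
                 (∈-× (⊆-∈ (ord-∈ Oν (π₁∈ p∈′)) Oδ (λ _ → ∪ˡ) r)
                      (∈-structuresBelow SA (proj₁ Oδ _ (⊆-∈ (ord-∈ Oν u∈) Oδ (λ _ → ∪ʳ) r))))

    task : V → V
    task = inverse (injection tasks ν) tasks

    Next : V → V → V → Set ℓ
    Next γ X Y = X ≼ Y × K[ ν ] Y × Realized (task γ) Y

    next′ : ∀ γ X → Dec (∃ (Next γ X)) → V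
    next′ γ X (yes (Y , _)) = Y
    next′ γ X (no _)        = X

    next : V → V → V
    next γ X = next′ γ X em

    next-extends : ∀ {γ X} → K[ ν ] X → X ≼ next γ X × K[ ν ] (next γ X)
    next-extends {γ} {X} kX = go em
      where
      go : ∀ d → X ≼ next′ γ X d × K[ ν ] (next′ γ X d)
      go (yes (_ , X≼ , kY , _)) = X≼ , kY
      go (no _)                  = ≼-refl X (proj₁ kX) , kX

    next-realizes : ∀ {γ X} → ∃ (Next γ X) → Realized (task γ) (next γ X)
    next-realizes {γ} {X} ex = go em
      where
      go : ∀ d → Realized (task γ) (next′ γ X d)
      go (yes (_ , _ , _ , r)) = r
      go (no none)             = ⊥-elim (none ex)

    stageAt : ∀ i → V → Dec (i ≡ ∅) → Dec (∃ λ γ → i ≡ S γ) → V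
    stageAt i g (yes _) _             = M
    stageAt i g (no _)  (yes (γ , _)) = next γ (g ′ γ)
    stageAt i g (no _)  (no _)        = ⋃ₘ (g ′_) i

    stage : V → V
    stage = trec λ i g → stageAt i g em em

    stage-∅ : stage ∅ ≡ M
    stage-∅ = trans (trec-≡ _ ∅-ord) (go em em)
      where
      go : ∀ d d′ → stageAt ∅ (lam ∅ stage) d d′ ≡ M
      go (yes _) _ = refl
      go (no ne) _ = ⊥-elim (ne refl)

    stage-S : ∀ {γ} → Ordinal γ → stage (S γ) ≡ next γ (stage γ)
    stage-S {γ} O = trans (trec-≡ _ (S-ord O)) (go em em)
      where
      go : ∀ d d′ → stageAt (S γ) (lam (S γ) stage) d d′ ≡ next γ (stage γ)
      go (yes e) _             = ⊥-elim (S≢∅ e)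
      go (no _)  (no ¬s)       = ⊥-elim (¬s (γ , refl))
      go (no _)  (yes (δ , e)) =
        subst (λ δ → next δ (lam (S γ) stage ′ δ) ≡ next γ (stage γ)) (S-injective e)
          (cong (next γ) (lam-β stage ∈-S))

    stage-limit : ∀ {δ} → Limit δ → stage δ ≡ ⋃ₘ stage δ
    stage-limit {δ} (O , ∅∈ , S∈) = trans (trec-≡ _ O) (go em em)
      where
      go : ∀ d d′ → stageAt δ (lam δ stage) d d′ ≡ ⋃ₘ stage δ
      go (yes e) _             = ⊥-elim (∉∅ (subst (∅ ∈_) e ∅∈))
      go (no _)  (yes (γ , e)) =
        ⊥-elim (∈-irrefl (subst (_∈ δ) (sym e) (S∈ γ (subst (γ ∈_) (sym e) ∈-S))))
      go (no _)  (no _)        = ⋃ₘ-cong {lam δ stage ′_} {stage} {δ} {δ}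
        (cong ⋃ (image-cong _ _ δ λ α α∈ → cong univ (lam-β stage α∈)))
        λ s s∈ → cong ⋃ (image-cong _ _ δ λ α α∈ → cong (λ N → interp N s) (lam-β stage α∈))

    Invariant : V → Set ℓ
    Invariant i = K[ ν ] (stage i) × M ≼ stage i × (∀ γ → γ ∈ i → stage γ ≼ stage i)

    invariant : ∀ i → Ordinal i → i ⊆ ν → Invariant i
    invariant = ord-ind (λ i → i ⊆ ν → Invariant i) λ i O ih i⊆ →
      let ih′ = λ γ γ∈ → ih γ γ∈ λ z z∈ → i⊆ z (proj₁ O γ γ∈ z z∈) in
      [ (λ e → subst Invariant (sym e) zero-case)
      , [ (λ (γ , γ∈ , e) → subst Invariant (sym e) (successor-case (ord-∈ O γ∈) (ih′ γ γ∈)))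
        , (λ L → limit-case L i⊆ ih′) ]′ ]′ (ord-cases O)
      where
      zero-case : Invariant ∅
      zero-case = subst (K[ ν ]) (sym stage-∅) kM ,
        subst (M ≼_) (sym stage-∅) (≼-refl M (proj₁ kM)) , λ γ γ∈ → ⊥-elim (∉∅ γ∈)
      successor-case : ∀ {γ} → Ordinal γ → Invariant γ → Invariant (S γ)
      successor-case {γ} O (k , M≼ , below) =
        let (γ≼ , k′) = next-extends {γ} k
            up : stage γ ≼ stage (S γ)
            up = subst (stage γ ≼_) (sym (stage-S O)) γ≼
        in subst (K[ ν ]) (sym (stage-S O)) k′ , ≼-trans _ _ _ M≼ up ,
           λ δ δ∈ → [ (λ p → ≼-trans _ _ _ (below δ p) up)
                    , (λ e → subst (λ δ → stage δ ≼ stage (S γ)) (sym e) up) ]′ (S⁻ δ∈)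
      limit-case : ∀ {δ} → Limit δ → δ ⊆ ν → (∀ γ → γ ∈ δ → Invariant γ) → Invariant δ
      limit-case {δ} L@(Oδ , ∅∈ , _) δ⊆ν ih =
        -- A union of at most `ν` models of size `ν` has size at most `ν`, and it contains `M`.
        (Kδ , Cν , cantor-schröder-bernstein
          (subst (_≲ ν) (sym univ≡) (≲-⋃ PC (univ ∘ stage) (⊆⇒≲ δ⊆ν)
            λ γ γ∈ → ≈⇒≲ (proj₂ (proj₂ (proj₁ (ih γ γ∈))))))
          (≲-trans (≈⇒≲ (≈-sym (proj₂ (proj₂ kM)))) (⊆⇒≲ (≼⇒univ⊆ M≼δ)))) ,
        M≼δ , below
        where
        chain : IncreasingContinuous stage δ
        chain = (λ γ γ∈ → proj₁ (proj₁ (ih γ γ∈))) , (λ γ γ′ γ∈ γ′∈ → proj₂ (proj₂ (ih γ γ∈)) γ′ γ′∈) ,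
          λ γ γ∈ Lγ → stage-limit Lγ
        up : K (⋃ₘ stage δ) × (∀ γ → γ ∈ δ → stage γ ≼ ⋃ₘ stage δ)
        up = chain-upper stage δ L chain
        Kδ : K (stage δ)
        Kδ = subst K (sym (stage-limit L)) (proj₁ up)
        below : ∀ γ → γ ∈ δ → stage γ ≼ stage δ
        below γ γ∈ = subst (stage γ ≼_) (sym (stage-limit L)) (proj₂ up γ γ∈)
        M≼δ : M ≼ stage δ
        M≼δ = ≼-trans _ _ _ (proj₁ (proj₂ (ih ∅ ∅∈))) (below ∅ ∅∈)
        univ≡ : univ (stage δ) ≡ ⋃ (image (univ ∘ stage) δ)
        univ≡ = trans (cong univ (stage-limit L)) (univ-⋃ₘ stage δ)

    abstract
      realizer : V
      realizer = stage ν

      realizer-K[] : K[ ν ] realizer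
      realizer-K[] = proj₁ (invariant ν Oν λ _ → id)

      M≼realizer : M ≼ realizer
      M≼realizer = proj₁ (proj₂ (invariant ν Oν λ _ → id))

      realizer-realizes : ∀ {p N} → p ∈ tasks → realizer ≼ N → K[ ν ] N → Realized p N → Realized p realizer
      realizer-realizes {p} {N} p∈ ≼N kN r = subst (λ q → Realized q (stage ν)) task≡
        (Realized-mono (below (S i) (S∈-infinite (proj₁ PC) i∈))
          (subst (Realized (task i)) (sym (stage-S (ord-∈ Oν i∈)))
            -- `N` extends `realizer` and so `stage i`; it therefore witnesses that the task was
            -- realizable at step `i`, and the step has realized it.
            (next-realizes (N , ≼-trans _ _ _ (below i i∈) ≼N , kN , subst (λ q → Realized q N) (sym task≡) r))))
        where
        i : V
        i = injection tasks ν p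
        i∈ : i ∈ ν
        i∈ = proj₁ (injection-spec tasks-≲) p p∈
        task≡ : task i ≡ p
        task≡ = inverse-β (injection-spec tasks-≲) p∈
        below : ∀ γ → γ ∈ ν → stage γ ≼ stage ν
        below = proj₂ (proj₂ (invariant ν Oν λ _ → id))

    -- The small parts of N₁ embed over those of M into the realizer, hence into N₂.
    module Amalgamation (compact : Compact κ ν) {N₁ N₂ : V} (≼₁ : realizer ≼ N₁) (≼₂ : realizer ≼ N₂)
                        (k₁ : K[ ν ] N₁) (k₂ : K[ ν ] N₂) where

      N₁≲ : univ N₁ ≲ ν
      N₁≲ = ≈⇒≲ (proj₂ (proj₂ k₁))

      M≼₁ : M ≼ N₁
      M≼₁ = ≼-trans _ _ _ M≼realizer ≼₁

      Part₁ : V → V → Set ℓ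
      Part₁ j X = X ≼ N₁ × univ (part j) ∪ initial N₁ j ⊆ univ X × Small ν (univ X)

      part₁ : V → V
      part₁ j = ε (Part₁ j)

      part₁-spec : ∀ {j} → j ∈ κ → Part₁ j (part₁ j)
      part₁-spec {j} j∈ = let (X≼ , _ , sX) = part-spec j∈ in
        ε-spec (Part₁ j) (hull Cν LST∈ν (proj₁ k₁)
          (∪-least (λ x x∈ → ≼⇒univ⊆ M≼₁ x (≼⇒univ⊆ X≼ x x∈)) (λ x x∈ → proj₁ (sep⁻ _ x∈)))
          (small-∪ PC sX (initial-small j∈ N₁≲)))

      EmbedsPart : V → (V → V) → Set ℓ
      EmbedsPart j h = (∃ λ G → G ≼ realizer × Iso h (part₁ j) G) × (∀ x → x ∈ univ (part j) → h x ≡ x)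

      -- `part₁ j` is copied onto an ordinal with the listing of `part j` at its start. The copy is
      -- a task realized in `N₁`, hence in `realizer`; prescribed listings make the composite map
      -- fix `part j`.
      embeds-part : ∀ {j} → j ∈ κ → ∃ (EmbedsPart j)
      embeds-part {j} j∈ =
        let (γ , e , enum) = enumeration (univ (part₁ j)) (order j) (list j)
              (proj₁ (card-cardinal (univ (part j))))
              ((λ i i∈ → proj₁ (proj₂ (part₁-spec j∈)) _ (∪ˡ (proj₁ (proj₁ (list-bijective j)) i i∈))) ,
               proj₂ (proj₁ (list-bijective j)))
        in code γ e enum
        where
        code : ∀ γ e → Enumerates (list j) (order j) e γ (univ (part₁ j)) → ∃ (EmbedsPart j)
        code γ e (Oγ , order⊆ , b@(e-inj , _) , e-list) = transport (realizer-realizes p∈ ≼₁ k₁ realized)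
          where
          X≼ : part₁ j ≼ N₁
          X≼ = proj₁ (part₁-spec j∈)
          g : V → V
          g = inverse e γ
          A : V
          A = transfer g (part₁ j)
          moved : univ A ≡ γ × Iso g (part₁ j) A × Iso e A (part₁ j)
          moved = transfer-back (proj₁ (≼-⊆ₘ _ _ X≼)) b
          i = proj₁ (proj₂ moved)
          γ∈ : γ ∈ ν
          γ∈ = [ (λ p → ⊥-elim (¬small-self Cν (small-≲ (≲-trans (⊆⇒≲ p) (e , e-inj))
                           (proj₂ (proj₂ (part₁-spec j∈)))))) , id ]′ (⊆-or-∋ Oν Oγ)
          p : V
          p = ⟨ j , A ⟩
          p∈ : p ∈ tasks
          p∈ = ∈-tasks j∈ (proj₁ (proj₂ i)) (subst (_∈ ν) (sym (proj₁ moved)) γ∈)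
          realized : Realized p N₁
          realized = e , (part₁ j , X≼ , subst (λ B → Iso e B (part₁ j)) (sym π₂-⟨⟩) (proj₂ (proj₂ moved))) ,
            subst (λ k → ∀ i → i ∈ order k → e i ≡ list k i) (sym π₁-⟨⟩) e-list
          transport : Realized p realizer → ∃ (EmbedsPart j)
          transport (f , (G , G≼ , i′) , f-list) =
            f ∘ g , (G , G≼ , Iso-∘ i (subst (λ B → Iso f B G) π₂-⟨⟩ i′)) , fixes
            where
            f-list′ : ∀ i → i ∈ order j → f i ≡ list j i
            f-list′ = subst (λ k → ∀ i → i ∈ order k → f i ≡ list k i) π₁-⟨⟩ f-list
            fixes : ∀ x → x ∈ univ (part j) → f (g x) ≡ x
            fixes x x∈ =
              let (i , i∈ , eq) = proj₂ (list-bijective j) x x∈ in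
              subst (λ x → f (g x) ≡ x) eq
                (trans (cong f (trans (cong g (sym (e-list i i∈))) (inverse-β e-inj (order⊆ i i∈))))
                  (f-list′ i i∈))

      -- `Approximates` asks for values in `N₂` at every element of `N₁`; this is the value outside
      -- `part₁ j`.
      y₀ : ∃ λ y → y ∈ univ N₂
      y₀ = let (f , (f∈ , _) , _) = ≈-sym (proj₂ (proj₂ k₂)) in f ∅ , f∈ ∅ (∅∈-infinite (proj₁ PC))

      embeddings : ∃ λ (h : V → V → V) → ∀ j → j ∈ κ → EmbedsPart j (h j)
      embeddings = choice-on EmbedsPart id λ j → embeds-part

      value : ∀ j x → Dec (x ∈ univ (part₁ j)) → V
      value j x (yes _) = proj₁ embeddings j x
      value j x (no _)  = proj₁ y₀

      h₁ : V → V → V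
      h₁ j x = value j x em

      h₁-≡ : ∀ {j x} → x ∈ univ (part₁ j) → h₁ j x ≡ proj₁ embeddings j x
      h₁-≡ {j} {x} x∈ = go em
        where
        go : ∀ d → value j x d ≡ proj₁ embeddings j x
        go (yes _) = refl
        go (no ¬x) = ⊥-elim (¬x x∈)

      h₁-∈ : ∀ j → j ∈ κ → ∀ x → x ∈ univ N₁ → h₁ j x ∈ univ N₂
      h₁-∈ j j∈ x _ = go em
        where
        go : ∀ d → value j x d ∈ univ N₂
        go (no _)   = proj₂ y₀
        go (yes x∈) = let ((G , G≼ , (_ , _ , ((f∈ , _) , _) , _)) , _) = proj₂ embeddings j j∈ in
          ≼⇒univ⊆ ≼₂ _ (≼⇒univ⊆ G≼ _ (f∈ x x∈))

      -- Each element of `X` is in all late pieces `initial N₁ j`; as `X` is small and `κ` is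
      -- regular, all of `X` is in `part₁ j` for late `j`.
      h₁-local : ∀ X → X ≼ N₁ → Small κ (univ X) →
                 Eventually κ λ j → ∃ λ G → G ≼ N₂ × Iso (h₁ j) X G
      h₁-local X X≼ sX = finish (small-bounded inac from-stage sX λ x x∈ → proj₁ (from-spec x∈))
        where
        From : V → V → Set ℓ
        From x β = β ∈ κ × (∀ j → j ∈ κ → β ⊆ j → x ∈ initial N₁ j)
        from-stage : V → V
        from-stage x = ε (From x)
        from-spec : ∀ {x} → x ∈ univ X → From x (from-stage x)
        from-spec {x} x∈ = ε-spec (From x) (initial-cover N₁≲ (≼⇒univ⊆ X≼ x x∈))
        finish : (∃ λ γ → γ ∈ κ × (∀ x → x ∈ univ X → from-stage x ⊆ γ)) →
                 Eventually κ λ j → ∃ λ G → G ≼ N₂ × Iso (h₁ j) X G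
        finish (γ , γ∈ , bd) = γ , γ∈ , λ j j∈ γ⊆ →
          let X⊆ : univ X ⊆ univ (part₁ j)
              X⊆ = λ x x∈ → proj₁ (proj₂ (part₁-spec j∈)) x
                (∪ʳ (proj₂ (from-spec x∈) j j∈ λ z z∈ → γ⊆ z (bd x x∈ z z∈)))
              ((G , G≼ , i) , _) = proj₂ embeddings j j∈
              (t≼ , i′) = ≼-restrict (≼-within X≼ (proj₁ (part₁-spec j∈)) X⊆) i
          in _ , ≼-trans _ _ _ t≼ (≼-trans _ _ _ G≼ ≼₂) ,
             Iso-cong (λ x x∈ → sym (h₁-≡ (X⊆ x x∈))) i′

      result : Amalgam M N₁ N₂
      -- Every `P j` is `N₂`: its own maps are identities, and those of `N₁` come from the embedded
      -- parts.
      result = compact (λ _ → N₂) h₁ (λ _ → id) M N₁ N₂ M≼₁ (≼-trans _ _ _ M≼realizer ≼₂)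
        N₁≲ (≈⇒≲ (proj₂ (proj₂ k₂))) (λ _ _ → proj₁ k₂) (h₁-∈ , h₁-local)
        ((λ _ _ _ x∈ → x∈) , λ X X≼ _ → ∅ , ∅∈-infinite (proj₁ (proj₁ inac)) ,
          λ j j∈ _ → X , X≼ , Iso-id (proj₁ (≼-⊆ₘ _ _ X≼)))
        λ x x∈ → let (β , β∈ , h) = initial-cover (≈⇒≲ (proj₂ (proj₂ kM))) x∈ in
          β , β∈ , λ j j∈ sub →
            let x∈part = proj₁ (proj₂ (part-spec j∈)) x (h j j∈ sub) in
            trans (h₁-≡ (proj₁ (proj₂ (part₁-spec j∈)) x (∪ˡ x∈part))) (proj₂ (proj₂ embeddings j j∈) x x∈part)

  amalgamating-extension : ∀ {ν κ} → PowerClosed ν → LST ∈ ν → Inaccessible κ → κ ⊆ ν →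
    (c : V → V) → (∀ j → j ∈ κ → c j ∈ ν) → (∀ γ → γ ∈ ν → Eventually κ λ j → γ ∈ c j) →
    Compact κ ν → ∀ {M} → K[ ν ] M → ∃ λ N → M ≼ N × K[ ν ] N × AmalgamatesOver ν ν M N
  amalgamating-extension PC LST∈ν inac κ⊆ν c c∈ cover compact kM =
    realizer , M≼realizer , realizer-K[] , λ N₁ N₂ ≼₁ ≼₂ k₁ k₂ → Amalgamation.result compact ≼₁ ≼₂ k₁ k₂
    where open Tasks PC LST∈ν inac κ⊆ν c c∈ cover kM

-- The three cases of the theorem.

module Conclusion {ℓ : Level} (𝒵 : ZFC ℓ) (τ : SetTheory.Vocabulary 𝒵)
    (𝔨 : SetTheory.AEC 𝒵 τ) (LST : SetTheory.V 𝒵) (lsb : SetTheory.AEC.LSBound 𝔨 LST) where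
  open SetTheoryLemmas 𝒵
  open AEC 𝔨
  open CompactAmalgamation 𝒵 τ 𝔨 LST lsb
  open Majorities 𝒵 τ 𝔨 LST lsb
  open Realizing 𝒵 τ 𝔨 LST lsb

  dense⇒majority : ∀ {κ θ χ₁ χ₂} → Cardinal κ → Measurable θ → LST ∈ θ →
    (∀ M → Dom κ M → univ M ≲ χ₁ × univ M ≲ χ₂) →
    (∀ M → K[ κ ] M → ∃ λ N → M ≼ N × K[ κ ] N × AmalgamatesOver χ₁ χ₂ M N) →
    HasAmalgamationBases₂ χ₁ χ₂ κ θ
  dense⇒majority {κ} {θ} {χ₁} {χ₂} Cκ mθ LST∈θ sizes dense = majority mθ LST∈θ sizes λ M d →
    let (N , M≼ , kN , amal) = dense M (proj₁ d , Cκ , Dom⇒≈ Cκ d)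
    in extension-on-ordinal d M≼ kN amal

  same-size : ∀ {κ} → Cardinal κ → ∀ M → Dom κ M → univ M ≲ κ × univ M ≲ κ
  same-size Cκ M d = ≈⇒≲ (Dom⇒≈ Cκ d) , ≈⇒≲ (Dom⇒≈ Cκ d)

  weakly-compact-case : ∀ κ θ → θ ∈ κ → LST ∈ θ → Measurable θ → WeaklyCompact κ → HasAmalgamationBases κ θ
  weakly-compact-case κ θ θ∈κ LST∈θ mθ wκ = dense⇒majority Cκ mθ LST∈θ (same-size Cκ) λ M kM →
    -- Here the size is `κ` itself and the pieces are initial segments: `c` is the identity, and `γ`
    -- belongs to `j` from `S γ` on.
    amalgamating-extension (proj₁ inaccessible) LST∈κ inaccessible (λ _ → id) id (λ _ → id)
      (λ γ γ∈ → S γ , S∈-infinite infiniteCardinal γ∈ , λ j j∈ sub → sub γ ∈-S)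
      (weaklyCompact⇒compact wκ LST∈κ) kM
    where
    open WeaklyCompactCardinal wκ
    Cκ : Cardinal κ
    Cκ = proj₁ wκ
    LST∈κ : LST ∈ κ
    LST∈κ = proj₁ (proj₁ Cκ) θ θ∈κ LST LST∈θ

  singular-case : ∀ κ θ μ → Measurable κ → Measurable θ → LST ∈ κ → LST ∈ θ → κ ∈ μ →
                  StrongLimit μ → Cofinality μ κ → HasAmalgamationBases μ θ
  singular-case κ θ μ mκ mθ LST∈κ LST∈θ κ∈μ sl@(Iμ@(Cμ@(Oμ , _) , _) , _)
                (Oκ , (f , f∈ , f-cofinal) , no-shorter) =
    dense⇒majority Cμ mθ LST∈θ (same-size Cμ) λ M kM →
      amalgamating-extension (strongLimit⇒powerClosed sl) (proj₁ Oμ κ κ∈μ LST LST∈κ) inaccessible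
        (proj₁ Oμ κ κ∈μ) c c∈ cover (measurable⇒compact mκ LST∈κ) kM
    where
    open MeasurableCardinal mκ
    f-ord : ∀ {i} → i ∈ κ → Ordinal (f i)
    f-ord i∈ = ord-∈ Oμ (f∈ _ i∈)
    -- The cofinal map `f` need not be increasing, but the suprema of its initial segments are. They
    -- stay below `μ`, since otherwise fewer than `κ` values would be cofinal.
    c : V → V
    c j = ⋃ (image f (S j))
    c∈ : ∀ j → j ∈ κ → c j ∈ μ
    c∈ j j∈ = by-contradiction λ c∉ → no-shorter (S j) (S∈-infinite infiniteCardinal j∈) (f ,
      (λ i i∈ → f∈ i (below i i∈)) ,
      λ γ γ∈ → by-contradiction λ none → c∉ (⊆-∈ c-ord Oμ
        (λ z z∈ → let (i , i∈ , z∈i) = ⋃image⁻ f z∈ in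
          [ (λ p → ⊥-elim (none (i , i∈ , p)))
          , (λ p → proj₁ (ord-∈ Oμ γ∈) _ p z z∈i) ]′ (⊆-or-∋ (ord-∈ Oμ γ∈) (f-ord (below i i∈)))) γ∈))
      where
      below : S j ⊆ κ
      below = ∈⇒S⊆ Oκ j∈
      c-ord : Ordinal (c j)
      c-ord = ⋃image-ord f λ i i∈ → f-ord (below i i∈)
    cover : ∀ γ → γ ∈ μ → Eventually κ λ j → γ ∈ c j
    cover γ γ∈ =
      let (i , i∈ , sub) = f-cofinal (S γ) (S∈-infinite Iμ γ∈)
      in i , i∈ , λ j j∈ i⊆j → ∈-⋃image f (⊆-∈ (ord-∈ Oκ i∈) (S-ord (ord-∈ Oκ j∈)) i⊆j ∈-S) (sub γ ∈-S)

  dense-case : ∀ κ θ χ₁ χ₂ → Cardinal κ → LST ∈ θ → Measurable θ →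
    (∀ M → K[ κ ] M → ∃ λ N → M ≼ N × K[ κ ] N × AmalgamationBase χ₁ χ₂ N) →
    HasAmalgamationBases₂ χ₁ χ₂ κ θ
  dense-case κ θ χ₁ χ₂ Cκ LST∈θ mθ dense = dense⇒majority Cκ mθ LST∈θ
    -- The bounds on the size of `M` are read off from an amalgamation base above it.
    (λ M d → let (N , M≼ , _ , (_ , s₁ , s₂ , _)) = dense M (proj₁ d , Cκ , Dom⇒≈ Cκ d) in
      ≲-trans (⊆⇒≲ (≼⇒univ⊆ M≼)) s₁ , ≲-trans (⊆⇒≲ (≼⇒univ⊆ M≼)) s₂)
    λ M kM → let (N , M≼ , kN , (_ , _ , _ , base)) = dense M kM in
      N , M≼ , kN , λ N₁ N₂ ≼₁ ≼₂ k₁ k₂ →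
        let (M₃ , N≼ , e₁ , e₂) = base N₁ N₂ ≼₁ ≼₂ k₁ k₂
        in M₃ , ≼-trans _ _ _ M≼ N≼ , weaken M≼ e₁ , weaken M≼ e₂
    where
    open AECLemmas 𝒵 τ 𝔨 using (≼⇒univ⊆)
    weaken : ∀ {M N X Y} → M ≼ N → EmbedsOver N X Y → EmbedsOver M X Y
    weaken M≼ (f , sub , h) = f , sub , λ x x∈ → h x (≼⇒univ⊆ M≼ x x∈)

claim1p12 : ∀ {ℓ : Level} (𝒵 : ZFC ℓ) → let open SetTheory 𝒵 in
    ∀ (τ : Vocabulary) (𝔨 : AEC τ) → let open AEC 𝔨 in
    ∀ (LST : V) → IsLST LST →
    (∀ κ θ → θ ∈ κ → LST ∈ θ → Measurable θ → WeaklyCompact κ →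
    HasAmalgamationBases κ θ)
    × (∀ κ θ μ → Measurable κ → Measurable θ → LST ∈ κ → LST ∈ θ →
    κ ∈ μ → θ ∈ μ → StrongLimit μ → Singular μ → Cofinality μ κ →
    HasAmalgamationBases μ θ)
    × (∀ κ θ χ₁ χ₂ → Cardinal κ → Cardinal χ₁ → Cardinal χ₂ →
    θ ∈ κ → LST ∈ θ → Measurable θ →
    (∀ M → K[ κ ] M →
    ∃ λ N → M ≼ N × K[ κ ] N × AmalgamationBase χ₁ χ₂ N) →
    HasAmalgamationBases₂ χ₁ χ₂ κ θ)
claim1p12 𝒵 τ 𝔨 LST (lsb , _) =
  weakly-compact-case ,
  (λ κ θ μ mκ mθ LST∈κ LST∈θ κ∈μ _ sl _ cof → singular-case κ θ μ mκ mθ LST∈κ LST∈θ κ∈μ sl cof) ,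
  λ κ θ χ₁ χ₂ Cκ _ _ _ LST∈θ mθ → dense-case κ θ χ₁ χ₂ Cκ LST∈θ mθ
  where open Conclusion 𝒵 τ 𝔨 LST lsb
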